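{- Suppose that every unstable NIP theory interprets an infinite linear order. Then every theory which is both NIP and SOP (i.e. has the strict order property) is not hereditarily G-compact.
   Context: Theories are complete first-order theories; structures may be many-sorted (possibly with infinitely many sorts). A theory interprets a structure if some model of it does, possibly with parameters. An interpreted structure $N$ may be many-sorted: each of its sorts is a definable set modulo a definable equivalence relation, and its basic relations and functions are definable in the interpreting structure, where parameters are allowed. Lascar distance: let $\mathfrak C$ be a monster model of a theory. For small (possibly infinite) tuples $a,b\in\mathfrak C$ write $d_L(a,b)\le n$ if there are tuples $a=a_0,a_1,\dots,a_n=b$ and small $M_1,\dots,M_n\preceq\mathfrak C$ such that $\operatorname{tp}(a_{i-1}/M_i)=\operatorname{tp}(a_i/M_i)$ for $i=1,\dots,n$. $d_L(a,b)$ is the least such $n$, or $\infty$ if there is none. A theory is G-compact if for every tuple $a$ there is an integer $n$ such that for all $b$, $d_L(a,b)<\infty$ implies $d_L(a,b)\le n$. A theory $T$ is hereditarily G-compact if for every model $M\models T$ and every structure $N$ interpreted by $M$ (with parameters), $\operatorname{Th}(N)$ is G-compact. The hypothesis that every unstable NIP theory interprets an infinite linear order is an open conjecture; the statement is conditional on it. -}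

module Defs where

open import Level using (Level; _⊔_; 0ℓ) renaming (suc to lsuc)
open import Data.Bool.Base using (Bool; true)
open import Data.Empty using (⊥)
import Data.Empty.Polymorphic as Empty
open import Data.Fin.Base using (Fin)
open import Data.List.Base using (List; []; _∷_; length; lookup)
open import Data.List.Relation.Unary.All using (All)
open import Data.Maybe.Base using (Maybe; just; nothing; maybe′)
open import Data.Nat.Base using (ℕ; zero; suc; _<_)
open import Data.Product.Base using (Σ; Σ-syntax; ∃; ∃-syntax; _×_; _,_; proj₁; proj₂; curry)
open import Data.Sum.Base using (_⊎_; inj₁; inj₂; [_,_]′)
open import Data.Unit.Polymorphic.Base using (⊤; tt)
open import Function.Base using (_∘_)
open import Function.Bundles using (_⇔_; Injection; Inverse)
open import Relation.Binary.Bundles using (Setoid)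
open import Relation.Binary.Structures using (IsTotalOrder)
open import Relation.Binary.PropositionalEquality using (_≡_; setoid)
open import Relation.Nullary.Negation.Core using (¬_)
open import Relation.Unary using (Pred; _⊂_)

open Setoid using (Carrier)

------------------------------------------------------------------------
-- Many-sorted first-order logic

-- A sorted family of variables, possibly infinite.  Only finitely many of
-- them occur in any one formula.
record Context {s} (S : Set s) (i : Level) : Set (s ⊔ lsuc i) where
  constructor ctx
  field
    Index : Set i
    sort  : Index → S

open Context public

module _ {s} {S : Set s} where

  ⟦_⟧ : List S → Context S 0ℓ
  ⟦ ss ⟧ = ctx (Fin (length ss)) (lookup ss)

  ∅ : Context S 0ℓ
  ∅ = ctx ⊥ λ ()

  infixl 6 _▹_ _⊕_

  _▹_ : ∀ {i} → Context S i → S → Context S i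
  Γ ▹ t = ctx (Maybe (Index Γ)) (maybe′ (sort Γ) t)

  _⊕_ : ∀ {i j} → Context S i → Context S j → Context S (i ⊔ j)
  Γ ⊕ Δ = ctx (Index Γ ⊎ Index Δ) [ sort Γ , sort Δ ]′

-- Concatenation and extension of tuples.
module _ {i c : Level} {I : Set i} where

  infixl 6 _▸_ _⊞_

  _▸_ : {C : Maybe I → Set c} → (∀ x → C (just x)) → C nothing → ∀ x → C x
  (a ▸ c) (just x) = a x
  (a ▸ c) nothing  = c

  _⊞_ : ∀ {j} {J : Set j} {C : I ⊎ J → Set c} →
        (∀ x → C (inj₁ x)) → (∀ y → C (inj₂ y)) → ∀ x → C x
  (a ⊞ b) (inj₁ x) = a x
  (a ⊞ b) (inj₂ y) = b y

record Signature (ℓ : Level) : Set (lsuc ℓ) where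
  field
    Sort : Set ℓ
    Fun  : List Sort → Sort → Set ℓ
    Rel  : List Sort → Set ℓ

open Signature public

module _ {ℓ} (L : Signature ℓ) where

  data Term {i} (Γ : Context (Sort L) i) : Sort L → Set (ℓ ⊔ i) where
    var : (x : Index Γ) → Term Γ (sort Γ x)
    app : ∀ {ss t} → Fun L ss t → (∀ k → Term Γ (lookup ss k)) → Term Γ t

  infix  5 _≐_
  infixr 4 _⇒_

  -- The logic is classical, so these connectives suffice.
  data Formula {i} (Γ : Context (Sort L) i) : Set (ℓ ⊔ i) where
    _≐_  : ∀ {t} → Term Γ t → Term Γ t → Formula Γ
    atom : ∀ {ss} → Rel L ss → (∀ k → Term Γ (lookup ss k)) → Formula Γ
    ⊥̇    : Formula Γ
    _⇒_  : Formula Γ → Formula Γ → Formula Γ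
    ∀̇    : ∀ t → Formula (Γ ▹ t) → Formula Γ

  Sentence : Set ℓ
  Sentence = Formula ∅

  Theory : Set (lsuc ℓ)
  Theory = Pred Sentence ℓ

  -- Sorts are setoids, which is how quotients by definable equivalence
  -- relations can be structures.
  record Structure (m : Level) : Set (ℓ ⊔ lsuc m) where
    field
      Dom : Sort L → Setoid m m

    infix 4 _≈_
    _≈_ : ∀ {t} → Carrier (Dom t) → Carrier (Dom t) → Set m
    _≈_ {t} = Setoid._≈_ (Dom t)

    field
      fun      : ∀ {ss t} → Fun L ss t →
                 (∀ k → Carrier (Dom (lookup ss k))) → Carrier (Dom t)
      fun-cong : ∀ {ss t} (f : Fun L ss t) {xs ys} →
                 (∀ k → xs k ≈ ys k) → fun f xs ≈ fun f ys
      rel      : ∀ {ss} → Rel L ss →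
                 (∀ k → Carrier (Dom (lookup ss k))) → Set m
      rel-resp : ∀ {ss} (R : Rel L ss) {xs ys} →
                 (∀ k → xs k ≈ ys k) → rel R xs → rel R ys

infix 9 ∼_
∼_ : ∀ {ℓ} {L : Signature ℓ} {i} {Γ : Context (Sort L) i} →
     Formula L Γ → Formula L Γ
∼ φ = φ ⇒ ⊥̇

module _ {ℓ} {L : Signature ℓ} where

  ∣_∣ : ∀ {m} → Structure L m → Sort L → Set m
  ∣ M ∣ t = Carrier (Structure.Dom M t)

  Tuple : ∀ {m i} → Structure L m → Context (Sort L) i → Set (m ⊔ i)
  Tuple M Γ = ∀ x → ∣ M ∣ (sort Γ x)

  eval : ∀ {m i} (M : Structure L m) {Γ : Context (Sort L) i} {t} →
         Tuple M Γ → Term L Γ t → ∣ M ∣ t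
  eval M a (var x)    = a x
  eval M a (app f ts) = Structure.fun M f λ k → eval M a (ts k)

  infix 4 _⊨_[_] _⊨_ _⊨ᵀ_

  _⊨_[_] : ∀ {m i} (M : Structure L m) {Γ : Context (Sort L) i} →
           Formula L Γ → Tuple M Γ → Set m
  M ⊨ t ≐ u     [ a ] = Structure._≈_ M (eval M a t) (eval M a u)
  M ⊨ atom R ts [ a ] = Structure.rel M R λ k → eval M a (ts k)
  M ⊨ ⊥̇         [ a ] = Empty.⊥
  M ⊨ φ ⇒ ψ     [ a ] = M ⊨ φ [ a ] → M ⊨ ψ [ a ]
  M ⊨ ∀̇ t φ     [ a ] = (c : ∣ M ∣ t) → M ⊨ φ [ a ▸ c ]

  _⊨_ : ∀ {m} → Structure L m → Sentence L → Set m
  M ⊨ σ = M ⊨ σ [ (λ ()) ]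

  _⊨ᵀ_ : ∀ {m} → Structure L m → Theory L → Set (ℓ ⊔ m)
  M ⊨ᵀ T = ∀ σ → T σ → M ⊨ σ

  module _ {m} (M : Structure L m) where

    -- All elements of M, listed as one tuple.
    Elements : Context (Sort L) (ℓ ⊔ m)
    Elements = ctx (Σ (Sort L) ∣ M ∣) proj₁

    elements : Tuple M Elements
    elements = proj₂

    -- Definability with parameters from M.
    Definable : ∀ {i p} (Γ : Context (Sort L) i) → Pred (Tuple M Γ) p →
                Set (ℓ ⊔ m ⊔ i ⊔ p)
    Definable Γ P =
      Σ[ φ ∈ Formula L (Γ ⊕ Elements) ]
        ∀ a → P a ⇔ M ⊨ φ [ a ⊞ elements ]

  Th : Structure L ℓ → Theory L
  Th M σ = M ⊨ σ

  -- By Löwenheim–Skolem, models in Set ℓ suffice for theories in Set ℓ.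
  Complete : Theory L → Set (lsuc ℓ)
  Complete T =
    (Σ[ M ∈ Structure L ℓ ] M ⊨ᵀ T) ×
    (∀ σ → ((M : Structure L ℓ) → M ⊨ᵀ T → M ⊨ σ) ⊎
           ((M : Structure L ℓ) → M ⊨ᵀ T → M ⊨ ∼ σ))

------------------------------------------------------------------------
-- Dividing lines, for partitioned formulas φ(x; y) with x, y finite tuples

module _ {ℓ} {L : Signature ℓ} (T : Theory L) {X Y : List (Sort L)}
         (φ : Formula L (⟦ X ⟧ ⊕ ⟦ Y ⟧)) where

  HasIP : Set (lsuc ℓ)
  HasIP =
    Σ[ M ∈ Structure L ℓ ] M ⊨ᵀ T ×
    Σ[ a ∈ (ℕ → Tuple M ⟦ X ⟧) ] Σ[ b ∈ ((ℕ → Bool) → Tuple M ⟦ Y ⟧) ]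
      (∀ i J → M ⊨ φ [ a i ⊞ b J ] ⇔ J i ≡ true)

  HasOP : Set (lsuc ℓ)
  HasOP =
    Σ[ M ∈ Structure L ℓ ] M ⊨ᵀ T ×
    Σ[ a ∈ (ℕ → Tuple M ⟦ X ⟧) ] Σ[ b ∈ (ℕ → Tuple M ⟦ Y ⟧) ]
      (∀ i j → M ⊨ φ [ a i ⊞ b j ] ⇔ i < j)

  HasSOP : Set (lsuc ℓ)
  HasSOP =
    Σ[ M ∈ Structure L ℓ ] M ⊨ᵀ T ×
    Σ[ b ∈ (ℕ → Tuple M ⟦ Y ⟧) ]
      (∀ i j → i < j →
        (λ (a : Tuple M ⟦ X ⟧) → M ⊨ φ [ a ⊞ b i ]) ⊂ (λ a → M ⊨ φ [ a ⊞ b j ]))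

module _ {ℓ} {L : Signature ℓ} (T : Theory L) where

  NIP Stable SOP : Set (lsuc ℓ)
  NIP    = ∀ X Y (φ : Formula L (⟦ X ⟧ ⊕ ⟦ Y ⟧)) → ¬ HasIP T {X} {Y} φ
  Stable = ∀ X Y (φ : Formula L (⟦ X ⟧ ⊕ ⟦ Y ⟧)) → ¬ HasOP T {X} {Y} φ
  SOP    = ∃[ X ] ∃[ Y ] Σ[ φ ∈ Formula L (⟦ X ⟧ ⊕ ⟦ Y ⟧) ] HasSOP T {X} {Y} φ

------------------------------------------------------------------------
-- Interpretations

-- M interprets N (with parameters): every sort s of N is, via the surjection
-- coord s, a definable set U s of tuples of M modulo a definable equivalence
-- relation (the kernel of coord s), and the preimages of the basic relations
-- and of the graphs of the basic functions are definable.
record Interpretation {ℓ} {L K : Signature ℓ}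
                      (M : Structure L ℓ) (N : Structure K ℓ) : Set (lsuc ℓ) where
  open Structure N using (_≈_; fun; rel)
  field
    dim : Sort K → List (Sort L)

  Rep : Sort K → Set ℓ
  Rep s = Tuple M ⟦ dim s ⟧

  -- The variables of a sequence of representatives, one for each of ss.
  Reps : List (Sort K) → Context (Sort L) 0ℓ
  Reps ss = ctx (Σ[ k ∈ Fin (length ss) ] Fin (length (dim (lookup ss k))))
                (λ (k , j) → lookup (dim (lookup ss k)) j)

  field
    U          : ∀ s → Pred (Rep s) ℓ
    coord      : ∀ s → ∃ (U s) → ∣ N ∣ s
    coord-cong : ∀ s {x y : ∃ (U s)} →
                 (∀ j → Structure._≈_ M (proj₁ x j) (proj₁ y j)) →
                 coord s x ≈ coord s y
    coord-surj : ∀ s (y : ∣ N ∣ s) → ∃[ x ] coord s x ≈ y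

    U-definable   : ∀ s → Definable M ⟦ dim s ⟧ (U s)
    ≈-definable   : ∀ s → Definable M (⟦ dim s ⟧ ⊕ ⟦ dim s ⟧) λ a →
                    Σ[ u ∈ U s (a ∘ inj₁) ] Σ[ v ∈ U s (a ∘ inj₂) ]
                      coord s (a ∘ inj₁ , u) ≈ coord s (a ∘ inj₂ , v)
    rel-definable : ∀ {ss} (R : Rel K ss) → Definable M (Reps ss) λ a →
                    Σ[ u ∈ (∀ k → U (lookup ss k) (curry a k)) ]
                      rel R (λ k → coord (lookup ss k) (curry a k , u k))
    fun-definable : ∀ {ss t} (f : Fun K ss t) →
                    Definable M (Reps ss ⊕ ⟦ dim t ⟧) λ a →
                    Σ[ u ∈ (∀ k → U (lookup ss k) (curry (a ∘ inj₁) k)) ]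
                    Σ[ v ∈ U t (a ∘ inj₂) ]
                      fun f (λ k → coord (lookup ss k) (curry (a ∘ inj₁) k , u k))
                        ≈ coord t (a ∘ inj₂ , v)

data OrderSymbol {ℓ} : List (⊤ {ℓ}) → Set ℓ where
  le : OrderSymbol (tt ∷ tt ∷ [])

orderSignature : ∀ ℓ → Signature ℓ
orderSignature ℓ = record
  { Sort = ⊤
  ; Fun  = λ _ _ → Empty.⊥
  ; Rel  = OrderSymbol
  }

record IsInfiniteLinearOrder {ℓ} (N : Structure (orderSignature ℓ) ℓ) : Set ℓ where
  open Structure N using (Dom; _≈_; rel)

  _≤_ : ∣ N ∣ tt → ∣ N ∣ tt → Set ℓ
  x ≤ y = rel le λ { Fin.zero → x ; (Fin.suc Fin.zero) → y }

  field
    isTotalOrder : IsTotalOrder (_≈_ {tt}) _≤_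
    infinite     : Injection (setoid ℕ) (Dom tt)

InterpretsInfiniteLinearOrder : ∀ {ℓ} {L : Signature ℓ} → Theory L → Set (lsuc ℓ)
InterpretsInfiniteLinearOrder {ℓ} {L} T =
  Σ[ M ∈ Structure L ℓ ] M ⊨ᵀ T ×
  Σ[ N ∈ Structure (orderSignature ℓ) ℓ ] IsInfiniteLinearOrder N × Interpretation M N

------------------------------------------------------------------------
-- Monster models and Lascar distance
--
-- For a theory in Set ℓ, a monster model lives one universe up, and "small"
-- means indexed by a type in Set ℓ.

module _ {ℓ} {L : Signature ℓ} where

  module _ {m} (M : Structure L m) where

    -- tp(a/c) = tp(b/c)
    SameType : ∀ {i j} {Γ : Context (Sort L) i} {Δ : Context (Sort L) j} →
               Tuple M Δ → Tuple M Γ → Tuple M Γ → Set (ℓ ⊔ m ⊔ i ⊔ j)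
    SameType {Γ = Γ} {Δ} c a b =
      (φ : Formula L (Γ ⊕ Δ)) → M ⊨ φ [ a ⊞ c ] ⇔ M ⊨ φ [ b ⊞ c ]

    record Automorphism : Set (ℓ ⊔ m) where
      open Structure M using (Dom; _≈_; fun; rel)
      field
        inverse : ∀ t → Inverse (Dom t) (Dom t)

      to : ∀ {t} → ∣ M ∣ t → ∣ M ∣ t
      to {t} = Inverse.to (inverse t)

      field
        fun-homo : ∀ {ss t} (f : Fun L ss t) xs → to (fun f xs) ≈ fun f (λ k → to (xs k))
        rel-homo : ∀ {ss} (R : Rel L ss) xs → rel R xs ⇔ rel R (λ k → to (xs k))

  record IsMonster (T : Theory L) (ℭ : Structure L (lsuc ℓ)) : Set (lsuc (lsuc ℓ)) where
    field
      model : ℭ ⊨ᵀ T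

      saturated :
        ∀ {Γ Δ : Context (Sort L) ℓ} (c : Tuple ℭ Δ) (p : Pred (Formula L (Γ ⊕ Δ)) ℓ) →
        (∀ φs → All p φs → Σ[ a ∈ Tuple ℭ Γ ] All (λ φ → ℭ ⊨ φ [ a ⊞ c ]) φs) →
        Σ[ a ∈ Tuple ℭ Γ ] (∀ φ → p φ → ℭ ⊨ φ [ a ⊞ c ])

      stronglyHomogeneous :
        ∀ {Γ : Context (Sort L) ℓ} (a b : Tuple ℭ Γ) →
        SameType ℭ {Δ = ∅} (λ ()) a b →
        Σ[ f ∈ Automorphism ℭ ]
          (∀ x → Structure._≈_ ℭ (Automorphism.to f (a x)) (b x))

  -- Small M ≼ ℭ, given as an elementary embedding.  Applying elementarity to
  -- equations shows that the embedding respects and reflects ≈.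
  record SmallElementarySubmodel (ℭ : Structure L (lsuc ℓ)) : Set (lsuc ℓ) where
    field
      M          : Structure L ℓ
      embed      : ∀ {t} → ∣ M ∣ t → ∣ ℭ ∣ t
      elementary : ∀ {ss} (φ : Formula L ⟦ ss ⟧) (a : Tuple M ⟦ ss ⟧) →
                   M ⊨ φ [ a ] ⇔ ℭ ⊨ φ [ (λ x → embed (a x)) ]

    points : Tuple ℭ (Elements M)
    points (_ , x) = embed x

  module _ (ℭ : Structure L (lsuc ℓ)) {Γ : Context (Sort L) ℓ} where

    -- LascarDist≤ n a b  is  d_L(a, b) ≤ n.
    data LascarDist≤ : ℕ → Tuple ℭ Γ → Tuple ℭ Γ → Set (lsuc ℓ) where
      done : ∀ {a b} → (∀ x → Structure._≈_ ℭ (a x) (b x)) → LascarDist≤ zero a b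
      step : ∀ {n a a′ b} (M : SmallElementarySubmodel ℭ) →
             SameType ℭ (SmallElementarySubmodel.points M) a a′ →
             LascarDist≤ n a′ b → LascarDist≤ (suc n) a b

  -- A complete theory with language in Set ℓ has a monster model, and whether
  -- the bounds below exist does not depend on which one is taken.
  GCompact : Theory L → Set (lsuc (lsuc ℓ))
  GCompact T =
    Σ[ ℭ ∈ Structure L (lsuc ℓ) ] IsMonster T ℭ ×
    (∀ (Γ : Context (Sort L) ℓ) (a : Tuple ℭ Γ) →
      ∃[ n ] (∀ b → (∃[ k ] LascarDist≤ ℭ {Γ} k a b) → LascarDist≤ ℭ {Γ} n a b))

HereditarilyGCompact : ∀ {ℓ} {L : Signature ℓ} → Theory L → Set (lsuc (lsuc ℓ))
HereditarilyGCompact {ℓ} {L} T =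
  (M : Structure L ℓ) → M ⊨ᵀ T →
  (K : Signature ℓ) (N : Structure K ℓ) → Interpretation M N → GCompact (Th N)

{-# OPTIONS --safe #-}

-- Strict order property gives instability, hence an infinite linear order
-- definable in a model M.  By Ramsey and saturation, a monster extension of M
-- contains x < y < z whose three pairs have the same type over M, so two
-- automorphisms map the interval [x, z) onto [x, y) and onto [y, z).  A
-- Skolem hull closed under both is a small model in which I = [x, z) is the
-- ordered sum of two copies of itself.  It interprets, for every n, the cyclic
-- order obtained from n copies of I, with the relation "q follows p by less
-- than one copy".  Self-similarity hides the boundaries between the copies:
-- automorphisms in the style of Thompson's group T make all short arcs of a
-- fixed shape conjugate, and a large set of points, pairwise joined by such
-- arcs, has two points with the same type over a small model.  So neighbouring
-- points are at Lascar distance at most 1, and all marked points are at finite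
-- distance.  But a model cuts the circle into n arcs, so a point moves by at
-- most two arcs in each Lascar step, and the distances in the n-th sort grow
-- with n.  A tuple with a point in each sort refutes G-compactness.
module Submission where

open import Defs
open import Axiom.ExcludedMiddle using (ExcludedMiddle)
open import Relation.Nullary.Negation.Core using (¬_)

open import Level using (_⊔_; 0ℓ; Lift; lift; lower) renaming (suc to lsuc)
open import Data.Bool.Base using (Bool; true; false)
open import Data.Empty using (⊥; ⊥-elim)
import Data.Empty.Polymorphic as Empty
open import Data.Fin.Base using (Fin; zero; suc; fromℕ; inject₁; toℕ)
open import Data.Fin.Properties using (toℕ-fromℕ; toℕ-inject₁; toℕ-injective)
open import Data.Fin.Relation.Unary.Top using (view; ‵fromℕ; ‵inject₁; view-fromℕ; view-inject₁)
open import Data.List.Base using (List; []; _∷_; _++_; length; lookup; map; concat; tabulate)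
open import Data.List.Membership.Propositional using (_∈_)
open import Data.List.Membership.Propositional.Properties using (∈-++⁺ˡ; ∈-++⁺ʳ; ∈-concat⁺′; ∈-tabulate⁺)
open import Data.List.Relation.Unary.All as All using (All; []; _∷_)
open import Data.List.Relation.Unary.Any using (here; there)
open import Data.Maybe.Base using (Maybe; just; nothing)
open import Data.Nat.Base using (ℕ; zero; suc; _+_; _∸_; _≤_; _<_; z≤n; s≤s)
open import Data.Nat.Properties using
  ( suc-injective; ≤-refl; ≤-reflexive; ≤-trans; <-trans; <-irrefl; <⇒≤; ≰⇒>; n≤1+n; m≤n⇒m≤1+n; m≤n⇒m<n∨m≡n
  ; <-cmp; +-suc; +-comm; +-identityʳ; m≤m+n; m≤n+m; m∸n+n≡m; +-monoʳ-≤; +-monoˡ-<; +-cancelˡ-≤ )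
open import Data.Product.Base using (Σ-syntax; ∃; ∃-syntax; _×_; _,_; proj₁; proj₂; curry)
open import Data.Sum.Base as Sum using (_⊎_; inj₁; inj₂; [_,_]′)
open import Data.Unit.Polymorphic.Base using (⊤; tt)
open import Function.Base using (_∘_; id)
open import Function.Bundles using (_⇔_; mk⇔; Equivalence; Inverse; Injection)
open import Function.Construct.Composition using (_⇔-∘_)
open import Function.Construct.Identity using (⇔-id)
open import Function.Construct.Symmetry using (⇔-sym)
open import Relation.Binary.Bundles using (Setoid)
open import Relation.Binary.Definitions using (Tri; tri<; tri≈; tri>)
open import Relation.Binary.PropositionalEquality using (_≡_; refl; sym; trans; cong) renaming (subst to ≡-subst)
open import Relation.Binary.Structures using (IsTotalOrder)
open import Relation.Nullary.Decidable.Core using (Dec; yes; no; does; True; toWitness; fromWitness)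
open import Relation.Unary using (Pred)

open Equivalence using (to; from)

-- Hereditary G-compactness is used twice, and each time it also supplies the monster model: for `M`
-- interpreted in itself, where the triple and the automorphisms are found, and for the circles over
-- the hull, where the contradiction arises. The order given by the conjecture may be rigid, and
-- then the boundaries between the copies could be definable. This is why symmetry is first created
-- in a monster model and then brought down to a small one, the hypothesis being about models in
-- `Set ℓ`.
--
-- All circles are built from one order, so an automorphism of that order, or a half turn, acts on
-- all sorts at once. The number of Lascar steps that the construction needs therefore does not
-- depend on the sort, while the lower bound is read off in a sort chosen after the alleged bound.
-- Lascar distance itself is not first-order; what passes between the models is a formula saying
-- that two points are joined by a chain of a given number of links.

module Classical (em : ∀ {a} → ExcludedMiddle a) where

  -- Formulas

  -- Satisfaction of `⊥̇` is the empty type at the level of the structure, so two kinds of falsity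
  -- occur. The refutation of `P` lands in the polymorphic one, as the failure of a formula does;
  -- the contradiction drawn from it is the ordinary one.
  dne : ∀ {p q} {P : Set p} → ((P → Empty.⊥ {q}) → ⊥) → P
  dne {P = P} h with em {P = P}
  ... | yes p = p
  ... | no ¬p = ⊥-elim (h λ p → ⊥-elim (¬p p))

  raise : ∀ {q} → ⊥ → Empty.⊥ {q}
  raise ()

  drop : ∀ {q} → Empty.⊥ {q} → ⊥
  drop ()

  module _ {ℓ} {L : Signature ℓ} where

    ⊤̇ : ∀ {i} {Γ : Context (Sort L) i} → Formula L Γ
    ⊤̇ = ⊥̇ ⇒ ⊥̇

    infixr 6 _∧̇_
    infixr 5 _∨̇_

    _∧̇_ _∨̇_ : ∀ {i} {Γ : Context (Sort L) i} → Formula L Γ → Formula L Γ → Formula L Γ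
    φ ∧̇ ψ = ∼ (φ ⇒ ∼ ψ)
    φ ∨̇ ψ = ∼ φ ⇒ ψ

    ∃̇ : ∀ {i} {Γ : Context (Sort L) i} t → Formula L (Γ ▹ t) → Formula L Γ
    ∃̇ t φ = ∼ ∀̇ t (∼ φ)

    ⋁ : ∀ {i} {Γ : Context (Sort L) i} n → (Fin n → Formula L Γ) → Formula L Γ
    ⋁ zero    φ = ⊥̇
    ⋁ (suc n) φ = φ zero ∨̇ ⋁ n (φ ∘ suc)

    extend : ∀ {m i t} (M : Structure L m) {Γ : Context (Sort L) i} →
             Tuple M Γ → ∣ M ∣ t → Tuple M (Γ ▹ t)
    extend M a c = a ▸ c

    append : ∀ {m i j} (M : Structure L m) {Γ : Context (Sort L) i} {Δ : Context (Sort L) j} →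
             Tuple M Γ → Tuple M Δ → Tuple M (Γ ⊕ Δ)
    append M a b = a ⊞ b

    module _ {m i} (M : Structure L m) {Γ : Context (Sort L) i} (a : Tuple M Γ) where

      ∼-⊨ : ∀ φ → M ⊨ ∼ φ [ a ] ⇔ (¬ M ⊨ φ [ a ])
      ∼-⊨ φ = mk⇔ (λ f p → drop (f p)) (λ f p → raise (f p))

      ∧̇-⊨ : ∀ φ ψ → M ⊨ φ ∧̇ ψ [ a ] ⇔ (M ⊨ φ [ a ] × M ⊨ ψ [ a ])
      ∧̇-⊨ φ ψ = mk⇔ (λ f → dne λ k → drop (f λ p q → k (p , q))) (λ (p , q) f → f p q)

      ∨̇-⊨ : ∀ φ ψ → M ⊨ φ ∨̇ ψ [ a ] ⇔ (M ⊨ φ [ a ] ⊎ M ⊨ ψ [ a ])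
      ∨̇-⊨ φ ψ = mk⇔ f g
        where
        f : M ⊨ φ ∨̇ ψ [ a ] → M ⊨ φ [ a ] ⊎ M ⊨ ψ [ a ]
        f h with em {P = M ⊨ φ [ a ]}
        ... | yes p = inj₁ p
        ... | no ¬p = inj₂ (h λ p → raise (¬p p))
        g : M ⊨ φ [ a ] ⊎ M ⊨ ψ [ a ] → M ⊨ φ ∨̇ ψ [ a ]
        g (inj₁ p) k = Empty.⊥-elim (k p)
        g (inj₂ q) k = q

      ∃̇-⊨ : ∀ t φ → M ⊨ ∃̇ t φ [ a ] ⇔ (Σ[ c ∈ ∣ M ∣ t ] M ⊨ φ [ a ▸ c ])
      ∃̇-⊨ t φ = mk⇔ (λ f → dne λ k → drop (f λ c p → k (c , p))) (λ (c , p) f → f c p)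

      ⋁-⊨ : ∀ n φ → M ⊨ ⋁ n φ [ a ] ⇔ (Σ[ k ∈ Fin n ] M ⊨ φ k [ a ])
      ⋁-⊨ zero    φ = mk⇔ (λ ()) (λ ())
      ⋁-⊨ (suc n) φ = mk⇔ f g
        where
        f : M ⊨ ⋁ (suc n) φ [ a ] → Σ[ k ∈ Fin (suc n) ] M ⊨ φ k [ a ]
        f h with to (∨̇-⊨ (φ zero) (⋁ n (φ ∘ suc))) h
        ... | inj₁ p = zero , p
        ... | inj₂ q = let (k , r) = to (⋁-⊨ n (φ ∘ suc)) q in suc k , r
        g : Σ[ k ∈ Fin (suc n) ] M ⊨ φ k [ a ] → M ⊨ ⋁ (suc n) φ [ a ]
        g (zero  , p) = from (∨̇-⊨ (φ zero) (⋁ n (φ ∘ suc))) (inj₁ p)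
        g (suc k , p) =
          from (∨̇-⊨ (φ zero) (⋁ n (φ ∘ suc))) (inj₂ (from (⋁-⊨ n (φ ∘ suc)) (k , p)))

    -- An isomorphism modulo the setoid equalities, given by its graph: this
    -- spares choosing images and proving congruence.
    record Correspondence {m n} (A : Structure L m) (B : Structure L n) r :
                          Set (ℓ ⊔ m ⊔ n ⊔ lsuc r) where
      private
        module A = Structure A
        module B = Structure B
      field
        Z      : ∀ {t} → ∣ A ∣ t → ∣ B ∣ t → Set r
        total  : ∀ {t} (a : ∣ A ∣ t) → ∃[ b ] Z a b
        onto   : ∀ {t} (b : ∣ B ∣ t) → ∃[ a ] Z a b
        eq     : ∀ {t} {a a′ : ∣ A ∣ t} {b b′} → Z a b → Z a′ b′ → a A.≈ a′ ⇔ b B.≈ b′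
        fun    : ∀ {ss t} (f : Fun L ss t) {xs ys} → (∀ k → Z (xs k) (ys k)) →
                 Z (A.fun f xs) (B.fun f ys)
        rel    : ∀ {ss} (R : Rel L ss) {xs ys} → (∀ k → Z (xs k) (ys k)) →
                 A.rel R xs ⇔ B.rel R ys

    module _ {m n r} {A : Structure L m} {B : Structure L n} (𝒵 : Correspondence A B r) where
      open Correspondence 𝒵

      corr-eval : ∀ {i} {Γ : Context (Sort L) i} {s} {a b} →
                  (∀ x → Z (a x) (b x)) → (t : Term L Γ s) → Z (eval A a t) (eval B b t)
      corr-eval z (var x)    = z x
      corr-eval z (app f ts) = fun f λ k → corr-eval z (ts k)

      corr-⊨ : ∀ {i} {Γ : Context (Sort L) i} {a b} → (∀ x → Z (a x) (b x)) →
               ∀ φ → A ⊨ φ [ a ] ⇔ B ⊨ φ [ b ]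
      corr-⊨ z (t ≐ u)     = eq (corr-eval z t) (corr-eval z u)
      corr-⊨ z (atom R ts) = rel R λ k → corr-eval z (ts k)
      corr-⊨ z ⊥̇           = mk⇔ (λ ()) (λ ())
      corr-⊨ z (φ ⇒ ψ)     = mk⇔ (λ f p → to (corr-⊨ z ψ) (f (from (corr-⊨ z φ) p)))
                                 (λ f p → from (corr-⊨ z ψ) (f (to (corr-⊨ z φ) p)))
      corr-⊨ {Γ = Γ} {a} {b} z (∀̇ t φ) = mk⇔
        (λ f c → let (d , q) = onto c in to (corr-⊨ (ext q) φ) (f d))
        (λ f c → let (d , q) = total c in from (corr-⊨ (ext q) φ) (f d))
        where
        ext : ∀ {c d} → Z c d → ∀ x → Z {sort (Γ ▹ t) x} (extend A a c x) (extend B b d x)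
        ext q (just x) = z x
        ext q nothing  = q

    module _ {m} (M : Structure L m) where
      private module S {t} = Setoid (Structure.Dom M t)
      open Structure M hiding (fun)

      eval-cong : ∀ {i} {Γ : Context (Sort L) i} {a b : Tuple M Γ} → (∀ x → a x ≈ b x) →
                  ∀ {s} (t : Term L Γ s) → eval M a t ≈ eval M b t
      eval-cong z (var x)    = z x
      eval-cong z (app f ts) = fun-cong f λ k → eval-cong z (ts k)

      identity : Correspondence M M m
      identity = record
        { Z     = _≈_
        ; total = λ a → a , S.refl
        ; onto  = λ a → a , S.refl
        ; eq    = λ p q → mk⇔ (λ e → S.trans (S.sym p) (S.trans e q))
                              (λ e → S.trans p (S.trans e (S.sym q)))
        ; fun   = fun-cong
        ; rel   = λ R p → mk⇔ (rel-resp R p) (rel-resp R λ k → S.sym (p k))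
        }

      ⊨-resp : ∀ {i} {Γ : Context (Sort L) i} {a b : Tuple M Γ} → (∀ x → a x ≈ b x) →
               ∀ φ → M ⊨ φ [ a ] ⇔ M ⊨ φ [ b ]
      ⊨-resp = corr-⊨ identity

      graph : Automorphism M → Correspondence M M m
      graph F = record
        { Z     = λ a b → F.to a ≈ b
        ; total = λ a → F.to a , S.refl
        ; onto  = λ b → Inverse.from (F.inverse _) b , Inverse.strictlyInverseˡ (F.inverse _) b
        ; eq    = λ p q → mk⇔ (λ e → S.trans (S.sym p) (S.trans (Inverse.to-cong (F.inverse _) e) q))
                              (λ e → injective (S.trans p (S.trans e (S.sym q))))
        ; fun   = λ f p → S.trans (F.fun-homo f _) (fun-cong f p)
        ; rel   = λ R p → mk⇔ (λ r → rel-resp R p (to (F.rel-homo R _) r))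
                              (λ r → from (F.rel-homo R _) (rel-resp R (λ k → S.sym (p k)) r))
        }
        where
        module F = Automorphism F
        injective : ∀ {t} {a b : ∣ M ∣ t} → F.to a ≈ F.to b → a ≈ b
        injective {t} e = S.trans (S.sym (Inverse.strictlyInverseʳ (F.inverse t) _))
          (S.trans (Inverse.from-cong (F.inverse t) e) (Inverse.strictlyInverseʳ (F.inverse t) _))

    -- Free variables and substitution

    FVᵗ : ∀ {i} {Γ : Context (Sort L) i} {s} → Term L Γ s → Index Γ → Set i
    FVᵗ (var y)    x = y ≡ x
    FVᵗ (app f ts) x = ∃[ k ] FVᵗ (ts k) x

    FV : ∀ {i} {Γ : Context (Sort L) i} → Formula L Γ → Index Γ → Set i
    FV (t ≐ u)     x = FVᵗ t x ⊎ FVᵗ u x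
    FV (atom R ts) x = ∃[ k ] FVᵗ (ts k) x
    FV ⊥̇           x = Empty.⊥
    FV (φ ⇒ ψ)     x = FV φ x ⊎ FV ψ x
    FV (∀̇ t φ)     x = FV φ (just x)

    weaken : ∀ {i} {Γ : Context (Sort L) i} {s t} → Term L Γ s → Term L (Γ ▹ t) s
    weaken (var x)    = var (just x)
    weaken (app f ts) = app f λ k → weaken (ts k)

    -- Substitutions need only be defined on the free variables; this is what
    -- allows a formula to be moved to a context lacking the other sorts.
    module _ {i j} {Γ : Context (Sort L) i} {Δ : Context (Sort L) j} where

      substᵗ : ∀ {s} (t : Term L Γ s) → (∀ x → FVᵗ t x → Term L Δ (sort Γ x)) → Term L Δ s
      substᵗ (var x)    σ = σ x refl
      substᵗ (app f ts) σ = app f λ k → substᵗ (ts k) λ x p → σ x (k , p)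

      lifted : ∀ {t} {F : Index (Γ ▹ t) → Set i} → (∀ x → F (just x) → Term L Δ (sort Γ x)) →
               ∀ x → F x → Term L (Δ ▹ t) (sort (Γ ▹ t) x)
      lifted σ (just x) p = weaken (σ x p)
      lifted σ nothing  p = var nothing

    subst : ∀ {i j} {Γ : Context (Sort L) i} {Δ : Context (Sort L) j} (φ : Formula L Γ) →
            (∀ x → FV φ x → Term L Δ (sort Γ x)) → Formula L Δ
    subst (t ≐ u)     σ = substᵗ t (λ x → σ x ∘ inj₁) ≐ substᵗ u (λ x → σ x ∘ inj₂)
    subst (atom R ts) σ = atom R λ k → substᵗ (ts k) λ x p → σ x (k , p)
    subst ⊥̇           σ = ⊥̇
    subst (φ ⇒ ψ)     σ = subst φ (λ x → σ x ∘ inj₁) ⇒ subst ψ (λ x → σ x ∘ inj₂)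
    subst (∀̇ t φ)     σ = ∀̇ t (subst φ (lifted σ))

    rename : ∀ {i j} {Γ : Context (Sort L) i} {Δ : Context (Sort L) j} → Formula L Γ →
             (∀ x → Term L Δ (sort Γ x)) → Formula L Δ
    rename φ σ = subst φ λ x _ → σ x

    renameᵗ : ∀ {i j} {Γ : Context (Sort L) i} {Δ : Context (Sort L) j} {s} → Term L Γ s →
              (∀ x → Term L Δ (sort Γ x)) → Term L Δ s
    renameᵗ t σ = substᵗ t λ x _ → σ x

    module _ {m} (M : Structure L m) where
      private module S {t} = Setoid (Structure.Dom M t)
      open Structure M hiding (fun)

      eval-weaken : ∀ {i} {Γ : Context (Sort L) i} {s t} {a : Tuple M Γ} {c : ∣ M ∣ t}
                    (u : Term L Γ s) → eval M (a ▸ c) (weaken u) ≈ eval M a u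
      eval-weaken (var x)    = S.refl
      eval-weaken (app f ts) = fun-cong f λ k → eval-weaken (ts k)

      eval-subst : ∀ {i j} {Γ : Context (Sort L) i} {Δ : Context (Sort L) j} {a b s}
                   (t : Term L Γ s) {σ : ∀ x → FVᵗ t x → Term L Δ (sort Γ x)} →
                   (∀ x p → eval M b (σ x p) ≈ a x) → eval M b (substᵗ t σ) ≈ eval M a t
      eval-subst (var x)    h = h x refl
      eval-subst (app f ts) h = fun-cong f λ k → eval-subst (ts k) λ x p → h x (k , p)

      ⊨-subst : ∀ {i j} {Γ : Context (Sort L) i} {Δ : Context (Sort L) j} {a b}
                (φ : Formula L Γ) {σ : ∀ x → FV φ x → Term L Δ (sort Γ x)} →
                (∀ x p → eval M b (σ x p) ≈ a x) → M ⊨ subst φ σ [ b ] ⇔ M ⊨ φ [ a ]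
      ⊨-subst (t ≐ u) h = mk⇔
        (λ e → S.trans (S.sym (eval-subst t (λ x → h x ∘ inj₁))) (S.trans e (eval-subst u (λ x → h x ∘ inj₂))))
        (λ e → S.trans (eval-subst t (λ x → h x ∘ inj₁)) (S.trans e (S.sym (eval-subst u (λ x → h x ∘ inj₂)))))
      ⊨-subst (atom R ts) h = mk⇔
        (rel-resp R λ k → eval-subst (ts k) λ x p → h x (k , p))
        (rel-resp R λ k → S.sym (eval-subst (ts k) λ x p → h x (k , p)))
      ⊨-subst ⊥̇       h = mk⇔ (λ ()) (λ ())
      ⊨-subst (φ ⇒ ψ) h = mk⇔
        (λ f p → to (⊨-subst ψ (λ x → h x ∘ inj₂)) (f (from (⊨-subst φ (λ x → h x ∘ inj₁)) p)))
        (λ f p → from (⊨-subst ψ (λ x → h x ∘ inj₂)) (f (to (⊨-subst φ (λ x → h x ∘ inj₁)) p)))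
      ⊨-subst {Γ = Γ} {Δ} {a} {b} (∀̇ t φ) {σ} h = mk⇔
        (λ f c → to (⊨-subst φ (ext c)) (f c))
        (λ f c → from (⊨-subst φ (ext c)) (f c))
        where
        ext : ∀ c x p → eval M (b ▸ c) (lifted {Γ = Γ} {Δ} {t} {FV φ} σ x p) ≈ extend M a c x
        ext c (just x) p = S.trans (eval-weaken (σ x p)) (h x p)
        ext c nothing  p = S.refl

      ⊨-rename : ∀ {i j} {Γ : Context (Sort L) i} {Δ : Context (Sort L) j} {a b}
                 (φ : Formula L Γ) {σ : ∀ x → Term L Δ (sort Γ x)} →
                 (∀ x → eval M b (σ x) ≈ a x) → M ⊨ rename φ σ [ b ] ⇔ M ⊨ φ [ a ]
      ⊨-rename φ h = ⊨-subst φ λ x _ → h x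

    freeᵗ : ∀ {i} {Γ : Context (Sort L) i} {s} (t : Term L Γ s) →
            ∃[ xs ] (∀ x → FVᵗ t x → x ∈ xs)
    freeˢ : ∀ {i} {Γ : Context (Sort L) i} {n} {s : Fin n → Sort L} (ts : ∀ k → Term L Γ (s k)) →
            ∃[ xs ] (∀ x → (∃[ k ] FVᵗ (ts k) x) → x ∈ xs)
    freeᵗ (var x)    = x ∷ [] , λ { _ refl → here refl }
    freeᵗ (app f ts) = freeˢ ts
    freeˢ ts = concat (tabulate (proj₁ ∘ freeᵗ ∘ ts)) ,
      λ x (k , p) → ∈-concat⁺′ (proj₂ (freeᵗ (ts k)) x p) (∈-tabulate⁺ {f = proj₁ ∘ freeᵗ ∘ ts} k)

    catJust : ∀ {i} {I : Set i} (xs : List (Maybe I)) → ∃[ ys ] (∀ x → just x ∈ xs → x ∈ ys)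
    catJust []             = [] , λ _ ()
    catJust (nothing ∷ xs) = let (ys , h) = catJust xs in ys , λ { x (there p) → h x p }
    catJust (just y ∷ xs)  = let (ys , h) = catJust xs in
      y ∷ ys , λ { x (here refl) → here refl ; x (there p) → there (h x p) }

    free : ∀ {i} {Γ : Context (Sort L) i} (φ : Formula L Γ) → ∃[ xs ] (∀ x → FV φ x → x ∈ xs)
    free (t ≐ u) = let (xs , h) = freeᵗ t ; (ys , k) = freeᵗ u in
      xs ++ ys , λ x → [ ∈-++⁺ˡ ∘ h x , ∈-++⁺ʳ xs ∘ k x ]′
    free (atom R ts) = freeˢ ts
    free ⊥̇           = [] , λ _ ()
    free (φ ⇒ ψ) = let (xs , h) = free φ ; (ys , k) = free ψ in
      xs ++ ys , λ x → [ ∈-++⁺ˡ ∘ h x , ∈-++⁺ʳ xs ∘ k x ]′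
    free (∀̇ t φ) = let (xs , h) = free φ ; (ys , k) = catJust xs in
      ys , λ x p → k x (h (just x) p)

    occurrence : ∀ {i} {Γ : Context (Sort L) i} {xs : List (Index Γ)} {x} → x ∈ xs →
                 Term L ⟦ map (sort Γ) xs ⟧ (sort Γ x)
    occurrence (here refl) = var zero
    occurrence (there p)   = renameᵗ (occurrence p) λ k → var (suc k)

    restrict : ∀ {m i} (M : Structure L m) {Γ : Context (Sort L) i} (xs : List (Index Γ)) →
               Tuple M Γ → Tuple M ⟦ map (sort Γ) xs ⟧
    restrict M (x ∷ xs) a zero    = a x
    restrict M (x ∷ xs) a (suc k) = restrict M xs a k

    eval-occurrence : ∀ {m i} (M : Structure L m) {Γ : Context (Sort L) i} {a : Tuple M Γ}
                      {xs x} (p : x ∈ xs) →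
                      Structure._≈_ M (eval M (restrict M xs a) (occurrence {Γ = Γ} p)) (a x)
    eval-occurrence M (here refl) = Setoid.refl (Structure.Dom M _)
    eval-occurrence M {Γ} (there p) = Setoid.trans (Structure.Dom M _)
      (eval-subst M (occurrence {Γ = Γ} p) λ _ _ → Setoid.refl (Structure.Dom M _))
      (eval-occurrence M {Γ} p)

    decided : ∀ {p} {P : Set p} → Dec P → P → P
    decided (yes p) _ = p
    decided (no ¬p) p = p

    module _ {i j} {Γ : Context (Sort L) i} {Δ : Context (Sort L) j} where

      lefts : (zs : List (Index (Γ ⊕ Δ))) → ∃[ xs ] (∀ x → inj₁ x ∈ zs → x ∈ xs)
      lefts []            = [] , λ _ ()
      lefts (inj₁ y ∷ zs) = let (xs , h) = lefts zs in
        y ∷ xs , λ { x (here refl) → here refl ; x (there p) → there (h x p) }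
      lefts (inj₂ y ∷ zs) = let (xs , h) = lefts zs in xs , λ { x (there p) → h x p }

      module FiniteSupport (φ : Formula L (Γ ⊕ Δ)) where

        support : List (Index Γ)
        support = proj₁ (lefts (proj₁ (free φ)))

        covers : ∀ x → FV φ (inj₁ x) → x ∈ support
        covers x p = proj₂ (lefts (proj₁ (free φ))) x (proj₂ (free φ) (inj₁ x) p)

        finite : Context (Sort L) 0ℓ
        finite = ⟦ map (sort Γ) support ⟧

        -- A variable may be listed twice; excluded middle picks one occurrence
        -- uniformly, so that tuples can be pulled back along it.
        locate : ∀ x → FV φ x → Term L (finite ⊕ Δ) (sort (Γ ⊕ Δ) x)
        locate (inj₁ x) p = renameᵗ (occurrence {Γ = Γ} (decided em (covers x p))) λ k → var (inj₁ k)
        locate (inj₂ y) p = var (inj₂ y)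

        truncated : Formula L (finite ⊕ Δ)
        truncated = subst φ locate

        module _ {m} (M : Structure L m) (b : Tuple M Δ) where
          private module S {t} = Setoid (Structure.Dom M t)

          restrict-⊨ : ∀ a → M ⊨ truncated [ restrict M support a ⊞ b ] ⇔ M ⊨ φ [ a ⊞ b ]
          restrict-⊨ a = ⊨-subst M φ λ
            { (inj₁ x) p → S.trans
                (eval-subst M (occurrence {Γ = Γ} (decided em (covers x p))) λ _ _ → S.refl)
                (eval-occurrence M {Γ} (decided em (covers x p)))
            ; (inj₂ y) p → S.refl }

          module _ (default : ∀ x → ∣ M ∣ (sort Γ x)) (d : Tuple M finite) where

            value : ∀ {x} → Dec (x ∈ support) → ∣ M ∣ (sort Γ x)
            value     (yes p) = eval M d (occurrence {Γ = Γ} p)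
            value {x} (no _)  = default x

            pullback : Tuple M Γ
            pullback x = value em

            eval-decided : ∀ {x} (D : Dec (x ∈ support)) p →
                           Structure._≈_ M (eval M d (occurrence {Γ = Γ} (decided D p))) (value D)
            eval-decided (yes _) p = S.refl
            eval-decided (no ¬p) p = ⊥-elim (¬p p)

            pullback-⊨ : M ⊨ truncated [ d ⊞ b ] ⇔ M ⊨ φ [ pullback ⊞ b ]
            pullback-⊨ = ⊨-subst M φ λ
              { (inj₁ x) p → S.trans
                  (eval-subst M (occurrence {Γ = Γ} (decided em (covers x p))) λ _ _ → S.refl)
                  (eval-decided em (covers x p))
              ; (inj₂ y) p → S.refl }

    module _ {j} {Δ : Context (Sort L) j} where

      rotate : ∀ s ss x → Term L (⟦ ss ⟧ ⊕ Δ ▹ s) (sort (⟦ s ∷ ss ⟧ ⊕ Δ) x)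
      rotate s ss (inj₁ zero)    = var nothing
      rotate s ss (inj₁ (suc k)) = var (just (inj₁ k))
      rotate s ss (inj₂ y)       = var (just (inj₂ y))

      ∃-closure : ∀ ss → Formula L (⟦ ss ⟧ ⊕ Δ) → Formula L Δ
      ∃-closure []       φ = rename φ λ { (inj₂ y) → var y }
      ∃-closure (s ∷ ss) φ = ∃-closure ss (∃̇ s (rename φ (rotate s ss)))

      module _ {m} (M : Structure L m) (b : Tuple M Δ) where
        private module S {t} = Setoid (Structure.Dom M t)

        cons : ∀ s ss → ∣ M ∣ s → Tuple M ⟦ ss ⟧ → Tuple M ⟦ s ∷ ss ⟧
        cons s ss c₀ c zero    = c₀
        cons s ss c₀ c (suc k) = c k

        rotate-⊨ : ∀ s ss φ (c₀ : ∣ M ∣ s) (c : Tuple M ⟦ ss ⟧) →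
                   M ⊨ rename φ (rotate s ss) [ append M c b ▸ c₀ ] ⇔ M ⊨ φ [ cons s ss c₀ c ⊞ b ]
        rotate-⊨ s ss φ c₀ c = ⊨-rename M φ λ
          { (inj₁ zero) → S.refl ; (inj₁ (suc k)) → S.refl ; (inj₂ y) → S.refl }

        ∃-closure-⊨ : ∀ ss φ → M ⊨ ∃-closure ss φ [ b ] ⇔ (Σ[ c ∈ Tuple M ⟦ ss ⟧ ] M ⊨ φ [ c ⊞ b ])
        ∃-closure-⊨ [] φ = mk⇔
          (λ p → (λ ()) , to (⊨-rename M φ λ { (inj₂ y) → S.refl }) p)
          (λ (c , p) → from (⊨-rename M φ λ { (inj₂ y) → S.refl }) p)
        ∃-closure-⊨ (s ∷ ss) φ = mk⇔
          (λ p → let (c , q) = to (∃-closure-⊨ ss (∃̇ s (rename φ (rotate s ss)))) p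
                     (c₀ , r) = to (∃̇-⊨ M (append M c b) s (rename φ (rotate s ss))) q
                 in cons s ss c₀ c , to (rotate-⊨ s ss φ c₀ c) r)
          (λ (c , p) → from (∃-closure-⊨ ss (∃̇ s (rename φ (rotate s ss)))) (c ∘ suc ,
             from (∃̇-⊨ M (append M (c ∘ suc) b) s (rename φ (rotate s ss)))
               (c zero , from (rotate-⊨ s ss φ (c zero) (c ∘ suc)) (to (⊨-resp M
                 {a = append M c b} {append M (cons s ss (c zero) (c ∘ suc)) b} (λ
                 { (inj₁ zero) → S.refl ; (inj₁ (suc k)) → S.refl ; (inj₂ y) → S.refl }) φ) p))))

    -- tp(a) ⊆ tp(b), across structures.
    infix 4 _⟪_⟫≼_⟪_⟫
    _⟪_⟫≼_⟪_⟫ : ∀ {m n i} (A : Structure L m) {Γ : Context (Sort L) i} → Tuple A Γ →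
                (B : Structure L n) → Tuple B Γ → Set (ℓ ⊔ i ⊔ m ⊔ n)
    A ⟪ a ⟫≼ B ⟪ b ⟫ = ∀ φ → A ⊨ φ [ a ] → B ⊨ φ [ b ]

    -- Types are complete: a formula true of `b` but not of `a` would have its negation carried from
    -- `a` to `b`.
    ≼-converse : ∀ {m n i} {A : Structure L m} {B : Structure L n} {Γ : Context (Sort L) i}
                 {a : Tuple A Γ} {b : Tuple B Γ} → A ⟪ a ⟫≼ B ⟪ b ⟫ → B ⟪ b ⟫≼ A ⟪ a ⟫
    ≼-converse h φ p = dne λ k → drop (h (∼ φ) k p)

    module _ {m n i j} {A : Structure L m} {B : Structure L n}
             {Γ : Context (Sort L) i} {Δ : Context (Sort L) j} {a : Tuple A Δ} {b : Tuple B Δ}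
             (a≼b : A ⟪ a ⟫≼ B ⟪ b ⟫) where

      -- `Γ` may be infinite, but `φ` mentions only finitely many of its variables; quantifying
      -- these existentially leaves a formula over `Δ`, which the inclusion of types carries to `B`.
      realize : ∀ (φ : Formula L (Γ ⊕ Δ)) c → A ⊨ φ [ c ⊞ a ] → Σ[ d ∈ Tuple B Γ ] B ⊨ φ [ d ⊞ b ]
      realize φ c p = _ , to (pullback-⊨ B b default (proj₁ solution)) (proj₂ solution)
        where
        open FiniteSupport φ
        solution : Σ[ d ∈ Tuple B finite ] B ⊨ truncated [ d ⊞ b ]
        closed : Formula L Δ
        closed = ∃-closure (map (sort Γ) support) truncated
        solution = to (∃-closure-⊨ B b (map (sort Γ) support) truncated) (a≼b closed
          (from (∃-closure-⊨ A a (map (sort Γ) support) truncated) (restrict A support c , from (restrict-⊨ A a c) p)))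
        -- The remaining variables need values in `B` as well. Their sorts are inhabited there
        -- because `A` has the element `c x`, and inhabitation of a sort is a formula.
        default : ∀ x → ∣ B ∣ (sort Γ x)
        default x = proj₁ (to (∃̇-⊨ B b (sort Γ x) ⊤̇)
          (a≼b (∃̇ (sort Γ x) ⊤̇) (from (∃̇-⊨ A a (sort Γ x) ⊤̇) (c x , λ ()))))

    transfer : ∀ {m n i j} {A : Structure L m} {B : Structure L n}
               {Γ : Context (Sort L) i} {Δ : Context (Sort L) j} {a : Tuple A Δ} {b : Tuple B Δ} →
               A ⟪ a ⟫≼ B ⟪ b ⟫ → ∀ (φ : Formula L (Γ ⊕ Δ)) →
               (∀ c → A ⊨ φ [ c ⊞ a ]) → ∀ d → B ⊨ φ [ d ⊞ b ]
    transfer {A = A} {B} {a = a} {b} a≼b φ h d = dne λ k →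
      let (c , p) = realize {A = B} {A} {a = b} {a} (≼-converse {A = A} {B} {a = a} {b} a≼b) (∼ φ) d k
      in drop (p (h c))

    module _ {ℭ : Structure L (lsuc ℓ)} (V : SmallElementarySubmodel ℭ) where
      open SmallElementarySubmodel V

      -- `elementary` covers finite contexts only. Both structures evaluate `φ` through its
      -- restriction to the variables that occur in it.
      elementary-∞ : ∀ {i} {Γ : Context (Sort L) i} (φ : Formula L Γ) (a : Tuple M Γ) →
                     M ⊨ φ [ a ] ⇔ ℭ ⊨ φ [ (λ x → embed (a x)) ]
      elementary-∞ {Γ = Γ} φ a = mk⇔
        (λ p → to right (to (elementary {ss = map (sort Γ) support} ψ (restrict M support a)) (from left p)))
        (λ p → to left (from (elementary {ss = map (sort Γ) support} ψ (restrict M support a)) (from right p)))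
        where
        φ′ : Formula L (Γ ⊕ ∅)
        φ′ = rename φ λ x → var (inj₁ x)
        open FiniteSupport φ′
        ψ : Formula L finite
        ψ = rename truncated λ { (inj₁ x) → var x }
        module _ {m} (A : Structure L m) (c : Tuple A finite) (d : Tuple A Γ)
                 (e : ∀ k → Structure._≈_ A (c k) (restrict A support d k)) where
          private module S {t} = Setoid (Structure.Dom A t)
          none : Tuple A ∅
          none ()
          scope : A ⊨ ψ [ c ] ⇔ A ⊨ φ [ d ]
          scope = mk⇔
            (λ p → to i (to (restrict-⊨ A none d) (to j p)))
            (λ p → from j (from (restrict-⊨ A none d) (from i p)))
            where
            i : A ⊨ φ′ [ append A d none ] ⇔ A ⊨ φ [ d ]
            i = ⊨-rename A φ λ x → S.refl
            j : A ⊨ ψ [ c ] ⇔ A ⊨ truncated [ append A (restrict A support d) none ]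
            j = ⊨-rename A truncated λ { (inj₁ x) → e x }
        left : M ⊨ ψ [ restrict M support a ] ⇔ M ⊨ φ [ a ]
        left = scope M (restrict M support a) a λ k → Setoid.refl (Structure.Dom M _)
        right : ℭ ⊨ ψ [ (λ x → embed (restrict M support a x)) ] ⇔ ℭ ⊨ φ [ (λ x → embed (a x)) ]
        right = scope ℭ (λ x → embed (restrict M support a x)) (λ x → embed (a x)) (embed-restrict support)
          where
          embed-restrict : ∀ xs k → Structure._≈_ ℭ (embed (restrict M {Γ} xs a k))
                                                     (restrict ℭ {Γ} xs (λ x → embed (a x)) k)
          embed-restrict (x ∷ xs) zero    = Setoid.refl (Structure.Dom ℭ _)
          embed-restrict (x ∷ xs) (suc k) = embed-restrict xs k

  -- Saturation and homogeneity

  module _ {ℓ} {L : Signature ℓ} where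

    ⋀ : ∀ {i} {Γ : Context (Sort L) i} → List (Formula L Γ) → Formula L Γ
    ⋀ []       = ⊤̇
    ⋀ (φ ∷ φs) = φ ∧̇ ⋀ φs

    ⋀-⊨ : ∀ {m i} (M : Structure L m) {Γ : Context (Sort L) i} (a : Tuple M Γ) φs →
          M ⊨ ⋀ φs [ a ] ⇔ All (λ φ → M ⊨ φ [ a ]) φs
    ⋀-⊨ M a []       = mk⇔ (λ _ → []) (λ _ ())
    ⋀-⊨ M a (φ ∷ φs) = mk⇔
      (λ p → let (q , r) = to (∧̇-⊨ M a φ (⋀ φs)) p in q ∷ to (⋀-⊨ M a φs) r)
      (λ { (q ∷ r) → from (∧̇-⊨ M a φ (⋀ φs)) (q , from (⋀-⊨ M a φs) r) })

    realizeAll : ∀ {m n i j} {A : Structure L m} {B : Structure L n}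
                 {Γ : Context (Sort L) i} {Δ : Context (Sort L) j} {a : Tuple A Δ} {b : Tuple B Δ} →
                 A ⟪ a ⟫≼ B ⟪ b ⟫ → ∀ (φs : List (Formula L (Γ ⊕ Δ))) c →
                 All (λ φ → A ⊨ φ [ c ⊞ a ]) φs →
                 Σ[ d ∈ Tuple B Γ ] All (λ φ → B ⊨ φ [ d ⊞ b ]) φs
    realizeAll {A = A} {B} {a = a} {b} a≼b φs c ps =
      let (d , q) = realize {A = A} {B} {a = a} {b} a≼b (⋀ φs) c (from (⋀-⊨ A (append A c a) φs) ps)
      in d , to (⋀-⊨ B (append B d b) φs) q

    -- The saturation of a monster model takes contexts of level ℓ, while `∅` has level zero.
    ∅ℓ : Context (Sort L) ℓ
    ∅ℓ = ctx Empty.⊥ λ ()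

    none : ∀ {m} (M : Structure L m) → Tuple M ∅ℓ
    none M ()

    module _ {W : Structure L ℓ} {ℭ : Structure L (lsuc ℓ)} (monster : IsMonster (Th W) ℭ) where
      open IsMonster monster

      sentences≼ : W ⟪ none W ⟫≼ ℭ ⟪ none ℭ ⟫
      sentences≼ φ p = to (⊨-rename ℭ {b = λ ()} φ λ ())
        (model (rename φ λ ()) (from (⊨-rename W {b = λ ()} φ λ ()) p))

      -- Finite satisfiability is checked in the concrete structure `W`: it satisfies the same
      -- sentences as the monster model, so finitely many formulas solvable in one are solvable in
      -- the other.
      realizeType : ∀ {Γ : Context (Sort L) ℓ} (p : Pred (Formula L Γ) ℓ) →
                    (∀ φs → All p φs → Σ[ a ∈ Tuple W Γ ] All (λ φ → W ⊨ φ [ a ]) φs) →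
                    Σ[ a ∈ Tuple ℭ Γ ] (∀ φ → p φ → ℭ ⊨ φ [ a ])
      realizeType {Γ} p h = proj₁ solution , λ φ pφ →
        to (⊨-rename ℭ {b = append ℭ (proj₁ solution) (none ℭ)} φ λ x → Setoid.refl (Structure.Dom ℭ _))
           (proj₂ solution (inΓ φ) (φ , pφ , refl))
        where
        inΓ : Formula L Γ → Formula L (Γ ⊕ ∅ℓ)
        inΓ φ = rename φ λ x → var (inj₁ x)
        P : Pred (Formula L (Γ ⊕ ∅ℓ)) ℓ
        P ψ = ∃[ φ ] p φ × inΓ φ ≡ ψ
        preimages : ∀ ψs → All P ψs → ∃[ φs ] All p φs × (∀ (a : Tuple W Γ) →
                    All (λ φ → W ⊨ φ [ a ]) φs → All (λ ψ → W ⊨ ψ [ a ⊞ none W ]) ψs)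
        preimages [] [] = [] , [] , λ _ _ → []
        preimages (_ ∷ ψs) ((φ , q , refl) ∷ qs) =
          let (φs , ps , h) = preimages ψs qs in φ ∷ φs , q ∷ ps , λ { a (r ∷ rs) →
            from (⊨-rename W {b = append W a (none W)} φ λ x → Setoid.refl (Structure.Dom W _)) r ∷ h a rs }
        solution : Σ[ a ∈ Tuple ℭ Γ ] (∀ ψ → P ψ → ℭ ⊨ ψ [ a ⊞ none ℭ ])
        solution = saturated (none ℭ) P λ ψs qs →
          let (φs , ps , k) = preimages ψs qs
              (a , rs) = h φs ps
          in realizeAll {A = W} {ℭ} {a = none W} {none ℭ} sentences≼ ψs a (k a rs)

      -- The realized type is the elementary diagram of `W`, with one variable for each element.
      embedding : Σ[ e ∈ Tuple ℭ (Elements W) ] W ⟪ elements W ⟫≼ ℭ ⟪ e ⟫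
      embedding = realizeType (λ φ → W ⊨ φ [ elements W ]) λ φs ps → elements W , ps

      homogeneous : ∀ {Γ : Context (Sort L) ℓ} {a b : Tuple ℭ Γ} → ℭ ⟪ a ⟫≼ ℭ ⟪ b ⟫ →
                    Σ[ F ∈ Automorphism ℭ ] (∀ x → Structure._≈_ ℭ (Automorphism.to F (a x)) (b x))
      homogeneous {Γ} {a} {b} a≼b = stronglyHomogeneous a b λ φ → mk⇔
        (λ p → from (plain φ b) (a≼b (strip φ) (to (plain φ a) p)))
        (λ p → from (plain φ a) (≼-converse {A = ℭ} {ℭ} {a = a} {b} a≼b (strip φ) (to (plain φ b) p)))
        where
        strip : Formula L (Γ ⊕ ∅) → Formula L Γ
        strip φ = rename φ λ { (inj₁ x) → var x }
        plain : ∀ φ (c : Tuple ℭ Γ) → ℭ ⊨ φ [ c ⊞ (λ ()) ] ⇔ ℭ ⊨ strip φ [ c ]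
        plain φ c = mk⇔ (from r) (to r)
          where
          r : ℭ ⊨ strip φ [ c ] ⇔ ℭ ⊨ φ [ c ⊞ (λ ()) ]
          r = ⊨-rename ℭ φ λ { (inj₁ x) → Setoid.refl (Structure.Dom ℭ _) }

    module _ {W : Structure L ℓ} {m} {ℭ : Structure L m} {e : Tuple ℭ (Elements W)}
             (elementary : W ⟪ elements W ⟫≼ ℭ ⟪ e ⟫) where

      embedding-⊨ : ∀ {i} {Γ : Context (Sort L) i} (φ : Formula L Γ) (a : Tuple W Γ) →
                    W ⊨ φ [ a ] ⇔ ℭ ⊨ φ [ (λ x → e (sort Γ x , a x)) ]
      embedding-⊨ {Γ = Γ} φ a = mk⇔
        (λ p → to (⊨-rename ℭ {b = e} φ λ x → Setoid.refl (Structure.Dom ℭ _))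
          (elementary φ′ (from (⊨-rename W {b = elements W} φ λ x → Setoid.refl (Structure.Dom W _)) p)))
        (λ p → to (⊨-rename W {b = elements W} φ λ x → Setoid.refl (Structure.Dom W _))
          (≼-converse {A = W} {ℭ} {a = elements W} {e} elementary φ′
            (from (⊨-rename ℭ {b = e} φ λ x → Setoid.refl (Structure.Dom ℭ _)) p)))
        where
        φ′ : Formula L (Elements W)
        φ′ = rename φ λ x → var (sort Γ x , a x)

    submodel : ∀ {W : Structure L ℓ} {ℭ : Structure L (lsuc ℓ)} {e : Tuple ℭ (Elements W)} →
               W ⟪ elements W ⟫≼ ℭ ⟪ e ⟫ → SmallElementarySubmodel ℭ
    submodel {W} {ℭ} {e} elementary = record
      { M          = W
      ; embed      = λ x → e (_ , x)
      ; elementary = λ φ a → embedding-⊨ elementary φ a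
      }

    moved : ∀ {ℭ : Structure L (lsuc ℓ)} → Automorphism ℭ → SmallElementarySubmodel ℭ →
            SmallElementarySubmodel ℭ
    moved {ℭ} F V = record
      { M          = M
      ; embed      = λ x → Automorphism.to F (embed x)
      ; elementary = λ {ss} φ a → mk⇔
          (λ p → to (corr-⊨ (graph ℭ F) (λ x → Setoid.refl (Structure.Dom ℭ _)) φ) (to (elementary {ss} φ a) p))
          (λ p → from (elementary {ss} φ a) (from (corr-⊨ (graph ℭ F) (λ x → Setoid.refl (Structure.Dom ℭ _)) φ) p))
      }
      where open SmallElementarySubmodel V

  -- Two pigeonhole principles

  -- Cantor's diagonal argument.
  module _ {ℓ} {F : Set ℓ} (t : ((F → Bool) → Bool) → F → Bool) where

    private
      -- `q` is the image of some family `x` of sets that does not have `q` as a member. If `t` were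
      -- injective, `t diagonal` would belong to the family `diagonal` exactly when it does not.
      Escapes : (F → Bool) → Set ℓ
      Escapes q = ∃[ x ] (∀ φ → t x φ ≡ q φ) × x q ≡ false

      diagonal : (F → Bool) → Bool
      diagonal q = does (em {P = Escapes q})

    collapse : ∃[ x ] ∃[ y ] ¬ (x ≡ y) × (∀ φ → t x φ ≡ t y φ)
    collapse = dne {q = 0ℓ} λ k → drop {0ℓ} (absurd λ x y e → dne λ x≢y →
        drop (k (x , y , (λ p → drop {0ℓ} (x≢y p)) , e)))
      where
      absurd : (∀ x y → (∀ φ → t x φ ≡ t y φ) → x ≡ y) → Empty.⊥ {0ℓ}
      absurd injective with em {P = Escapes (t diagonal)} in eq
      ... | yes (x , e , xf) with refl ← injective x diagonal e with () ← trans (sym xf) (cong does eq)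
      ... | no ¬escapes = raise (¬escapes (diagonal , (λ _ → refl) , cong does eq))

  module Ramsey where

    Increasing : (ℕ → ℕ) → Set
    Increasing h = ∀ {i j} → i < j → h i < h j

    increasing : ∀ {h} → (∀ i → h i < h (suc i)) → Increasing h
    increasing up {i} {suc j} (s≤s i≤j) with m≤n⇒m<n∨m≡n i≤j
    ... | inj₁ i<j  = <-trans (increasing up i<j) (up j)
    ... | inj₂ refl = up j

    -- Either `Q` fails from some `n` on, and a shift by `n` works, or it holds arbitrarily late,
    -- and `next` finds its instances one after another.
    pigeonhole : ∀ {q} (Q : ℕ → Set q) →
                 Σ[ g ∈ (ℕ → ℕ) ] Increasing g × ((∀ i → Q (g i)) ⊎ (∀ i → ¬ Q (g i)))
    pigeonhole Q with em {P = ∃[ n ] (∀ m → n ≤ m → ¬ Q m)}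
    ... | yes (n , f) = (_+ n) , +-monoˡ-< n , inj₂ λ i → f (i + n) (m≤n+m n i)
    ... | no k = g , increasing (λ i → proj₁ (proj₂ (next (suc (g i))))) , inj₁ Qg
      where
      next : ∀ n → ∃[ m ] n ≤ m × Q m
      next n = dne {q = 0ℓ} λ f → k (n , λ m n≤m q → drop (f (m , n≤m , q)))
      g : ℕ → ℕ
      g zero    = proj₁ (next zero)
      g (suc i) = proj₁ (next (suc (g i)))
      Qg : ∀ i → Q (g i)
      Qg zero    = proj₂ (proj₂ (next zero))
      Qg (suc i) = proj₂ (proj₂ (next (suc (g i))))

    module _ {p} (P : ℕ → ℕ → Set p) where

      private
        colour : ∀ (h : ℕ → ℕ) → Σ[ g ∈ (ℕ → ℕ) ] Increasing g ×
                 ((∀ i → P (h 0) (h (suc (g i)))) ⊎ (∀ i → ¬ P (h 0) (h (suc (g i)))))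
        colour h = pigeonhole λ m → P (h 0) (h (suc m))

        -- A decreasing chain of infinite sets, each enumerated in order: `H (suc k)` drops the
        -- first number of `H k` and keeps numbers that all have the same colour with it. The colour
        -- thus becomes a property of `k`, and `ramsey` needs just one more pigeonhole.
        H : ℕ → ℕ → ℕ
        H zero    = id
        H (suc k) = H k ∘ suc ∘ proj₁ (colour (H k))

        H-increasing : ∀ k → Increasing (H k)
        H-increasing zero    = id
        H-increasing (suc k) = H-increasing k ∘ s≤s ∘ proj₁ (proj₂ (colour (H k)))

        nested : ∀ {k} d i → ∃[ j ] H (d + k) i ≡ H k j
        nested zero    i = i , refl
        nested (suc d) i = nested d _

        Red : ℕ → Set p
        Red k = ∀ i → P (H k 0) (H (suc k) i)

        not-red : ∀ k → ¬ Red k → ∀ i → ¬ P (H k 0) (H (suc k) i)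
        not-red k ¬red with proj₂ (proj₂ (colour (H k)))
        ... | inj₁ red  = ⊥-elim (¬red red)
        ... | inj₂ blue = blue

        later : ∀ {k l} → k < l → ∃[ j ] H l 0 ≡ H (suc k) j
        later {k} {l} k<l = let (j , e) = nested {suc k} (l ∸ suc k) 0
          in j , trans (cong (λ n → H n 0) (sym (m∸n+n≡m k<l))) e

      ramsey : Σ[ h ∈ (ℕ → ℕ) ] Increasing h ×
               ((∀ i j → i < j → P (h i) (h j)) ⊎ (∀ i j → i < j → ¬ P (h i) (h j)))
      ramsey = let (g , g-inc , c) = pigeonhole Red in
        (λ i → H (g i) 0) ,
        (λ i<j → increasing {λ k → H k 0} (λ k → H-increasing k (s≤s z≤n)) (g-inc i<j)) ,
        [ (λ red → inj₁ λ i j i<j → let (j′ , e) = later (g-inc i<j)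
             in ≡-subst (P _) (sym e) (red i j′))
        , (λ blue → inj₂ λ i j i<j p → let (j′ , e) = later (g-inc i<j)
             in not-red (g i) (blue i) j′ (≡-subst (P _) e p)) ]′ c

  -- Circles over a self-similar order

  next : ∀ {n} → Fin (suc n) → Fin (suc n)
  next i with view i
  ... | ‵fromℕ     = zero
  ... | ‵inject₁ j = suc j

  prev : ∀ {n} → Fin (suc n) → Fin (suc n)
  prev zero    = fromℕ _
  prev (suc j) = inject₁ j

  next-prev : ∀ {n} (i : Fin (suc n)) → next (prev i) ≡ i
  next-prev {n} zero rewrite view-fromℕ n = refl
  next-prev (suc j) rewrite view-inject₁ j = refl

  prev-next : ∀ {n} (i : Fin (suc n)) → prev (next i) ≡ i
  prev-next i with view i
  ... | ‵fromℕ     = refl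
  ... | ‵inject₁ j = refl

  next-injective : ∀ {n} {i j : Fin (suc n)} → next i ≡ next j → i ≡ j
  next-injective {i = i} {j} e = trans (sym (prev-next i)) (trans (cong prev e) (prev-next j))

  -- Only a preorder is asked for, and equality means `~`, because the points will be tuples
  -- representing elements of an interpreted order. The `origin` lies in the leftmost cell of every
  -- subdivision, which is why `rotation` fixes it.
  record SelfSimilar ℓ : Set (lsuc ℓ) where
    infix 4 _≲_ _~_
    field
      Point  : Set ℓ
      _≲_    : Point → Point → Set ℓ
      ≲-refl : ∀ {u} → u ≲ u
      ≲-trans : ∀ {u v w} → u ≲ v → v ≲ w → u ≲ w
      left right : Point → Point
      left-≲  : ∀ {u v} → left u ≲ left v ⇔ u ≲ v
      right-≲ : ∀ {u v} → right u ≲ right v ⇔ u ≲ v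
      left≲right : ∀ {u v} → left u ≲ right v
      right≴left : ∀ {u v} → ¬ right u ≲ left v

    _~_ : Point → Point → Set ℓ
    u ~ v = u ≲ v × v ≲ u

    field
      split  : ∀ w → (∃[ u ] w ~ left u) ⊎ (∃[ u ] w ~ right u)
      origin : Point
      origin-left : origin ~ left origin

  module Circle {ℓ} (I : SelfSimilar ℓ) where
    open SelfSimilar I

    ~-refl : ∀ {u} → u ~ u
    ~-refl = ≲-refl , ≲-refl

    ~-sym : ∀ {u v} → u ~ v → v ~ u
    ~-sym (p , q) = q , p

    ~-trans : ∀ {u v w} → u ~ v → v ~ w → u ~ w
    ~-trans (p , q) (r , s) = ≲-trans p r , ≲-trans s q

    ≲-resp : ∀ {u u′ v v′} → u ~ u′ → v ~ v′ → u ≲ v ⇔ u′ ≲ v′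
    ≲-resp (p , q) (r , s) = mk⇔ (λ e → ≲-trans q (≲-trans e r)) (λ e → ≲-trans p (≲-trans e s))

    left-~ : ∀ {u v} → u ~ v → left u ~ left v
    left-~ (p , q) = from left-≲ p , from left-≲ q

    right-~ : ∀ {u v} → u ~ v → right u ~ right v
    right-~ (p , q) = from right-≲ p , from right-≲ q

    record OrderCorrespondence : Set (lsuc ℓ) where
      field
        Z     : Point → Point → Set ℓ
        total : ∀ u → ∃[ v ] Z u v
        onto  : ∀ v → ∃[ u ] Z u v
        mono  : ∀ {u u′ v v′} → Z u u′ → Z v v′ → u ≲ v ⇔ u′ ≲ v′

    -- The tree rotation ((a b) c) ↦ (a (b c)).
    data Rotation (w w′ : Point) : Set ℓ where
      low : ∀ u → w ~ left (left u)  → w′ ~ left u          → Rotation w w′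
      mid : ∀ u → w ~ left (right u) → w′ ~ right (left u)  → Rotation w w′
      high  : ∀ u → w ~ right u        → w′ ~ right (right u) → Rotation w w′

    private
      both : ∀ {p q} {P : Set p} {Q : Set q} → P → Q → P ⇔ Q
      both p q = mk⇔ (λ _ → q) (λ _ → p)

      neither : ∀ {p q} {P : Set p} {Q : Set q} → ¬ P → ¬ Q → P ⇔ Q
      neither ¬p ¬q = mk⇔ (⊥-elim ∘ ¬p) (⊥-elim ∘ ¬q)

      infixr 2 _⟶_
      _⟶_ : ∀ {p q s} {P : Set p} {Q : Set q} {S : Set s} → P ⇔ Q → Q ⇔ S → P ⇔ S
      f ⟶ g = g ⇔-∘ f

    rotation : OrderCorrespondence
    rotation = record { Z = Rotation ; total = total ; onto = onto ; mono = mono }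
      where
      total : ∀ w → ∃[ w′ ] Rotation w w′
      total w with split w
      ... | inj₂ (u , p) = _ , high u p ~-refl
      ... | inj₁ (v , p) with split v
      ...   | inj₁ (u , q) = _ , low u (~-trans p (left-~ q)) ~-refl
      ...   | inj₂ (u , q) = _ , mid u (~-trans p (left-~ q)) ~-refl
      onto : ∀ w′ → ∃[ w ] Rotation w w′
      onto w′ with split w′
      ... | inj₁ (u , p) = _ , low u ~-refl p
      ... | inj₂ (v , p) with split v
      ...   | inj₁ (u , q) = _ , mid u ~-refl (~-trans p (right-~ q))
      ...   | inj₂ (u , q) = _ , high u ~-refl (~-trans p (right-~ q))
      mono : ∀ {w w′ v v′} → Rotation w w′ → Rotation v v′ → w ≲ v ⇔ w′ ≲ v′
      mono s t = canonical s t
        where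
        core : ∀ {w w′ v v′ a a′ b b′} → w ~ a → w′ ~ a′ → v ~ b → v′ ~ b′ → a ≲ b ⇔ a′ ≲ b′ →
               w ≲ v ⇔ w′ ≲ v′
        core p p′ q q′ h = ≲-resp p q ⟶ h ⟶ ⇔-sym (≲-resp p′ q′)
        canonical : ∀ {w w′ v v′} → Rotation w w′ → Rotation v v′ → w ≲ v ⇔ w′ ≲ v′
        canonical (low a p p′) (low b q q′) = core p p′ q q′ left-≲
        canonical (low a p p′) (mid b q q′) = core p p′ q q′ (both (from left-≲ left≲right) left≲right)
        canonical (low a p p′) (high b q q′)  = core p p′ q q′ (both left≲right left≲right)
        canonical (mid a p p′) (low b q q′) = core p p′ q q′ (neither (right≴left ∘ to left-≲) right≴left)
        canonical (mid a p p′) (mid b q q′) =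
          core p p′ q q′ (left-≲ ⟶ right-≲ ⟶ ⇔-sym left-≲ ⟶ ⇔-sym right-≲)
        canonical (mid a p p′) (high b q q′)  = core p p′ q q′ (both left≲right (from right-≲ left≲right))
        canonical (high a p p′) (low b q q′)  = core p p′ q q′ (neither right≴left right≴left)
        canonical (high a p p′) (mid b q q′)  = core p p′ q q′ (neither right≴left (right≴left ∘ to right-≲))
        canonical (high a p p′) (high b q q′)   = core p p′ q q′ (⇔-sym right-≲)

    -- With `rotation` for `𝒵` this is, up to inversion, the second standard generator of Thompson's
    -- group F, the first being `rotation` itself. It rearranges the right half while keeping the
    -- left half in place.
    data OnRight (𝒵 : OrderCorrespondence) (w w′ : Point) : Set ℓ where
      fixed : ∀ u → w ~ left u → w′ ~ left u → OnRight 𝒵 w w′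
      acted : ∀ u u′ → OrderCorrespondence.Z 𝒵 u u′ → w ~ right u → w′ ~ right u′ → OnRight 𝒵 w w′

    onRight : OrderCorrespondence → OrderCorrespondence
    onRight 𝒵 = record { Z = OnRight 𝒵 ; total = totalʳ ; onto = ontoʳ ; mono = monoʳ }
      where
      open OrderCorrespondence 𝒵
      totalʳ : ∀ w → ∃[ w′ ] OnRight 𝒵 w w′
      totalʳ w with split w
      ... | inj₁ (u , p) = _ , fixed u p ~-refl
      ... | inj₂ (u , p) = let (u′ , z) = total u in _ , acted u u′ z p ~-refl
      ontoʳ : ∀ w′ → ∃[ w ] OnRight 𝒵 w w′
      ontoʳ w with split w
      ... | inj₁ (u , p) = _ , fixed u ~-refl p
      ... | inj₂ (u′ , p) = let (u , z) = onto u′ in _ , acted u u′ z ~-refl p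
      monoʳ : ∀ {w w′ v v′} → OnRight 𝒵 w w′ → OnRight 𝒵 v v′ → w ≲ v ⇔ w′ ≲ v′
      monoʳ (fixed a p p′) (fixed b q q′) = ≲-resp p q ⟶ ⇔-sym (≲-resp p′ q′)
      monoʳ (fixed a p p′) (acted b b′ z q q′) = ≲-resp p q ⟶ both left≲right left≲right ⟶ ⇔-sym (≲-resp p′ q′)
      monoʳ (acted a a′ z p p′) (fixed b q q′) = ≲-resp p q ⟶ neither right≴left right≴left ⟶ ⇔-sym (≲-resp p′ q′)
      monoʳ (acted a a′ z p p′) (acted b b′ y q q′) =
        ≲-resp p q ⟶ right-≲ ⟶ mono z y ⟶ ⇔-sym right-≲ ⟶ ⇔-sym (≲-resp p′ q′)

    data Arc : List (Lift ℓ ℕ) → Set ℓ where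
      arc : ∀ n → Arc (n ∷ n ∷ [])

    signature : Signature ℓ
    signature = record { Sort = Lift ℓ ℕ ; Fun = λ _ _ → Empty.⊥ ; Rel = Arc }

    Position : Lift ℓ ℕ → Set ℓ
    Position n = Fin (suc (lower n)) × Point

    -- q is reached from p by moving forward by less than one copy of I.
    Near : ∀ {n} → Position n → Position n → Set ℓ
    Near (i , u) (j , v) = (i ≡ j × u ≲ v) ⊎ (j ≡ next i × ¬ u ≲ v)

    _≋_ : ∀ {n} → Position n → Position n → Set ℓ
    (i , u) ≋ (j , v) = i ≡ j × u ~ v

    Near-via : ∀ {n} {i i′ j j′ : Fin (suc (lower n))} {u u′ v v′} →
               i ≡ j ⇔ i′ ≡ j′ → j ≡ next i ⇔ j′ ≡ next i′ → u ≲ v ⇔ u′ ≲ v′ →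
               Near {n} (i , u) (j , v) ⇔ Near {n} (i′ , u′) (j′ , v′)
    Near-via e f g = mk⇔
      (λ { (inj₁ (p , q)) → inj₁ (to e p , to g q) ; (inj₂ (p , q)) → inj₂ (to f p , q ∘ from g) })
      (λ { (inj₁ (p , q)) → inj₁ (from e p , from g q) ; (inj₂ (p , q)) → inj₂ (from f p , q ∘ to g) })

    Near-resp : ∀ {n} {p p′ q q′ : Position n} → p ≋ p′ → q ≋ q′ → Near {n} p q ⇔ Near {n} p′ q′
    Near-resp {n} (refl , e) (refl , f) = Near-via {n} (⇔-id _) (⇔-id _) (≲-resp e f)

    -- Sort n is the (n + 1)-fold cover of the circle obtained by closing up I.
    circle : Structure signature ℓ
    circle = record
      { Dom      = λ n → record
          { Carrier = Position n
          ; _≈_     = _≋_ {n}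
          ; isEquivalence = record
              { refl  = refl , ~-refl
              ; sym   = λ (e , p) → sym e , ~-sym p
              ; trans = λ (e , p) (f , q) → trans e f , ~-trans p q } }
      ; fun      = λ ()
      ; fun-cong = λ ()
      ; rel      = λ { (arc n) xs → Near {n} (xs zero) (xs (suc zero)) }
      ; rel-resp = λ { (arc n) e → to (Near-resp {n} (e zero) (e (suc zero))) }
      }

    fromOrder : OrderCorrespondence → Correspondence circle circle ℓ
    fromOrder 𝒵 = record
      { Z     = λ (i , u) (j , v) → i ≡ j × Z u v
      ; total = λ (i , u) → let (v , z) = total u in (i , v) , refl , z
      ; onto  = λ (i , v) → let (u , z) = onto v in (i , u) , refl , z
      ; eq    = λ { (refl , y) (refl , z) → mk⇔
          (λ (e , p , q) → e , to (mono y z) p , to (mono z y) q)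
          (λ (e , p , q) → e , from (mono y z) p , from (mono z y) q) }
      ; fun   = λ ()
      ; rel   = λ { (arc n) {xs} {ys} z → lemma {n} (z zero) (z (suc zero)) }
      }
      where
      open OrderCorrespondence 𝒵
      lemma : ∀ {n i i′ j j′ u u′ v v′} → (i ≡ i′ × Z u u′) → (j ≡ j′ × Z v v′) →
              Near {n} (i , u) (j , v) ⇔ Near {n} (i′ , u′) (j′ , v′)
      lemma {n} (refl , y) (refl , z) = Near-via {n} (⇔-id _) (⇔-id _) (mono y z)

    module _ {n : Lift ℓ ℕ} {i j : Fin (suc (lower n))} {u v : Point} where

      Near-left-left : Near {n} (i , left u) (j , left v) ⇔ Near {n} (i , u) (j , v)
      Near-left-left = Near-via {n} (⇔-id _) (⇔-id _) left-≲

      Near-right-right : Near {n} (i , right u) (j , right v) ⇔ Near {n} (i , u) (j , v)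
      Near-right-right = Near-via {n} (⇔-id _) (⇔-id _) right-≲

      Near-left-right : Near {n} (i , left u) (j , right v) ⇔ (i ≡ j)
      Near-left-right = mk⇔
        (λ { (inj₁ (e , _)) → e ; (inj₂ (_ , p)) → ⊥-elim (p left≲right) })
        (λ e → inj₁ (e , left≲right))

      Near-right-left : Near {n} (i , right u) (j , left v) ⇔ (j ≡ next i)
      Near-right-left = mk⇔
        (λ { (inj₁ (_ , p)) → ⊥-elim (right≴left p) ; (inj₂ (e , _)) → e })
        (λ e → inj₂ (e , right≴left))

      Near-next : Near {n} (next i , u) (next j , v) ⇔ Near {n} (i , u) (j , v)
      Near-next = Near-via {n} (mk⇔ next-injective (cong next)) (mk⇔ next-injective (cong next)) (⇔-id _)

    -- A rotation by half a copy, the same in every sort; applied twice, it leads to the same point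
    -- of the next copy. It carries the boundary between two copies to the middle of a copy.
    data HalfTurn {n} (p q : Position n) : Set ℓ where
      within : ∀ i u → p ≋ (i , left u)  → q ≋ (i , right u)     → HalfTurn p q
      across : ∀ i u → p ≋ (i , right u) → q ≋ (next i , left u) → HalfTurn p q

    halfTurn : Correspondence circle circle ℓ
    halfTurn = record
      { Z     = λ {n} → HalfTurn {n}
      ; total = total
      ; onto  = onto
      ; eq    = eq
      ; fun   = λ ()
      ; rel   = λ { (arc n) z → near {n} (z zero) (z (suc zero)) }
      }
      where
      total : ∀ {n} (p : Position n) → ∃[ q ] HalfTurn {n} p q
      total (i , w) with split w
      ... | inj₁ (u , e) = _ , within i u (refl , e) (refl , ~-refl)
      ... | inj₂ (u , e) = _ , across i u (refl , e) (refl , ~-refl)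
      onto : ∀ {n} (q : Position n) → ∃[ p ] HalfTurn {n} p q
      onto (i , w) with split w
      ... | inj₁ (u , e) = _ , across (prev i) u (refl , ~-refl) (sym (next-prev i) , e)
      ... | inj₂ (u , e) = _ , within i u (refl , ~-refl) (refl , e)
      ≋-resp : ∀ {n} {p p′ q q′ : Position n} → p ≋ p′ → q ≋ q′ → (p ≋ q) ⇔ (p′ ≋ q′)
      ≋-resp (refl , e) (refl , f) = mk⇔
        (λ (k , h) → k , ~-trans (~-sym e) (~-trans h f))
        (λ (k , h) → k , ~-trans e (~-trans h (~-sym f)))
      eq : ∀ {n} {p p′ q q′ : Position n} → HalfTurn {n} p q → HalfTurn {n} p′ q′ → (p ≋ p′) ⇔ (q ≋ q′)
      eq {n} (within i u e f) (within j v e′ f′) = ≋-resp {n} e e′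
        ⟶ mk⇔ (λ (k , x , y) → k , from right-≲ (to left-≲ x) , from right-≲ (to left-≲ y))
              (λ (k , x , y) → k , from left-≲ (to right-≲ x) , from left-≲ (to right-≲ y))
        ⟶ ⇔-sym (≋-resp {n} f f′)
      eq {n} (within i u e f) (across j v e′ f′) = ≋-resp {n} e e′
        ⟶ neither (right≴left ∘ proj₂ ∘ proj₂) (right≴left ∘ proj₁ ∘ proj₂) ⟶ ⇔-sym (≋-resp {n} f f′)
      eq {n} (across i u e f) (within j v e′ f′) = ≋-resp {n} e e′
        ⟶ neither (right≴left ∘ proj₁ ∘ proj₂) (right≴left ∘ proj₂ ∘ proj₂) ⟶ ⇔-sym (≋-resp {n} f f′)
      eq {n} (across i u e f) (across j v e′ f′) = ≋-resp {n} e e′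
        ⟶ mk⇔ (λ (k , x , y) → cong next k , from left-≲ (to right-≲ x) , from left-≲ (to right-≲ y))
              (λ (k , x , y) → next-injective k , from right-≲ (to left-≲ x) , from right-≲ (to left-≲ y))
        ⟶ ⇔-sym (≋-resp {n} f f′)
      near : ∀ {n} {p p′ q q′ : Position n} → HalfTurn {n} p q → HalfTurn {n} p′ q′ →
             Near {n} p p′ ⇔ Near {n} q q′
      near {n} (within i u e f) (within j v e′ f′) = Near-resp {n} e e′
        ⟶ Near-left-left {n} ⟶ ⇔-sym (Near-right-right {n}) ⟶ ⇔-sym (Near-resp {n} f f′)
      near {n} (within i u e f) (across j v e′ f′) = Near-resp {n} e e′
        ⟶ Near-left-right {n} ⟶ mk⇔ (λ k → cong next (sym k)) (λ k → sym (next-injective k))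
        ⟶ ⇔-sym (Near-right-left {n}) ⟶ ⇔-sym (Near-resp {n} f f′)
      near {n} (across i u e f) (within j v e′ f′) = Near-resp {n} e e′
        ⟶ Near-right-left {n} ⟶ mk⇔ sym sym
        ⟶ ⇔-sym (Near-left-right {n}) ⟶ ⇔-sym (Near-resp {n} f f′)
      near {n} (across i u e f) (across j v e′ f′) = Near-resp {n} e e′
        ⟶ Near-right-right {n} ⟶ ⇔-sym (Near-next {n}) ⟶ ⇔-sym (Near-left-left {n})
        ⟶ ⇔-sym (Near-resp {n} f f′)

  -- Finite Lascar distances

  module LascarDistance {ℓ} (I : SelfSimilar ℓ) where
    open SelfSimilar I
    open Circle I

    -- One variable of each sort, so that a single tuple is subject to the lower bounds of all
    -- sorts.
    Γ : Context (Lift ℓ ℕ) ℓ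
    Γ = ctx (Lift ℓ ℕ) id

    -- Counts half turns from the origin of copy zero: the copy reached, and whether the point
    -- starts the left half of it or (`true`) the right half. In sort `n` the count wraps around
    -- after 2(n + 1) half turns.
    state : ∀ {n} → ℕ → Fin (suc n) × Bool
    state zero = zero , false
    state (suc k) with state k
    ... | i , false = i , true
    ... | i , true  = next i , false

    mark : ∀ {n} → Fin (suc n) × Bool → Fin (suc n) × Point
    mark (i , false) = i , origin
    mark (i , true)  = i , right origin

    S D : ℕ → Tuple circle Γ
    S k n = mark (state k)

    iterate : ℕ → Point
    iterate zero    = origin
    iterate (suc i) = right (iterate i)

    -- All these points lie in copy zero of every circle. The sequence begins with `right origin`,
    -- as `rotation` fixes `origin` but moves each later iterate to the next.
    D i n = zero , iterate (suc i)

    infix 4 _≈ᵀ_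
    _≈ᵀ_ : (p q : Tuple circle Γ × Tuple circle Γ) → Set ℓ
    (a , b) ≈ᵀ (c , d) = ∀ (φ : Formula signature (Γ ⊕ Γ)) →
                         circle ⊨ φ [ a ⊞ b ] ⇔ circle ⊨ φ [ c ⊞ d ]

    ≈ᵀ-trans : ∀ {p q r} → p ≈ᵀ q → q ≈ᵀ r → p ≈ᵀ r
    ≈ᵀ-trans f g φ = mk⇔ (to (g φ) ∘ to (f φ)) (from (f φ) ∘ from (g φ))

    ≈ᵀ-sym : ∀ {p q} → p ≈ᵀ q → q ≈ᵀ p
    ≈ᵀ-sym f φ = mk⇔ (from (f φ)) (to (f φ))

    module _ (𝒵 : Correspondence circle circle ℓ) where
      open Correspondence 𝒵 using (Z)

      along : ∀ {a b c d : Tuple circle Γ} → (∀ n → Z {n} (a n) (c n)) → (∀ n → Z {n} (b n) (d n)) →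
              (a , b) ≈ᵀ (c , d)
      along f g = corr-⊨ 𝒵 λ { (inj₁ n) → f n ; (inj₂ n) → g n }

    S-half : ∀ k n → HalfTurn {n} (S k n) (S (suc k) n)
    S-half k n with state {lower n} k
    ... | i , false = within i origin (refl , origin-left) (refl , ~-refl)
    ... | i , true  = across i origin (refl , ~-refl) (refl , origin-left)

    S-pairs : ∀ k → (S 0 , S 1) ≈ᵀ (S k , S (suc k))
    S-pairs zero    φ = mk⇔ id id
    S-pairs (suc k) = ≈ᵀ-trans (S-pairs k) (along halfTurn (S-half k) (S-half (suc k)))

    rotated : ∀ i → Rotation (iterate (suc i)) (iterate (suc (suc i)))
    rotated i = high (iterate i) ~-refl ~-refl

    rotation-origin : Rotation origin origin
    rotation-origin = low origin (~-trans origin-left (left-~ origin-left)) origin-left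

    D-shift : ∀ i j → (D i , D j) ≈ᵀ (D (suc i) , D (suc j))
    D-shift i j = along (fromOrder rotation) (λ _ → refl , rotated i) (λ _ → refl , rotated j)

    -- `onRight rotation` fixes `right origin`, the point of `D 0`, because `rotation` fixes
    -- `origin`; inside the right half it advances the later points by one.
    D-stretch : ∀ j → (D 0 , D (suc j)) ≈ᵀ (D 0 , D (suc (suc j)))
    D-stretch j = along (fromOrder (onRight rotation))
      (λ _ → refl , acted origin origin rotation-origin ~-refl ~-refl)
      (λ _ → refl , acted _ _ (rotated j) ~-refl ~-refl)

    -- The arc from `origin` to `right origin` is first shrunk into the left half by the inverse of
    -- `rotation`; a half turn then carries it into the right half of the same copy, onto the first
    -- two points of `D`.
    S-D : (S 0 , S 1) ≈ᵀ (D 0 , D 1)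
    S-D = ≈ᵀ-trans
      (≈ᵀ-sym (along (fromOrder rotation) (λ _ → refl , rotation-origin)
                     (λ _ → refl , mid origin ~-refl (right-~ origin-left))))
      (along halfTurn {b = λ _ → zero , left (right origin)}
        (λ _ → within zero origin (refl , origin-left) (refl , ~-refl))
        (λ _ → within zero (right origin) (refl , ~-refl) (refl , ~-refl)))

    D-pairs : ∀ i j → i < j → (S 0 , S 1) ≈ᵀ (D i , D j)
    D-pairs zero    (suc zero)    _         = S-D
    D-pairs zero    (suc (suc j)) _         = ≈ᵀ-trans (D-pairs zero (suc j) (s≤s z≤n)) (D-stretch j)
    D-pairs (suc i) (suc j)       (s≤s i<j) = ≈ᵀ-trans (D-pairs i j i<j) (D-shift i j)

    module _ {ℭ : Structure signature (lsuc ℓ)} (monster : IsMonster (Th circle) ℭ)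
             (e : Tuple ℭ (Elements circle)) (e-elementary : circle ⟪ elements circle ⟫≼ ℭ ⟪ e ⟫) where
      private
        module S′ {n} = Setoid (Structure.Dom ℭ n)

      Ŝ : ℕ → Tuple ℭ Γ
      Ŝ k n = e (n , S k n)

      private
        -- Families of sets of formulas over the model. A type over the model is one set of
        -- formulas, so by Cantor there are more indices here than types; yet `X` is small, so
        -- saturation applies to `ΓX`.
        X : Set ℓ
        X = (Formula signature (Γ ⊕ Elements circle) → Bool) → Bool

        ΓX : Context (Lift ℓ ℕ) ℓ
        ΓX = ctx (X × Lift ℓ ℕ) proj₂

        at : X → X → ∀ n → Term signature ΓX (sort (Γ ⊕ Γ) n)
        at x y (inj₁ n) = var (x , n)
        at x y (inj₂ n) = var (y , n)

        -- `X` carries no order, so a condition on two of its points cannot fix which comes first.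
        either : X → X → Formula signature (Γ ⊕ Γ) → Formula signature ΓX
        either x y φ = rename φ (at x y) ∨̇ rename φ (at y x)

        -- Any two of the points indexed by X are to look like S 0 and S 1, in one
        -- order or the other.
        Spread : Pred (Formula signature ΓX) ℓ
        Spread ψ = ∃[ x ] ∃[ y ] ∃[ φ ]
          ¬ x ≡ y × circle ⊨ φ [ append circle {Γ} {Γ} (S 0) (S 1) ] × either x y φ ≡ ψ

        module _ {m} (A : Structure signature m) (a : Tuple A ΓX) where

          point : X → Tuple A Γ
          point x n = a (x , n)

          at-⊨ : ∀ x y φ → A ⊨ rename φ (at x y) [ a ] ⇔ A ⊨ φ [ point x ⊞ point y ]
          at-⊨ x y φ = ⊨-rename A φ λ
            { (inj₁ n) → Setoid.refl (Structure.Dom A n) ; (inj₂ n) → Setoid.refl (Structure.Dom A n) }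

          either-⊨ : ∀ x y φ → A ⊨ either x y φ [ a ] ⇔
                     (A ⊨ φ [ point x ⊞ point y ] ⊎ A ⊨ φ [ point y ⊞ point x ])
          either-⊨ x y φ = mk⇔
            ([ inj₁ ∘ to (at-⊨ x y φ) , inj₂ ∘ to (at-⊨ y x φ) ]′ ∘
               to (∨̇-⊨ A a (rename φ (at x y)) (rename φ (at y x))))
            (from (∨̇-⊨ A a (rename φ (at x y)) (rename φ (at y x))) ∘
               [ inj₁ ∘ from (at-⊨ x y φ) , inj₂ ∘ from (at-⊨ y x φ) ]′)

        rank : List X → X → ℕ
        rank []       x = 0
        rank (y ∷ ys) x with em {P = x ≡ y}
        ... | yes _ = 0
        ... | no  _ = suc (rank ys x)

        -- It is enough that one of the two points is listed: an unlisted point has the length of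
        -- the list as its rank, which no listed point has. Hence `mentioned` records only the first
        -- point of each pair.
        rank-injective : ∀ {xs x y} → x ∈ xs → rank xs x ≡ rank xs y → x ≡ y
        rank-injective {z ∷ zs} {x} {y} p h with em {P = x ≡ z} | em {P = y ≡ z}
        ... | yes refl | yes refl = refl
        rank-injective {z ∷ zs} (here refl) h | no x≢z | no _ = ⊥-elim (x≢z refl)
        rank-injective {z ∷ zs} (there p)   h | no _   | no _ = rank-injective p (suc-injective h)

        mentioned : ∀ ψs → All Spread ψs → List X
        mentioned []       []                 = []
        mentioned (_ ∷ ψs) ((x , _) ∷ qs) = x ∷ mentioned ψs qs

        spread-out : (X → ℕ) → Tuple circle ΓX
        spread-out h (x , n) = D (h x) n

        spread-out-⊨ : ∀ h ψs (qs : All Spread ψs) →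
                       (∀ {x y} → x ∈ mentioned ψs qs → h x ≡ h y → x ≡ y) →
                       All (λ ψ → circle ⊨ ψ [ spread-out h ]) ψs
        spread-out-⊨ h [] [] _ = []
        spread-out-⊨ h (_ ∷ ψs) ((x , y , φ , x≢y , q , refl) ∷ qs) inj =
          from (either-⊨ circle (spread-out h) x y φ) (ordered (<-cmp (h x) (h y)))
            ∷ spread-out-⊨ h ψs qs (inj ∘ there)
          where
          ordered : Tri (h x < h y) (h x ≡ h y) (h y < h x) →
                    circle ⊨ φ [ D (h x) ⊞ D (h y) ] ⊎ circle ⊨ φ [ D (h y) ⊞ D (h x) ]
          ordered (tri< lt _ _) = inj₁ (to (D-pairs _ _ lt φ) q)
          ordered (tri≈ _ eq _) = ⊥-elim (x≢y (inj (here refl) eq))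
          ordered (tri> _ _ gt) = inj₂ (to (D-pairs _ _ gt φ) q)

        large : Σ[ a ∈ Tuple ℭ ΓX ] (∀ ψ → Spread ψ → ℭ ⊨ ψ [ a ])
        large = realizeType monster Spread λ ψs qs →
          spread-out (rank (mentioned ψs qs)) , spread-out-⊨ _ ψs qs rank-injective

        module Twins (a : Tuple ℭ ΓX) (spread : ∀ ψ → Spread ψ → ℭ ⊨ ψ [ a ]) where

          A : X → Tuple ℭ Γ
          A = point ℭ a

          Standard : X → X → Set (lsuc ℓ)
          Standard x y = circle ⟪ append circle {Γ} {Γ} (S 0) (S 1) ⟫≼ ℭ ⟪ append ℭ {Γ} {Γ} (A x) (A y) ⟫

          -- Each instance of `either` could hold in a different order. But formulas `φ` and `ψ`
          -- that refute the two orders would make the instance for their conjunction false in both.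
          standard : ∀ {x y} → ¬ x ≡ y → Standard x y ⊎ Standard y x
          standard {x} {y} x≢y with em {P = Standard x y}
          ... | yes s = inj₁ s
          ... | no ¬s = inj₂ λ φ p → dne λ k → drop (absurd φ p k)
            where
            absurd : ∀ φ → circle ⊨ φ [ append circle {Γ} {Γ} (S 0) (S 1) ] →
                     (ℭ ⊨ φ [ append ℭ {Γ} {Γ} (A y) (A x) ] → Empty.⊥ {0ℓ}) → Empty.⊥ {0ℓ}
            absurd φ p ¬φ = raise (¬s λ ψ q → dne λ ¬ψ → refute ψ q ¬ψ)
              where
              refute : ∀ ψ → circle ⊨ ψ [ append circle {Γ} {Γ} (S 0) (S 1) ] →
                       (ℭ ⊨ ψ [ append ℭ {Γ} {Γ} (A x) (A y) ] → Empty.⊥ {0ℓ}) → ⊥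
              refute ψ q ¬ψ with to (either-⊨ ℭ a x y (φ ∧̇ ψ))
                  (spread (either x y (φ ∧̇ ψ)) (x , y , φ ∧̇ ψ , x≢y ,
                    from (∧̇-⊨ circle (append circle {Γ} {Γ} (S 0) (S 1)) φ ψ) (p , q) , refl))
              ... | inj₁ h = drop (¬ψ (proj₂ (to (∧̇-⊨ ℭ (append ℭ {Γ} {Γ} (A x) (A y)) φ ψ) h)))
              ... | inj₂ h = drop (¬φ (proj₁ (to (∧̇-⊨ ℭ (append ℭ {Γ} {Γ} (A y) (A x)) φ ψ) h)))

          Indiscernible : X → X → Set _
          Indiscernible x y = SameType ℭ {Γ = Γ} {Elements circle} e (A x) (A y)

          twins : ∃[ x ] ∃[ y ] Standard x y × Indiscernible x y
          twins = result (standard x≢y)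
            where
            type : X → Formula signature (Γ ⊕ Elements circle) → Bool
            type x φ = does (em {P = ℭ ⊨ φ [ A x ⊞ e ]})
            x y : X
            x = proj₁ (collapse type)
            y = proj₁ (proj₂ (collapse type))
            x≢y : ¬ x ≡ y
            x≢y = proj₁ (proj₂ (proj₂ (collapse type)))
            transport : ∀ {p q} {P : Set p} {Q : Set q} (d : Dec P) (d′ : Dec Q) → does d ≡ does d′ → P → Q
            transport (yes _) (yes q) _ _ = q
            transport (no ¬p) _       _ p = ⊥-elim (¬p p)
            same-type : Indiscernible x y
            same-type φ = mk⇔
              (transport em em (proj₂ (proj₂ (proj₂ (collapse type))) φ))
              (transport em em (sym (proj₂ (proj₂ (proj₂ (collapse type))) φ)))
            result : Standard x y ⊎ Standard y x → ∃[ x ] ∃[ y ] Standard x y × Indiscernible x y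
            result (inj₁ s) = x , y , s , same-type
            result (inj₂ s) = y , x , s , λ φ → mk⇔ (from (same-type φ)) (to (same-type φ))

      -- The pair of twins has the type of `S 0` and `S 1`, hence of each pair of neighbours, so an
      -- automorphism `F` moves it there. The twins agree over the embedded `circle`, so the
      -- neighbours agree over its image under `F`, a model that depends on `k`.
      neighbours : ∀ k → Σ[ V ∈ SmallElementarySubmodel ℭ ]
                   SameType ℭ {Γ = Γ} (SmallElementarySubmodel.points V) (Ŝ k) (Ŝ (suc k))
      neighbours k = moved F (submodel e-elementary) , λ φ → mk⇔
          (λ p → to (shift y φ (Ŝ (suc k)) (λ n → F-maps (inj₂ n)))
            (to (ind φ) (from (shift x φ (Ŝ k) (λ n → F-maps (inj₁ n))) p)))
          (λ p → to (shift x φ (Ŝ k) (λ n → F-maps (inj₁ n)))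
            (from (ind φ) (from (shift y φ (Ŝ (suc k)) (λ n → F-maps (inj₂ n))) p)))
        where
        open Twins (proj₁ large) (proj₂ large)
        x = proj₁ twins
        y = proj₁ (proj₂ twins)
        ind : Indiscernible x y
        ind = proj₂ (proj₂ (proj₂ twins))
        Ax≼Ŝ : ℭ ⟪ append ℭ {Γ} {Γ} (A x) (A y) ⟫≼ ℭ ⟪ append ℭ {Γ} {Γ} (Ŝ k) (Ŝ (suc k)) ⟫
        Ax≼Ŝ φ p = to (⊨-resp ℭ (λ { (inj₁ n) → S′.refl ; (inj₂ n) → S′.refl }) φ)
          (to (embedding-⊨ {ℭ = ℭ} {e} e-elementary φ (append circle {Γ} {Γ} (S k) (S (suc k))))
            (to (S-pairs k φ) (≼-converse {A = circle} {ℭ} {a = append circle {Γ} {Γ} (S 0) (S 1)}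
              {append ℭ {Γ} {Γ} (A x) (A y)} (proj₁ (proj₂ (proj₂ twins))) φ p)))
        moving = homogeneous monster {a = append ℭ {Γ} {Γ} (A x) (A y)} {append ℭ {Γ} {Γ} (Ŝ k) (Ŝ (suc k))} Ax≼Ŝ
        F = proj₁ moving
        F-maps = proj₂ moving
        shift : ∀ z φ (s : Tuple ℭ Γ) → (∀ n → Structure._≈_ ℭ (Automorphism.to F (A z n)) (s n)) →
                ℭ ⊨ φ [ append ℭ {Γ} {Elements circle} (A z) e ] ⇔
                ℭ ⊨ φ [ append ℭ {Γ} {Elements circle} s (λ c → Automorphism.to F (e c)) ]
        shift z φ s h = corr-⊨ (graph ℭ F) (λ { (inj₁ n) → h n ; (inj₂ c) → S′.refl }) φ

      connected : ∀ k i → LascarDist≤ ℭ {Γ} k (Ŝ i) (Ŝ (k + i))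
      connected zero    i = done λ _ → S′.refl
      connected (suc k) i = step (proj₁ (neighbours i)) (proj₂ (neighbours i))
        (≡-subst (λ j → LascarDist≤ ℭ {Γ} k (Ŝ (suc i)) (Ŝ j)) (+-suc k i) (connected k (suc i)))

  -- Large Lascar distances

  double : ℕ → ℕ
  double zero    = zero
  double (suc k) = suc (suc (double k))

  module LowerBound {ℓ} (I : SelfSimilar ℓ) (n : ℕ) where
    open SelfSimilar I
    open Circle I
    open LascarDistance I

    N : Lift ℓ ℕ
    N = lift n

    two : ∀ {a} {A : Set a} → A → A → Fin 2 → A
    two p q zero       = p
    two p q (suc zero) = q

    pair : ∀ {m} (A : Structure signature m) → ∣ A ∣ N → ∣ A ∣ N → ∀ k → ∣ A ∣ (lookup (N ∷ N ∷ []) k)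
    pair A p q zero       = p
    pair A p q (suc zero) = q

    near : ∀ {i} {Δ : Context (Lift ℓ ℕ) i} → Term signature Δ N → Term signature Δ N →
           Formula signature Δ
    near t u = atom (arc N) λ { zero → t ; (suc zero) → u }

    module _ {m} (A : Structure signature m) where
      open Structure A

      NearIn : ∣ A ∣ N → ∣ A ∣ N → Set m
      NearIn p q = rel (arc N) (pair A p q)

      near-⊨ : ∀ {i} {Δ : Context (Lift ℓ ℕ) i} (a : Tuple A Δ) t u →
               A ⊨ near t u [ a ] ⇔ NearIn (eval A a t) (eval A a u)
      near-⊨ a t u = mk⇔
        (rel-resp (arc N) λ { zero → Setoid.refl (Dom N) ; (suc zero) → Setoid.refl (Dom N) })
        (rel-resp (arc N) λ { zero → Setoid.refl (Dom N) ; (suc zero) → Setoid.refl (Dom N) })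

      NearIn-resp : ∀ {p p′ q q′} → p ≈ p′ → q ≈ q′ → NearIn p q → NearIn p′ q′
      NearIn-resp e f = rel-resp (arc N) λ { zero → e ; (suc zero) → f }

      -- What a Lascar path leaves behind in one sort: consecutive points share an arc starting at a
      -- common `o`. For fixed `k` this is the formula `chain`, which unlike Lascar distance can be
      -- pulled back from the monster model to `circle`.
      Chain : ℕ → ∣ A ∣ N → ∣ A ∣ N → Set m
      Chain zero    p q = p ≈ q
      Chain (suc k) p q = ∃[ o ] ∃[ p′ ] NearIn o p × NearIn o p′ × Chain k p′ q

      Chain-resp : ∀ k {p p′ q q′} → p ≈ p′ → q ≈ q′ → Chain k p q → Chain k p′ q′
      Chain-resp zero    e f h = Setoid.trans (Dom N) (Setoid.sym (Dom N) e) (Setoid.trans (Dom N) h f)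
      Chain-resp (suc k) e f (o , p″ , x , y , h) =
        o , p″ , NearIn-resp (Setoid.refl (Dom N)) e x , y , Chain-resp k (Setoid.refl (Dom N)) f h

    chain : ∀ {i} {Δ : Context (Lift ℓ ℕ) i} → ℕ → Term signature Δ N → Term signature Δ N →
            Formula signature Δ
    chain zero    t u = t ≐ u
    chain (suc k) t u = ∃̇ N (∃̇ N (near (var (just nothing)) (weaken (weaken t)) ∧̇
      (near (var (just nothing)) (var nothing) ∧̇ chain k (var nothing) (weaken (weaken u)))))

    module _ {m} (A : Structure signature m) where
      open Structure A

      chain-⊨ : ∀ {i} {Δ : Context (Lift ℓ ℕ) i} (a : Tuple A Δ) k t u →
                A ⊨ chain k t u [ a ] ⇔ Chain A k (eval A a t) (eval A a u)
      chain-⊨ a zero    t u = mk⇔ id id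
      chain-⊨ {Δ = Δ} a (suc k) t u = mk⇔ f g
        where
        φ₁ φ₂ φ₃ : Formula signature (Δ ▹ N ▹ N)
        φ₁ = near (var (just nothing)) (weaken (weaken t))
        φ₂ = near (var (just nothing)) (var nothing)
        φ₃ = chain k (var nothing) (weaken (weaken u))
        ext : ∣ A ∣ N → ∣ A ∣ N → Tuple A (Δ ▹ N ▹ N)
        ext o p = extend A (extend A a o) p
        weak : ∀ o p v → eval A (ext o p) (weaken (weaken v)) ≈ eval A a v
        weak o p v = Setoid.trans (Dom N) (eval-weaken A {a = extend A a o} (weaken v)) (eval-weaken A {a = a} v)
        f : A ⊨ chain (suc k) t u [ a ] → Chain A (suc k) (eval A a t) (eval A a u)
        f h = let
            (o , h₁) = to (∃̇-⊨ A a N (∃̇ N (φ₁ ∧̇ (φ₂ ∧̇ φ₃)))) h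
            (p , h₂) = to (∃̇-⊨ A (extend A a o) N (φ₁ ∧̇ (φ₂ ∧̇ φ₃))) h₁
            (x , h₃) = to (∧̇-⊨ A (ext o p) φ₁ (φ₂ ∧̇ φ₃)) h₂
            (y , z) = to (∧̇-⊨ A (ext o p) φ₂ φ₃) h₃
          in o , p ,
             NearIn-resp A (Setoid.refl (Dom N)) (weak o p t) (to (near-⊨ A (ext o p) _ (weaken (weaken t))) x) ,
             to (near-⊨ A (ext o p) _ _) y ,
             Chain-resp A k (Setoid.refl (Dom N)) (weak o p u)
               (to (chain-⊨ (ext o p) k (var nothing) (weaken (weaken u))) z)
        g : Chain A (suc k) (eval A a t) (eval A a u) → A ⊨ chain (suc k) t u [ a ]
        g (o , p , x , y , z) =
          from (∃̇-⊨ A a N (∃̇ N (φ₁ ∧̇ (φ₂ ∧̇ φ₃)))) (o ,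
          from (∃̇-⊨ A (extend A a o) N (φ₁ ∧̇ (φ₂ ∧̇ φ₃))) (p ,
          from (∧̇-⊨ A (ext o p) φ₁ (φ₂ ∧̇ φ₃)) (
            from (near-⊨ A (ext o p) (var (just nothing)) (weaken (weaken t)))
              (NearIn-resp A (Setoid.refl (Dom N)) (Setoid.sym (Dom N) (weak o p t)) x) ,
          from (∧̇-⊨ A (ext o p) φ₂ φ₃) (
            from (near-⊨ A (ext o p) (var (just nothing)) (var nothing)) y ,
            from (chain-⊨ (ext o p) k (var nothing) (weaken (weaken u)))
              (Chain-resp A k (Setoid.refl (Dom N)) (Setoid.sym (Dom N) (weak o p u)) z)))))

    Marks : Context (Lift ℓ ℕ) 0ℓ
    Marks = ctx (Fin (suc n)) λ _ → N

    arcFrom : Fin (suc n) → Formula signature (Marks ▹ N)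
    arcFrom i = near (var (just i)) (var nothing)

    covering : Formula signature Marks
    covering = ∀̇ N (⋁ (suc n) arcFrom)

    marks : Tuple circle Marks
    marks i = i , origin

    covered : circle ⊨ covering [ marks ]
    covered (i , u) = from (⋁-⊨ circle (extend circle marks (i , u)) (suc n) arcFrom) arc-found
      where
      arc-found : Σ[ j ∈ Fin (suc n) ] circle ⊨ arcFrom j [ extend circle marks (i , u) ]
      -- The record `SelfSimilar` does not make `origin` least; a point not above it is within reach
      -- of the mark in the previous copy.
      arc-found with em {P = origin ≲ u}
      ... | yes p = i , inj₁ (refl , p)
      ... | no ¬p = prev i , inj₂ (sym (next-prev i) , ¬p)

    -- i is at most s steps away from zero, in one direction or the other.
    Within : ℕ → Fin (suc n) → Set
    Within s i = toℕ i ≤ s ⊎ suc n ≤ toℕ i + s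

    next-cases : ∀ {n} (i : Fin (suc n)) → toℕ (next i) ≡ suc (toℕ i) ⊎ (toℕ (next i) ≡ 0 × toℕ i ≡ n)
    next-cases i with view i
    ... | ‵fromℕ     = inj₂ (refl , toℕ-fromℕ _)
    ... | ‵inject₁ j = inj₁ (cong suc (sym (toℕ-inject₁ j)))

    Within-suc : ∀ {s i} → Within s i → Within (suc s) i
    Within-suc {s} {i} (inj₁ p) = inj₁ (m≤n⇒m≤1+n p)
    Within-suc {s} {i} (inj₂ p) = inj₂ (≤-trans p (+-monoʳ-≤ (toℕ i) (n≤1+n s)))

    Within-next : ∀ {s i} → Within s i → Within (suc s) (next i)
    Within-next {s} {i} w with next-cases i
    Within-next {s} {i} w        | inj₂ (e , _) = inj₁ (≤-trans (≤-reflexive e) z≤n)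
    Within-next {s} {i} (inj₁ p) | inj₁ e = inj₁ (≤-trans (≤-reflexive e) (s≤s p))
    Within-next {s} {i} (inj₂ p) | inj₁ e = inj₂ (≤-trans (m≤n⇒m≤1+n p)
      (≤-trans (s≤s (+-monoʳ-≤ (toℕ i) (n≤1+n s))) (≤-reflexive (cong (_+ suc s) (sym e)))))

    Within-prev : ∀ {s i} → Within s (next i) → Within (suc s) i
    Within-prev {s} {i} w with next-cases i
    Within-prev {s} {i} w        | inj₂ (_ , e) =
      inj₂ (≤-trans (s≤s (m≤m+n n s)) (≤-reflexive (trans (cong (λ k → suc k + s) (sym e)) (sym (+-suc (toℕ i) s)))))
    Within-prev {s} {i} (inj₁ p) | inj₁ e =
      inj₁ (m≤n⇒m≤1+n (≤-trans (n≤1+n _) (≤-trans (≤-reflexive (sym e)) p)))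
    Within-prev {s} {i} (inj₂ p) | inj₁ e =
      inj₂ (≤-trans p (≤-reflexive (trans (cong (_+ s) e) (sym (+-suc (toℕ i) s)))))

    Near-forward : ∀ {s} (p q : Position N) → Near {N} p q → Within s (proj₁ p) → Within (suc s) (proj₁ q)
    Near-forward (i , _) (j , _) (inj₁ (refl , _)) w = Within-suc {i = i} w
    Near-forward (i , _) (j , _) (inj₂ (refl , _)) w = Within-next {i = i} w

    Near-backward : ∀ {s} (p q : Position N) → Near {N} p q → Within s (proj₁ q) → Within (suc s) (proj₁ p)
    Near-backward (i , _) (j , _) (inj₁ (refl , _)) w = Within-suc {i = i} w
    Near-backward (i , _) (j , _) (inj₂ (refl , _)) w = Within-prev {i = i} w

    -- Each link goes back to the start of an arc and forward again, and either move changes the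
    -- copy by at most one; hence the factor two.
    Chain-within-≤ : ∀ k {s} (p q : Position N) → Chain circle k p q → Within s (proj₁ p) →
                   Within (double k + s) (proj₁ q)
    Chain-within-≤ zero    (i , _) (j , _) (refl , _) w = w
    Chain-within-≤ (suc k) {s} p q (o , p′ , x , y , h) w =
      ≡-subst (λ t → Within t (proj₁ q)) (trans (+-suc (double k) (suc s)) (cong suc (+-suc (double k) s)))
        (Chain-within-≤ k p′ q h (Near-forward o p′ y (Near-backward o p x w)))

    -- As long as `j ≤ n` the circle has not been completed, so the cyclic successor is the ordinary
    -- one.
    state-double : ∀ j → j ≤ n → Σ[ i ∈ Fin (suc n) ] (state (double j) ≡ (i , false) × toℕ i ≡ j)
    state-double zero    _   = zero , refl , refl
    state-double (suc j) j<n with state {n} (double j) | state-double j (<⇒≤ j<n)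
    ... | _ | i , refl , e = next i , refl , result (next-cases i)
      where
      result : toℕ (next i) ≡ suc (toℕ i) ⊎ (toℕ (next i) ≡ 0 × toℕ i ≡ n) → toℕ (next i) ≡ suc j
      result (inj₁ f)       = trans f (cong suc e)
      result (inj₂ (_ , f)) = ⊥-elim (<-irrefl (trans (sym e) f) j<n)

    module _ {ℭ : Structure signature (lsuc ℓ)} (monster : IsMonster (Th circle) ℭ)
             (e : Tuple ℭ (Elements circle)) (e-elementary : circle ⟪ elements circle ⟫≼ ℭ ⟪ e ⟫) where
      private
        module S′ {n} = Setoid (Structure.Dom ℭ n)

      -- A model contains marks cutting the circle into arcs that are
      -- definable over it.
      linked : ∀ (V : SmallElementarySubmodel ℭ) {a b : Tuple ℭ Γ} →
               SameType ℭ {Γ = Γ} (SmallElementarySubmodel.points V) a b →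
               ∃[ o ] NearIn ℭ o (a N) × NearIn ℭ o (b N)
      linked V {a} {b} same = embed (v (proj₁ arcs)) , NearIn-resp ℭ S′.refl S′.refl (proj₂ arcs) ,
          to (near-⊨ ℭ (append ℭ b points) t u) (to (same (near t u))
            (from (near-⊨ ℭ (append ℭ a points) t u) (proj₂ arcs)))
        where
        open SmallElementarySubmodel V
        -- The marks of `circle` need not lie in `V`; but the existence of such marks is a sentence,
        -- and so passes to `V`.
        sentences : circle ⟪ none circle ⟫≼ M ⟪ none M ⟫
        sentences φ p = from (elementary-∞ V φ (none M))
          (to (⊨-resp ℭ {a = none ℭ} {λ x → embed (none M x)} (λ ()) φ) (sentences≼ monster φ p))
        covering′ : Formula signature (Marks ⊕ ∅ℓ {L = signature})
        covering′ = rename covering λ i → var (inj₁ i)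
        realized : Σ[ v ∈ Tuple M Marks ] M ⊨ covering′ [ append M v (none M) ]
        realized = realize {A = circle} {M} {a = none circle} {none M} sentences covering′ marks
          (from (⊨-rename circle {b = append circle marks (none circle)} covering
            λ _ → Setoid.refl (Structure.Dom circle N)) covered)
        v = proj₁ realized
        coveringℭ : ℭ ⊨ covering [ (λ i → embed (v i)) ]
        coveringℭ = to (elementary-∞ V covering v) (to (⊨-rename M {b = append M v (none M)} covering
            λ _ → Setoid.refl (Structure.Dom M N)) (proj₂ realized))
        w : Tuple ℭ (Marks ▹ N)
        w = extend ℭ (λ i → embed (v i)) (a N)
        arcs : ∃[ i ] NearIn ℭ (embed (v i)) (a N)
        arcs = let (i , h) = to (⋁-⊨ ℭ w (suc n) arcFrom) (coveringℭ (a N))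
               in i , to (near-⊨ ℭ w (var (just i)) (var nothing)) h
        t u : Term signature (Γ ⊕ Elements M) N
        t = var (inj₂ (N , v (proj₁ arcs)))
        u = var (inj₁ N)

      chained : ∀ {k a b} → LascarDist≤ ℭ {Γ} k a b → Chain ℭ k (a N) (b N)
      chained (done h) = h N
      chained (step {a = a} {a′} V same d) =
        let (o , x , y) = linked V {a} {a′} same in o , _ , x , y , chained d

      within-≤ : ∀ {k j} → LascarDist≤ ℭ {Γ} k (Ŝ monster e e-elementary 0) (Ŝ monster e e-elementary j) →
               Within (double k + 0) (proj₁ (S j N))
      within-≤ {k} {j} d = Chain-within-≤ k (S 0 N) (S j N) chain-circle (inj₁ z≤n)
        where
        ends : Tuple circle (ctx (Fin 2) λ _ → N)
        ends = two (S 0 N) (S j N)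
        φ : Formula signature (ctx (Fin 2) λ _ → N)
        φ = chain k (var zero) (var (suc zero))
        chain-circle : Chain circle k (S 0 N) (S j N)
        chain-circle = to (chain-⊨ circle ends k (var zero) (var (suc zero)))
          (from (embedding-⊨ {ℭ = ℭ} {e} e-elementary φ ends)
            (from (chain-⊨ ℭ (λ i → e (N , ends i)) k (var zero) (var (suc zero)))
              (chained d)))


  module _ {ℓ} (I : SelfSimilar ℓ) where
    open Circle I
    open LascarDistance I

    module _ {ℭ : Structure signature (lsuc ℓ)} (monster : IsMonster (Th circle) ℭ)
             (e : Tuple ℭ (Elements circle)) (e-elementary : circle ⟪ elements circle ⟫≼ ℭ ⟪ e ⟫) where

      unbounded : ∀ b → ¬ LascarDist≤ ℭ {Γ} b (Ŝ monster e e-elementary 0)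
                                            (Ŝ monster e e-elementary (double (suc (double b))))
      unbounded b d = not-within-≤ i≡K (≡-subst (Within (double b + 0)) (cong (proj₁ ∘ mark) i-state)
                                        (within-≤ monster e e-elementary {b} {double K} d))
        where
        -- The sort used below has `double b + K + 1`, that is 2K, copies. Copy `K` is opposite to
        -- copy zero, `K` steps away both ways, one more than the 2b steps that `b` links allow.
        K = suc (double b)
        open LowerBound I (double b + K) using (Within; within-≤; state-double)
        reached = state-double K (m≤n+m K (double b))
        i-state = proj₁ (proj₂ reached)
        i≡K = proj₂ (proj₂ reached)
        not-within-≤ : ∀ {i} → toℕ i ≡ K → ¬ Within (double b + 0) i
        not-within-≤ e (inj₁ h) rewrite +-identityʳ (double b) | e = <-irrefl refl h
        not-within-≤ e (inj₂ h) rewrite +-identityʳ (double b) | e =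
          <-irrefl refl (+-cancelˡ-≤ K _ _ (≤-trans (≤-reflexive (+-comm K K)) h))

    -- Half turns act on all sorts together, so `k` steps join the two tuples in every sort at once;
    -- the sort that contradicts the bound is chosen only after `b` is known.
    circle-not-GCompact : ¬ GCompact (Th circle)
    circle-not-GCompact (ℭ , monster , bounds) = unbounded monster e e-elementary b
        (proj₂ (bounds Γ (S′ 0)) (S′ k) (k ,
          ≡-subst (λ j → LascarDist≤ ℭ {Γ} k (S′ 0) (S′ j)) (+-identityʳ k)
            (connected monster e e-elementary k 0)))
      where
      e = proj₁ (embedding monster)
      e-elementary = proj₂ (embedding monster)
      S′ : ℕ → Tuple ℭ Γ
      S′ = Ŝ monster e e-elementary
      b k : ℕ
      b = proj₁ (bounds Γ (S′ 0))
      k = double (suc (double b))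

  -- Small models

  -- The hull lives in Set ℓ although ℭ does not: excluded middle resizes the
  -- equality and the relations of ℭ.
  module SkolemHull {ℓ} {L : Signature ℓ} (ℭ : Structure L (lsuc ℓ)) (Γ₀ G : Context (Sort L) ℓ)
                    (g : Tuple ℭ G) {J : Set} (maps : J → ∀ {t} → ∣ ℭ ∣ t → ∣ ℭ ∣ t) where
    private
      module ℭ = Structure ℭ
      module S {t} = Setoid (ℭ.Dom t)

    -- Codes for the contexts reached by passing under quantifiers. `Hull` ranges over these codes,
    -- since the type of all contexts lies one universe too high for `Hull` to be small.
    data Extension : Set ℓ where
      base : Extension
      _,,_ : Extension → Sort L → Extension

    extended : Extension → Context (Sort L) ℓ
    extended base     = Γ₀
    extended (Γ ,, t) = extended Γ ▹ t

    data Hull : Sort L → Set ℓ where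
      generator : ∀ x → Hull (sort G x)
      image     : ∀ {t} → J → Hull t → Hull t
      apply     : ∀ {ss t} → Fun L ss t → (∀ k → Hull (lookup ss k)) → Hull t
      -- The test that the sort is inhabited gives `choose` a default when no witness exists; as a
      -- `True` of excluded middle it stays small although the sort does not.
      witness   : ∀ Γ t → True (em {P = ∣ ℭ ∣ t}) → Formula L (extended Γ ▹ t) →
                  (∀ x → Hull (sort (extended Γ) x)) → Hull t

    choose : ∀ {t} → True (em {P = ∣ ℭ ∣ t}) → (P : ∣ ℭ ∣ t → Set (lsuc ℓ)) → Dec (∃ P) → ∣ ℭ ∣ t
    choose inh P (yes (c , _)) = c
    choose inh P (no _)        = toWitness inh

    choose-correct : ∀ {t} inh (P : ∣ ℭ ∣ t → Set (lsuc ℓ)) d → ∃ P → P (choose inh P d)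
    choose-correct inh P (yes (_ , p)) _ = p
    choose-correct inh P (no ¬p)       p = ⊥-elim (¬p p)

    value : ∀ {t} → Hull t → ∣ ℭ ∣ t
    value (generator x)         = g x
    value (image j h)           = maps j (value h)
    value (apply f hs)          = ℭ.fun f λ k → value (hs k)
    value (witness Γ t inh φ a) = choose inh (λ c → ℭ ⊨ φ [ (λ x → value (a x)) ▸ c ]) em

    Small : Set (lsuc ℓ) → Set ℓ
    Small P = Lift ℓ (True (em {P = P}))

    small : ∀ {P} → P → Small P
    small p = lift (fromWitness p)

    large : ∀ {P} → Small P → P
    large (lift p) = toWitness p

    hull : Structure L ℓ
    hull = record
      { Dom      = λ t → record
          { Carrier = Hull t
          ; _≈_     = λ h k → Small (value h ℭ.≈ value k)
          ; isEquivalence = record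
              { refl  = small S.refl
              ; sym   = λ p → small (S.sym (large p))
              ; trans = λ p q → small (S.trans (large p) (large q)) } }
      ; fun      = apply
      ; fun-cong = λ f p → small (ℭ.fun-cong f λ k → large (p k))
      ; rel      = λ R hs → Small (ℭ.rel R λ k → value (hs k))
      ; rel-resp = λ R p r → small (ℭ.rel-resp R (λ k → large (p k)) (large r))
      }

    value-eval : ∀ {i} {Γ : Context (Sort L) i} {t} (a : Tuple hull Γ) (u : Term L Γ t) →
                 value (eval hull a u) ℭ.≈ eval ℭ (λ x → value (a x)) u
    value-eval a (var x)    = S.refl
    value-eval a (app f ts) = ℭ.fun-cong f λ k → value-eval a (ts k)

    -- The Tarski-Vaught test: if a universal statement failed in `ℭ`, the Skolem witness for `∼ φ`
    -- would be a counterexample in the hull.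
    hull-⊨ : ∀ Γ (φ : Formula L (extended Γ)) (a : Tuple hull (extended Γ)) →
             hull ⊨ φ [ a ] ⇔ ℭ ⊨ φ [ (λ x → value (a x)) ]
    hull-⊨ Γ (t ≐ u) a = mk⇔
      (λ p → S.trans (S.sym (value-eval a t)) (S.trans (large p) (value-eval a u)))
      (λ p → small (S.trans (value-eval a t) (S.trans p (S.sym (value-eval a u)))))
    hull-⊨ Γ (atom R ts) a = mk⇔
      (λ p → ℭ.rel-resp R (λ k → value-eval a (ts k)) (large p))
      (λ p → small (ℭ.rel-resp R (λ k → S.sym (value-eval a (ts k))) p))
    hull-⊨ Γ ⊥̇       a = mk⇔ (λ ()) (λ ())
    hull-⊨ Γ (φ ⇒ ψ) a = mk⇔ (λ f p → to (hull-⊨ Γ ψ a) (f (from (hull-⊨ Γ φ a) p)))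
                             (λ f p → from (hull-⊨ Γ ψ a) (f (to (hull-⊨ Γ φ a) p)))
    hull-⊨ Γ (∀̇ t φ) a = mk⇔ forth (λ f h → from (inner h) (f (value h)))
      where
      b : Tuple ℭ (extended Γ)
      b x = value (a x)
      inner : ∀ h → hull ⊨ φ [ extend hull a h ] ⇔ ℭ ⊨ φ [ extend ℭ b (value h) ]
      inner h = mk⇔ (λ p → to same (to (hull-⊨ (Γ ,, t) φ (extend hull a h)) p))
                    (λ p → from (hull-⊨ (Γ ,, t) φ (extend hull a h)) (from same p))
        where
        same : ℭ ⊨ φ [ (λ x → value (extend hull a h x)) ] ⇔ ℭ ⊨ φ [ extend ℭ b (value h) ]
        same = ⊨-resp ℭ (λ { (just x) → S.refl ; nothing → S.refl }) φ
      forth : (∀ h → hull ⊨ φ [ extend hull a h ]) → ∀ c → ℭ ⊨ φ [ extend ℭ b c ]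
      forth f c = dne λ ¬p → drop
        (choose-correct inh (λ d → ℭ ⊨ ∼ φ [ extend ℭ b d ]) em (c , ¬p) (to (inner h) (f h)))
        where
        inh : True (em {P = ∣ ℭ ∣ t})
        inh = fromWitness c
        h : Hull t
        h = witness Γ t inh (∼ φ) a

  module _ {ℓ} {L : Signature ℓ} (M : Structure L ℓ) where
    private
      module S {t} = Setoid (Structure.Dom M t)
      open Structure M

    -- Through it hereditary G-compactness applies to a model itself and provides a monster model of
    -- its theory.
    self-interpretation : Interpretation M M
    self-interpretation = record
      { dim           = λ s → s ∷ []
      ; U             = λ _ _ → ⊤
      ; coord         = λ s (x , _) → x zero
      ; coord-cong    = λ s e → e zero
      ; coord-surj    = λ s y → ((λ { zero → y }) , tt) , S.refl
      ; U-definable   = λ s → ⊤̇ , λ a → mk⇔ (λ _ ()) (λ _ → tt)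
      ; ≈-definable   = λ s → (var (inj₁ (inj₁ zero)) ≐ var (inj₁ (inj₂ zero))) ,
                        λ a → mk⇔ (λ (_ , _ , e) → e) (λ e → tt , tt , e)
      ; rel-definable = λ R → atom R (λ k → var (inj₁ (k , zero))) ,
                        λ a → mk⇔ proj₂ (λ r → (λ _ → tt) , r)
      ; fun-definable = λ f → (app f (λ k → var (inj₁ (inj₁ (k , zero)))) ≐ var (inj₁ (inj₂ zero))) ,
                        λ a → mk⇔ (λ (_ , _ , e) → e) (λ e → (λ _ → tt) , tt , e)
      }

  -- Interpreting the circles

  module _ {ℓ} {L : Signature ℓ} (M : Structure L ℓ) where

    module _ {i} {Γ : Context (Sort L) i} where
      private
        full : Tuple M Γ → Tuple M (Γ ⊕ Elements M)
        full a = append M a (elements M)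

      definable-× : ∀ {p q} {P : Pred (Tuple M Γ) p} {Q : Pred (Tuple M Γ) q} →
                    Definable M Γ P → Definable M Γ Q → Definable M Γ (λ a → P a × Q a)
      definable-× (φ , f) (ψ , g) = φ ∧̇ ψ , λ a → mk⇔
        (λ (p , q) → from (∧̇-⊨ M (full a) φ ψ) (to (f a) p , to (g a) q))
        (λ h → let (p , q) = to (∧̇-⊨ M (full a) φ ψ) h in from (f a) p , from (g a) q)

      definable-⊎ : ∀ {p q} {P : Pred (Tuple M Γ) p} {Q : Pred (Tuple M Γ) q} →
                    Definable M Γ P → Definable M Γ Q → Definable M Γ (λ a → P a ⊎ Q a)
      definable-⊎ (φ , f) (ψ , g) = φ ∨̇ ψ , λ a → mk⇔
        ([ (λ p → from (∨̇-⊨ M (full a) φ ψ) (inj₁ (to (f a) p)))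
         , (λ q → from (∨̇-⊨ M (full a) φ ψ) (inj₂ (to (g a) q))) ]′)
        (λ h → [ inj₁ ∘ from (f a) , inj₂ ∘ from (g a) ]′ (to (∨̇-⊨ M (full a) φ ψ) h))

      definable-¬ : ∀ {p} {P : Pred (Tuple M Γ) p} →
                    Definable M Γ P → Definable M Γ (λ a → ¬ P a)
      definable-¬ (φ , f) = ∼ φ , λ a → mk⇔
        (λ k → from (∼-⊨ M (full a) φ) (k ∘ from (f a)))
        (λ h → to (∼-⊨ M (full a) φ) h ∘ to (f a))

      definable-Fin : ∀ {p} n {P : Fin n → Pred (Tuple M Γ) p} →
                      (∀ k → Definable M Γ (P k)) → Definable M Γ (λ a → ∃[ k ] P k a)
      definable-Fin n d = ⋁ n (proj₁ ∘ d) , λ a → mk⇔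
        (λ (k , p) → from (⋁-⊨ M (full a) n (proj₁ ∘ d)) (k , to (proj₂ (d k) a) p))
        (λ h → let (k , p) = to (⋁-⊨ M (full a) n (proj₁ ∘ d)) h in k , from (proj₂ (d k) a) p)

      definable-const : ∀ {p} (P : Set p) → Definable M Γ (λ _ → P)
      definable-const P with em {P = P}
      ... | yes p = ⊤̇ , λ a → mk⇔ (λ _ ()) (λ _ → p)
      ... | no ¬p = ⊥̇ , λ a → mk⇔ (λ p → ⊥-elim (¬p p)) (λ ())

      definable-resp : ∀ {p q} {P : Pred (Tuple M Γ) p} {Q : Pred (Tuple M Γ) q} →
                       (∀ a → P a ⇔ Q a) → Definable M Γ P → Definable M Γ Q
      definable-resp h (φ , f) = φ , λ a → mk⇔ (to (f a) ∘ from (h a)) (to (h a) ∘ from (f a))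

      definable-term : ∀ {j} (D : Context (Sort L) j) → (Tuple M Γ → Tuple M D) → Set (ℓ ⊔ i ⊔ j)
      definable-term D f = Σ[ s ∈ (∀ x → Term L (Γ ⊕ Elements M) (sort D x)) ]
        (∀ a x → Structure._≈_ M (eval M (full a) (s x)) (f a x))

      definable-subst : ∀ {j} {D : Context (Sort L) j} (φ : Formula L D) {f} → definable-term D f →
                        Definable M Γ (λ a → M ⊨ φ [ f a ])
      definable-subst φ (s , h) = rename φ s , λ a → mk⇔ (from (r a)) (to (r a))
        where r = λ a → ⊨-rename M {b = full a} φ (h a)

    first : ∀ xs ys (k : Fin (length xs)) → Term L ⟦ xs ++ ys ⟧ (lookup xs k)
    first (x ∷ xs) ys zero    = var zero
    first (x ∷ xs) ys (suc k) = renameᵗ (first xs ys k) λ j → var (suc j)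

    second : ∀ xs ys (k : Fin (length ys)) → Term L ⟦ xs ++ ys ⟧ (lookup ys k)
    second []       ys k = var k
    second (x ∷ xs) ys k = renameᵗ (second xs ys k) λ j → var (suc j)

    join : ∀ xs ys → Tuple M ⟦ xs ⟧ → Tuple M ⟦ ys ⟧ → Tuple M ⟦ xs ++ ys ⟧
    join []       ys a b k       = b k
    join (x ∷ xs) ys a b zero    = a zero
    join (x ∷ xs) ys a b (suc k) = join xs ys (a ∘ suc) b k

    first-join : ∀ xs ys a b k → Structure._≈_ M (eval M (join xs ys a b) (first xs ys k)) (a k)
    first-join (x ∷ xs) ys a b zero    = Setoid.refl (Structure.Dom M _)
    first-join (x ∷ xs) ys a b (suc k) = Setoid.trans (Structure.Dom M _)
      (eval-subst M (first xs ys k) λ _ _ → Setoid.refl (Structure.Dom M _))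
      (first-join xs ys (a ∘ suc) b k)

    second-join : ∀ xs ys a b k → Structure._≈_ M (eval M (join xs ys a b) (second xs ys k)) (b k)
    second-join []       ys a b k = Setoid.refl (Structure.Dom M _)
    second-join (x ∷ xs) ys a b k = Setoid.trans (Structure.Dom M _)
      (eval-subst M (second xs ys k) λ _ _ → Setoid.refl (Structure.Dom M _))
      (second-join xs ys (a ∘ suc) b k)

  -- A finite context raised to level ℓ, where saturation and homogeneity of the monster model need
  -- it.
  block : ∀ {ℓ} (L : Signature ℓ) → List (Sort L) → Context (Sort L) ℓ
  block {ℓ} L ds = ctx (Lift ℓ (Fin (length ds))) (lookup ds ∘ lower)

  module _ {ℓ} {L : Signature ℓ} where

    module _ {m} (A : Structure L m) {D Δ : Context (Sort L) ℓ} (θ : Formula L (D ⊕ D ⊕ Δ))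
             (e : Tuple A Δ) where

      Below : Tuple A D → Tuple A D → Set m
      Below u v = A ⊨ θ [ append A u v ⊞ e ]

      Below-resp : ∀ {u u′ v v′} → (∀ x → Structure._≈_ A (u x) (u′ x)) →
                   (∀ x → Structure._≈_ A (v x) (v′ x)) → Below u v → Below u′ v′
      Below-resp {u} {u′} {v} {v′} p q = to (⊨-resp A {a = append A (append A u v) e} {append A (append A u′ v′) e}
        (λ { (inj₁ (inj₁ x)) → p x ; (inj₁ (inj₂ x)) → q x ; (inj₂ y) → Setoid.refl (Structure.Dom A _) }) θ)

  module CircleInterpretation
    {ℓ} {L : Signature ℓ} (M : Structure L ℓ) (ds : List (Sort L)) {Δ : Context (Sort L) ℓ}
    (θ : Formula L (block L ds ⊕ block L ds ⊕ Δ)) (e : Tuple M Δ)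
    (below-trans : ∀ {u v w} → Below M θ e u v → Below M θ e v w → Below M θ e u w)
    (code : ℕ → Tuple M (block L ds)) (code-refl : ∀ k → Below M θ e (code k) (code k))
    (code-injective : ∀ {j k} → Below M θ e (code j) (code k) → Below M θ e (code k) (code j) → j ≡ k)
    (x z : Tuple M (block L ds)) (I : SelfSimilar ℓ)
    (point : ∀ u → Below M θ e x u × ¬ Below M θ e z u → SelfSimilar.Point I)
    (point-≲ : ∀ {u v} p q → SelfSimilar._≲_ I (point u p) (point v q) ⇔ Below M θ e u v)
    (point-onto : ∀ w → ∃[ u ] ∃[ p ] SelfSimilar._~_ I (point u p) w)
    where

    open SelfSimilar I
    open Circle I
    private
      module S {t} = Setoid (Structure.Dom M t)

    D : Context (Sort L) ℓ
    D = block L ds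

    infix 4 _⊴_
    _⊴_ : Tuple M D → Tuple M D → Set ℓ
    _⊴_ = Below M θ e

    Interval : Tuple M D → Set ℓ
    Interval u = x ⊴ u × ¬ z ⊴ u

    Coded : Set ℓ
    Coded = Tuple M ⟦ ds ++ ds ⟧

    index value : Coded → Tuple M D
    index b j = eval M b (first M ds ds (lower j))
    value b j = eval M b (second M ds ds (lower j))

    At : ℕ → Coded → Set ℓ
    At k b = (index b ⊴ code k × code k ⊴ index b) × Interval (value b)

    module _ {i} {Γ : Context (Sort L) i} where

      Source : (Tuple M Γ → Coded) → Set (ℓ ⊔ i)
      Source = definable-term M {Γ = Γ} ⟦ ds ++ ds ⟧

      definable-parameter : ∀ {j} {E : Context (Sort L) j} (c : Tuple M E) → definable-term M {Γ = Γ} E (λ _ → c)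
      definable-parameter c = (λ x → var (inj₂ (_ , c x))) , λ _ _ → S.refl

      definable-index : ∀ {f} → Source f → definable-term M {Γ = Γ} D (index ∘ f)
      definable-index (s , h) = (λ j → renameᵗ (first M ds ds (lower j)) s) ,
        λ a j → eval-subst M (first M ds ds (lower j)) λ k _ → h a k

      definable-value : ∀ {f} → Source f → definable-term M {Γ = Γ} D (value ∘ f)
      definable-value (s , h) = (λ j → renameᵗ (second M ds ds (lower j)) s) ,
        λ a j → eval-subst M (second M ds ds (lower j)) λ k _ → h a k

      definable-⊴ : ∀ {f g} → definable-term M {Γ = Γ} D f → definable-term M {Γ = Γ} D g →
                    Definable M Γ (λ a → f a ⊴ g a)
      definable-⊴ (s , h) (t , k) = definable-subst M θ
        ( (λ { (inj₁ (inj₁ j)) → s j ; (inj₁ (inj₂ j)) → t j ; (inj₂ y) → var (inj₂ (_ , e y)) })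
        , λ { a (inj₁ (inj₁ j)) → h a j ; a (inj₁ (inj₂ j)) → k a j ; a (inj₂ y) → S.refl } )

      definable-At : ∀ k {f} → Source f → Definable M Γ (At k ∘ f)
      definable-At k s = definable-× M
        (definable-× M (definable-⊴ (definable-index s) (definable-parameter (code k)))
                       (definable-⊴ (definable-parameter (code k)) (definable-index s)))
        (definable-× M (definable-⊴ (definable-parameter x) (definable-value s))
                       (definable-¬ M (definable-⊴ (definable-parameter z) (definable-value s))))

    value-⊴ : ∀ {k b} → At k b → value b ⊴ value b
    value-⊴ (_ , p) = to (point-≲ p p) ≲-refl

    interpretation : Interpretation M circle
    interpretation = record
      { dim           = λ _ → ds ++ ds
      ; U             = U
      ; coord         = coord
      ; coord-cong    = λ n {a} {b} → coord-cong n a b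
      ; coord-surj    = coord-surj
      ; U-definable   = λ n → definable-Fin M (suc (lower n)) λ i → definable-At (toℕ i) (var ∘ inj₁ , λ _ _ → S.refl)
      ; ≈-definable   = ≈-definable
      ; rel-definable = λ { (arc n) → arc-definable n }
      ; fun-definable = λ ()
      }
      where
      U : ∀ n → Pred Coded ℓ
      U n b = ∃[ i ] At (toℕ {suc (lower n)} i) b
      coord : ∀ n → ∃ (U n) → Position n
      coord n (b , i , _ , p) = i , point (value b) p
      coord-cong : ∀ n (a b : ∃ (U n)) → (∀ j → Structure._≈_ M (proj₁ a j) (proj₁ b j)) →
                   coord n a ≋ coord n b
      coord-cong n (a , i , (p , p′) , q) (b , j , (r , r′) , s) h =
          toℕ-injective (code-injective
            (below-trans p′ (below-trans (Below-resp M θ e (λ _ → S.refl) index≈ (below-trans p p′)) r))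
            (below-trans r′ (below-trans (Below-resp M θ e index≈ (λ _ → S.refl) (below-trans p p′)) p)))
        , from (point-≲ q s) (Below-resp M θ e (λ _ → S.refl) value≈ (value-⊴ {toℕ i} ((p , p′) , q)))
        , from (point-≲ s q) (Below-resp M θ e value≈ (λ _ → S.refl) (value-⊴ {toℕ i} ((p , p′) , q)))
        where
        index≈ : ∀ x → Structure._≈_ M (index a x) (index b x)
        index≈ x = eval-cong M h (first M ds ds (lower x))
        value≈ : ∀ x → Structure._≈_ M (value a x) (value b x)
        value≈ x = eval-cong M h (second M ds ds (lower x))
      coord-surj : ∀ n (y : Position n) → ∃[ a ] coord n a ≋ y
      coord-surj n (i , w) = let
          (u , p , u~w) = point-onto w
          b : Coded
          b = join M ds ds (code (toℕ i) ∘ lift) (u ∘ lift)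
          index≈ : ∀ j → Structure._≈_ M (index b j) (code (toℕ i) j)
          index≈ j = first-join M ds ds (code (toℕ i) ∘ lift) (u ∘ lift) (lower j)
          value≈ : ∀ j → Structure._≈_ M (value b j) (u j)
          value≈ j = second-join M ds ds (code (toℕ i) ∘ lift) (u ∘ lift) (lower j)
          q : Interval (value b)
          q = Below-resp M θ e (λ _ → S.refl) (λ j → S.sym (value≈ j)) (proj₁ p) ,
              proj₂ p ∘ Below-resp M θ e (λ _ → S.refl) value≈
          u⊴u : u ⊴ u
          u⊴u = to (point-≲ p p) ≲-refl
        in (b , i , ( Below-resp M θ e (λ j → S.sym (index≈ j)) (λ _ → S.refl) (code-refl (toℕ i))
                    , Below-resp M θ e (λ _ → S.refl) (λ j → S.sym (index≈ j)) (code-refl (toℕ i))) , q)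
         , refl
         , ~-trans ( from (point-≲ q p) (Below-resp M θ e (λ j → S.sym (value≈ j)) (λ _ → S.refl) u⊴u)
                   , from (point-≲ p q) (Below-resp M θ e (λ _ → S.refl) (λ j → S.sym (value≈ j)) u⊴u)) u~w
      ≈-definable : ∀ n → Definable M (⟦ ds ++ ds ⟧ ⊕ ⟦ ds ++ ds ⟧) λ a →
                    Σ[ u ∈ U n (a ∘ inj₁) ] Σ[ v ∈ U n (a ∘ inj₂) ]
                      coord n (a ∘ inj₁ , u) ≋ coord n (a ∘ inj₂ , v)
      ≈-definable n = definable-resp M
        (λ a → mk⇔
          (λ (i , p , q , r , s) → (i , p) , (i , q) , refl ,
            from (point-≲ (proj₂ p) (proj₂ q)) r , from (point-≲ (proj₂ q) (proj₂ p)) s)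
          (λ { ((i , p) , (_ , q) , refl , r , s) → i , p , q ,
            to (point-≲ (proj₂ p) (proj₂ q)) r , to (point-≲ (proj₂ q) (proj₂ p)) s }))
        (definable-Fin M (suc (lower n)) λ i →
          definable-× M (definable-At (toℕ i) one) (definable-× M (definable-At (toℕ i) two)
            (definable-× M (definable-⊴ (definable-value one) (definable-value two))
                           (definable-⊴ (definable-value two) (definable-value one)))))
        where
        one : Source λ a → a ∘ inj₁
        one = (λ k → var (inj₁ (inj₁ k))) , λ _ _ → S.refl
        two : Source λ a → a ∘ inj₂
        two = (λ k → var (inj₁ (inj₂ k))) , λ _ _ → S.refl
      Reps₂ : Context (Sort L) 0ℓ
      Reps₂ = ctx (Fin 2 × Fin (length (ds ++ ds))) λ (_ , j) → lookup (ds ++ ds) j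
      module _ (n : Lift ℓ ℕ) where

        -- `Split` unfolds `Near` into a finite disjunction over the copies, free of `coord`, from
        -- which definability can be read off.
        Ends Split : Tuple M Reps₂ → Set ℓ
        Ends a = Σ[ u ∈ (∀ k → U (lookup (n ∷ n ∷ []) k) (curry a k)) ]
          Near {n} (coord n (curry a zero , u zero)) (coord n (curry a (suc zero) , u (suc zero)))
        Split a = ∃[ i ] ∃[ j ] At (toℕ {suc (lower n)} i) (curry a zero) ×
          At (toℕ {suc (lower n)} j) (curry a (suc zero)) ×
          ((i ≡ j × value (curry a zero) ⊴ value (curry a (suc zero))) ⊎
           (j ≡ next i × ¬ value (curry a zero) ⊴ value (curry a (suc zero))))

        split⇔ends : ∀ a → Split a ⇔ Ends a
        split⇔ends a = mk⇔ forth back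
          where
          forth : Split a → Ends a
          forth (i , j , p , q , h) = (λ { zero → i , p ; (suc zero) → j , q }) ,
            [ (λ (e , r) → inj₁ (e , from (point-≲ (proj₂ p) (proj₂ q)) r))
            , (λ (e , r) → inj₂ (e , r ∘ to (point-≲ (proj₂ p) (proj₂ q)))) ]′ h
          back : Ends a → Split a
          back (u , h) = proj₁ (u zero) , proj₁ (u (suc zero)) , p , q ,
            [ (λ (e , r) → inj₁ (e , to (point-≲ (proj₂ p) (proj₂ q)) r))
            , (λ (e , r) → inj₂ (e , r ∘ from (point-≲ (proj₂ p) (proj₂ q)))) ]′ h
            where
            p = proj₂ (u zero)
            q = proj₂ (u (suc zero))

        arc-definable : Definable M Reps₂ Ends
        arc-definable = definable-resp M split⇔ends
          (definable-Fin M (suc (lower n)) λ i → definable-Fin M (suc (lower n)) λ j →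
            definable-× M (definable-At (toℕ i) one) (definable-× M (definable-At (toℕ j) two)
              (definable-⊎ M
                (definable-× M (definable-const M (i ≡ j)) (definable-⊴ (definable-value one) (definable-value two)))
                (definable-× M (definable-const M (j ≡ next i))
                  (definable-¬ M (definable-⊴ (definable-value one) (definable-value two)))))))
          where
          one : Source λ a → curry a zero
          one = (λ k → var (inj₁ (zero , k))) , λ _ _ → S.refl
          two : Source λ a → curry a (suc zero)
          two = (λ k → var (inj₁ (suc zero , k))) , λ _ _ → S.refl

  -- Triples with equal types

  cube : ∀ {s ℓ} {S : Set s} → Context S ℓ → Context S ℓ
  cube D = ctx (Fin 3 × Index D) (sort D ∘ proj₂)

  module _ {ℓ} {L : Signature ℓ} {m} (A : Structure L m) {D : Context (Sort L) ℓ} where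

    triple : Tuple A D → Tuple A D → Tuple A D → Tuple A (cube D)
    triple u v w (zero , j)           = u j
    triple u v w (suc zero , j)       = v j
    triple u v w (suc (suc zero) , j) = w j

    entry : Tuple A (cube D) → Fin 3 → Tuple A D
    entry t i j = t (i , j)

  module _ {ℓ} {L : Signature ℓ} {D Δ : Context (Sort L) ℓ} where

    -- A formula interpreting an order relates representatives only, so reflexivity and totality are
    -- restricted to the field, the tuples `u` with `u ⊴ u`. All clauses are universal statements
    -- about at most three tuples, hence transfer to the monster model.
    record IsTotalPreorderOnField {m} (A : Structure L m) (θ : Formula L (D ⊕ D ⊕ Δ)) (e : Tuple A Δ) :
                                  Set (ℓ ⊔ m) where
      private
        _⊴_ = Below A θ e
      field
        ⊴-trans : ∀ {u v w} → u ⊴ v → v ⊴ w → u ⊴ w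
        ⊴-reflˡ : ∀ {u v} → u ⊴ v → u ⊴ u
        ⊴-reflʳ : ∀ {u v} → u ⊴ v → v ⊴ v
        ⊴-total : ∀ {u v} → u ⊴ u → v ⊴ v → u ⊴ v ⊎ v ⊴ u

    Strict : ∀ {m} (A : Structure L m) (θ : Formula L (D ⊕ D ⊕ Δ)) (e : Tuple A Δ) →
             Tuple A D → Tuple A D → Set m
    Strict A θ e u v = Below A θ e u v × ¬ Below A θ e v u

    exchange : ∀ x → Term L (D ⊕ D ⊕ Δ) (sort (D ⊕ D ⊕ Δ) x)
    exchange (inj₁ (inj₁ j)) = var (inj₁ (inj₂ j))
    exchange (inj₁ (inj₂ j)) = var (inj₁ (inj₁ j))
    exchange (inj₂ y)        = var (inj₂ y)

    converse : Formula L (D ⊕ D ⊕ Δ) → Formula L (D ⊕ D ⊕ Δ)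
    converse θ = rename θ exchange

    module _ {m} (A : Structure L m) (θ : Formula L (D ⊕ D ⊕ Δ)) (e : Tuple A Δ) where

      converse-⊨ : ∀ u v → Below A (converse θ) e u v ⇔ Below A θ e v u
      converse-⊨ u v = ⊨-rename A {a = append A (append A v u) e} {append A (append A u v) e} θ λ
        { (inj₁ (inj₁ j)) → Setoid.refl (Structure.Dom A _)
        ; (inj₁ (inj₂ j)) → Setoid.refl (Structure.Dom A _)
        ; (inj₂ y)        → Setoid.refl (Structure.Dom A _) }

      converse-preorder : IsTotalPreorderOnField A θ e → IsTotalPreorderOnField A (converse θ) e
      converse-preorder pre = record
        { ⊴-trans = λ {u} {v} {w} p q → from (converse-⊨ u w) (⊴-trans (to (converse-⊨ v w) q) (to (converse-⊨ u v) p))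
        ; ⊴-reflˡ = λ {u} {v} p → from (converse-⊨ u u) (⊴-reflʳ (to (converse-⊨ u v) p))
        ; ⊴-reflʳ = λ {u} {v} p → from (converse-⊨ v v) (⊴-reflˡ (to (converse-⊨ u v) p))
        ; ⊴-total = λ {u} {v} p q → [ inj₁ ∘ from (converse-⊨ u v) , inj₂ ∘ from (converse-⊨ v u) ]′
                      (⊴-total (to (converse-⊨ v v) q) (to (converse-⊨ u u) p))
        }
        where open IsTotalPreorderOnField pre

    at : Fin 3 → Fin 3 → ∀ x → Term L (cube D ⊕ Δ) (sort (D ⊕ D ⊕ Δ) x)
    at i k (inj₁ (inj₁ j)) = var (inj₁ (i , j))
    at i k (inj₁ (inj₂ j)) = var (inj₁ (k , j))
    at i k (inj₂ y)        = var (inj₂ y)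

    module _ {m} (A : Structure L m) (t : Tuple A (cube D)) (e : Tuple A Δ) where

      at-⊨ : ∀ i k χ → A ⊨ rename χ (at i k) [ append A t e ] ⇔
                       A ⊨ χ [ append A (append A (entry A t i) (entry A t k)) e ]
      at-⊨ i k χ = ⊨-rename A {a = append A (append A (entry A t i) (entry A t k)) e} {append A t e} χ λ
        { (inj₁ (inj₁ j)) → Setoid.refl (Structure.Dom A _)
        ; (inj₁ (inj₂ j)) → Setoid.refl (Structure.Dom A _)
        ; (inj₂ y)        → Setoid.refl (Structure.Dom A _) }

    module _ {m n} {A : Structure L m} {B : Structure L n} {a : Tuple A Δ} {b : Tuple B Δ}
             (a≼b : A ⟪ a ⟫≼ B ⟪ b ⟫) (θ : Formula L (D ⊕ D ⊕ Δ)) where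

      private
        below : Fin 3 → Fin 3 → Formula L (cube D ⊕ Δ)
        below i k = rename θ (at i k)
        0′ 1′ 2′ : Fin 3
        0′ = zero
        1′ = suc zero
        2′ = suc (suc zero)
        tr : (φ : Formula L (cube D ⊕ Δ)) → (∀ t → A ⊨ φ [ t ⊞ a ]) → ∀ t → B ⊨ φ [ t ⊞ b ]
        tr = transfer {A = A} {B} {a = a} {b} a≼b

      transfer-preorder : IsTotalPreorderOnField A θ a → IsTotalPreorderOnField B θ b
      transfer-preorder pre = record
        { ⊴-trans = λ {u} {v} {w} p q → to (at-⊨ B (triple B u v w) b 0′ 2′ θ)
            (tr (below 0′ 1′ ⇒ below 1′ 2′ ⇒ below 0′ 2′)
              (λ t r s → from (at-⊨ A t a 0′ 2′ θ) (⊴-trans (to (at-⊨ A t a 0′ 1′ θ) r) (to (at-⊨ A t a 1′ 2′ θ) s)))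
              (triple B u v w) (from (at-⊨ B (triple B u v w) b 0′ 1′ θ) p)
              (from (at-⊨ B (triple B u v w) b 1′ 2′ θ) q))
        ; ⊴-reflˡ = λ {u} {v} p → to (at-⊨ B (triple B u v v) b 0′ 0′ θ)
            (tr (below 0′ 1′ ⇒ below 0′ 0′) (λ t r → from (at-⊨ A t a 0′ 0′ θ) (⊴-reflˡ (to (at-⊨ A t a 0′ 1′ θ) r)))
              (triple B u v v) (from (at-⊨ B (triple B u v v) b 0′ 1′ θ) p))
        ; ⊴-reflʳ = λ {u} {v} p → to (at-⊨ B (triple B u v v) b 1′ 1′ θ)
            (tr (below 0′ 1′ ⇒ below 1′ 1′) (λ t r → from (at-⊨ A t a 1′ 1′ θ) (⊴-reflʳ (to (at-⊨ A t a 0′ 1′ θ) r)))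
              (triple B u v v) (from (at-⊨ B (triple B u v v) b 0′ 1′ θ) p))
        ; ⊴-total = λ {u} {v} p q → Sum.map
            (to (at-⊨ B (triple B u v v) b 0′ 1′ θ)) (to (at-⊨ B (triple B u v v) b 1′ 0′ θ))
            (to (∨̇-⊨ B (append B (triple B u v v) b) (below 0′ 1′) (below 1′ 0′))
              (tr (below 0′ 0′ ⇒ below 1′ 1′ ⇒ below 0′ 1′ ∨̇ below 1′ 0′)
                (λ t r s → from (∨̇-⊨ A (append A t a) (below 0′ 1′) (below 1′ 0′)) (Sum.map
                  (from (at-⊨ A t a 0′ 1′ θ)) (from (at-⊨ A t a 1′ 0′ θ))
                  (⊴-total (to (at-⊨ A t a 0′ 0′ θ) r) (to (at-⊨ A t a 1′ 1′ θ) s))))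
                (triple B u v v) (from (at-⊨ B (triple B u v v) b 0′ 0′ θ) p)
                (from (at-⊨ B (triple B u v v) b 1′ 1′ θ) q)))
        }
        where open IsTotalPreorderOnField pre

  module IdempotentTriple
    {ℓ} {L : Signature ℓ} (M : Structure L ℓ) {D : Context (Sort L) ℓ}
    (θ : Formula L (D ⊕ D ⊕ Elements M)) (c : ℕ → Tuple M D)
    (c-strict : ∀ i j → i < j → Strict M θ (elements M) (c i) (c j))
    where

    private
      E : Context (Sort L) ℓ
      E = Elements M

      0′ 1′ 2′ : Fin 3
      0′ = zero
      1′ = suc zero
      2′ = suc (suc zero)

    strictly : Formula L (cube D ⊕ E)
    strictly = rename θ (at 0′ 1′) ∧̇ ∼ rename θ (at 1′ 0′)

    -- Implications from the pair (x, z) to the other two pairs suffice, since applied to negations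
    -- they become equivalences. Parameters from `M` are allowed in `χ`, so that the automorphisms
    -- obtained later fix the embedded copy of `M`.
    data Wanted : Formula L (cube D ⊕ E) → Set ℓ where
      diagram : ∀ χ → M ⊨ χ [ elements M ] → Wanted (rename χ λ y → var (inj₂ y))
      initial : ∀ χ → Wanted (rename χ (at 0′ 2′) ⇒ rename χ (at 0′ 1′))
      final   : ∀ χ → Wanted (rename χ (at 0′ 2′) ⇒ rename χ (at 1′ 2′))
      strict  : Wanted strictly

    open Ramsey

    points : ℕ → ℕ → ℕ → Tuple M (cube D ⊕ E)
    points i j k = append M (triple M (c i) (c j) (c k)) (elements M)

    Holds : (ℕ → ℕ) → Formula L (cube D ⊕ E) → Set ℓ
    Holds h φ = ∀ i j k → i < j → j < k → M ⊨ φ [ points (h i) (h j) (h k) ]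

    -- Ramsey gives `χ` the same truth value at all increasing pairs of the subsequence, and then
    -- both implications are immediate.
    homogeneous-for : ∀ h (χ : Formula L (D ⊕ D ⊕ E)) → Increasing h → Σ[ g ∈ (ℕ → ℕ) ] Increasing g ×
      Holds (h ∘ g) (rename χ (at 0′ 2′) ⇒ rename χ (at 0′ 1′)) ×
      Holds (h ∘ g) (rename χ (at 0′ 2′) ⇒ rename χ (at 1′ 2′))
    homogeneous-for h χ h-inc = g , g-inc ,
        (λ i j k i<j j<k p → from (R i j k 0′ 1′) (close i k i j (<-trans i<j j<k) i<j (to (R i j k 0′ 2′) p))) ,
        (λ i j k i<j j<k p → from (R i j k 1′ 2′) (close i k j k (<-trans i<j j<k) j<k (to (R i j k 0′ 2′) p)))
      where
      P : ℕ → ℕ → Set ℓ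
      P i j = M ⊨ χ [ append M (append M (c (h i)) (c (h j))) (elements M) ]
      g = proj₁ (ramsey P)
      g-inc : Increasing g
      g-inc = proj₁ (proj₂ (ramsey P))
      close : ∀ i j i′ j′ → i < j → i′ < j′ → P (g i) (g j) → P (g i′) (g j′)
      close i j i′ j′ i<j i′<j′ p with proj₂ (proj₂ (ramsey P))
      ... | inj₁ red  = red i′ j′ i′<j′
      ... | inj₂ blue = ⊥-elim (blue i j i<j p)
      R : ∀ i j k m n → M ⊨ rename χ (at m n) [ points (h (g i)) (h (g j)) (h (g k)) ] ⇔
          M ⊨ χ [ append M (append M (entry M (triple M (c (h (g i))) (c (h (g j))) (c (h (g k)))) m)
                                     (entry M (triple M (c (h (g i))) (c (h (g j))) (c (h (g k)))) n))
                           (elements M) ]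
      R i j k m n = at-⊨ M (triple M (c (h (g i))) (c (h (g j))) (c (h (g k)))) (elements M) m n χ

    thin : ∀ {h g φs} → Increasing g → All (Holds h) φs → All (Holds (h ∘ g)) φs
    thin g-inc []       = []
    thin {h} {g} g-inc (p ∷ ps) = (λ i j k i<j j<k → p (g i) (g j) (g k) (g-inc i<j) (g-inc j<k)) ∷ thin g-inc ps

    -- Formulas are handled one at a time, and Ramsey may thin the sequence at each; what was
    -- achieved before survives, as `Holds` speaks of all increasing triples.
    finitely-satisfied : ∀ φs → All Wanted φs → Σ[ h ∈ (ℕ → ℕ) ] Increasing h × All (Holds h) φs
    finitely-satisfied [] [] = id , id , []
    finitely-satisfied (_ ∷ φs) (diagram χ p ∷ ws) = let (h , h-inc , ps) = finitely-satisfied φs ws in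
      h , h-inc , (λ i j k _ _ → from (⊨-rename M {b = points (h i) (h j) (h k)} χ
        λ y → Setoid.refl (Structure.Dom M _)) p) ∷ ps
    finitely-satisfied (_ ∷ φs) (strict ∷ ws) = let (h , h-inc , ps) = finitely-satisfied φs ws in
      h , h-inc , (λ i j k i<j j<k →
        let (p , q) = c-strict (h i) (h j) (h-inc i<j)
            t = triple M (c (h i)) (c (h j)) (c (h k))
        in from (∧̇-⊨ M (points (h i) (h j) (h k)) (rename θ (at 0′ 1′)) (∼ rename θ (at 1′ 0′)))
          (from (at-⊨ M t (elements M) 0′ 1′ θ) p , λ r → raise (q (to (at-⊨ M t (elements M) 1′ 0′ θ) r)))) ∷ ps
    finitely-satisfied (_ ∷ φs) (initial χ ∷ ws) = let
        (h , h-inc , ps) = finitely-satisfied φs ws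
        (g , g-inc , p , _) = homogeneous-for h χ h-inc
      in h ∘ g , h-inc ∘ g-inc , p ∷ thin g-inc ps
    finitely-satisfied (_ ∷ φs) (final χ ∷ ws) = let
        (h , h-inc , ps) = finitely-satisfied φs ws
        (g , g-inc , _ , p) = homogeneous-for h χ h-inc
      in h ∘ g , h-inc ∘ g-inc , p ∷ thin g-inc ps

    record Triple (ℭ : Structure L (lsuc ℓ)) : Set (lsuc ℓ) where
      field
        e       : Tuple ℭ E
        x y z   : Tuple ℭ D
        e-elementary : M ⟪ elements M ⟫≼ ℭ ⟪ e ⟫
        xz≼xy   : ℭ ⟪ append ℭ (append ℭ x z) e ⟫≼ ℭ ⟪ append ℭ (append ℭ x y) e ⟫
        xz≼yz   : ℭ ⟪ append ℭ (append ℭ x z) e ⟫≼ ℭ ⟪ append ℭ (append ℭ y z) e ⟫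
        x<y     : Strict ℭ θ e x y

    find : ∀ {ℭ} → IsMonster (Th M) ℭ → Triple ℭ
    find {ℭ} monster = record
      { e = e ; x = entry ℭ t 0′ ; y = entry ℭ t 1′ ; z = entry ℭ t 2′
      ; e-elementary = λ χ p → to (⊨-rename ℭ {b = a} χ λ y → Setoid.refl (Structure.Dom ℭ _))
          (proj₂ solution _ (diagram χ p))
      ; xz≼xy = λ χ p → to (A 0′ 1′ χ) (proj₂ solution _ (initial χ) (from (A 0′ 2′ χ) p))
      ; xz≼yz = λ χ p → to (A 1′ 2′ χ) (proj₂ solution _ (final χ) (from (A 0′ 2′ χ) p))
      ; x<y   = let (p , q) = to (∧̇-⊨ ℭ a (rename θ (at 0′ 1′)) (∼ rename θ (at 1′ 0′))) (proj₂ solution _ strict)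
                in to (A 0′ 1′ θ) p , λ r → drop (q (from (A 1′ 0′ θ) r))
      }
      where
      solution : Σ[ a ∈ Tuple ℭ (cube D ⊕ E) ] (∀ φ → Wanted φ → ℭ ⊨ φ [ a ])
      solution = realizeType monster Wanted λ φs ws → let (h , _ , ps) = finitely-satisfied φs ws in
        points (h 0) (h 1) (h 2) , All.map (λ p → p 0 1 2 (s≤s z≤n) (s≤s (s≤s z≤n))) ps
      a = proj₁ solution
      t : Tuple ℭ (cube D)
      t x = a (inj₁ x)
      e : Tuple ℭ E
      e y = a (inj₂ y)
      A : ∀ i k χ → ℭ ⊨ rename χ (at i k) [ a ] ⇔
                    ℭ ⊨ χ [ append ℭ (append ℭ (entry ℭ t i) (entry ℭ t k)) e ]
      A i k χ = ⊨-rename ℭ {a = append ℭ (append ℭ (entry ℭ t i) (entry ℭ t k)) e} {a} χ λ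
        { (inj₁ (inj₁ j)) → Setoid.refl (Structure.Dom ℭ _)
        ; (inj₁ (inj₂ j)) → Setoid.refl (Structure.Dom ℭ _)
        ; (inj₂ y)        → Setoid.refl (Structure.Dom ℭ _) }

  -- A self-similar interval

  Moves : ∀ {ℓ m i} {L : Signature ℓ} {A : Structure L m} → Automorphism A →
          {Γ : Context (Sort L) i} → Tuple A Γ → Tuple A Γ → Set (m ⊔ i)
  Moves {A = A} F a b = ∀ j → Structure._≈_ A (Automorphism.to F (a j)) (b j)

  module Halving
    {ℓ} {L : Signature ℓ} {ℭ : Structure L (lsuc ℓ)} (ds : List (Sort L)) {Δ : Context (Sort L) ℓ}
    (θ : Formula L (block L ds ⊕ block L ds ⊕ Δ)) (e : Tuple ℭ Δ)
    (preorder : IsTotalPreorderOnField ℭ θ e) (x y z : Tuple ℭ (block L ds))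
    (x<y : Strict ℭ θ e x y) (y<z : Strict ℭ θ e y z) (α β : Automorphism ℭ)
    (α-x : Moves α x x)
    (α-z : Moves α z y)
    (α-e : Moves α e e)
    (β-x : Moves β x y)
    (β-z : Moves β z z)
    (β-e : Moves β e e)
    where

    open IsTotalPreorderOnField preorder

    private
      module S {t} = Setoid (Structure.Dom ℭ t)
      open Structure ℭ using (_≈_)

      D : Context (Sort L) ℓ
      D = block L ds

      infix 4 _⊴_
      _⊴_ : Tuple ℭ D → Tuple ℭ D → Set (lsuc ℓ)
      _⊴_ = Below ℭ θ e

      ⊴-resp : ∀ {u u′ v v′} → (∀ j → u j ≈ u′ j) → (∀ j → v j ≈ v′ j) → u ⊴ v → u′ ⊴ v′
      ⊴-resp = Below-resp ℭ θ e

      -- The inverses make the hull closed under preimages: every point of a half must come from a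
      -- point of the interval that lies in the hull.
      maps : Bool × Bool → ∀ {t} → ∣ ℭ ∣ t → ∣ ℭ ∣ t
      maps (false , false) {t} = Automorphism.to α
      maps (false , true)  {t} = Inverse.from (Automorphism.inverse α t)
      maps (true  , false) {t} = Automorphism.to β
      maps (true  , true)  {t} = Inverse.from (Automorphism.inverse β t)

    -- The initial context is that of `θ`, so the order of the hull is given by `hull-⊨ base`; the
    -- generators are the parameters and the three endpoints.
    open SkolemHull ℭ (D ⊕ D ⊕ Δ) (Δ ⊕ cube D) (append ℭ e (triple ℭ x y z)) maps public

    private
      values : Tuple hull D → Tuple ℭ D
      values u j = value (u j)

      e₀ : Tuple hull Δ
      e₀ i = generator (inj₁ i)

      x₀ z₀ : Tuple hull D
      x₀ j = generator (inj₂ (zero , j))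
      z₀ j = generator (inj₂ (suc (suc zero) , j))

      infix 4 _⊴₀_
      _⊴₀_ : Tuple hull D → Tuple hull D → Set ℓ
      _⊴₀_ = Below hull θ e₀

      ⊴₀⇔⊴ : ∀ u v → u ⊴₀ v ⇔ values u ⊴ values v
      ⊴₀⇔⊴ u v = mk⇔ (λ p → to same (to (hull-⊨ base θ (append hull (append hull u v) e₀)) p))
                      (λ p → from (hull-⊨ base θ (append hull (append hull u v) e₀)) (from same p))
        where
        same : ℭ ⊨ θ [ (λ k → value (append hull (append hull u v) e₀ k)) ] ⇔ values u ⊴ values v
        same = ⊨-resp ℭ {b = append ℭ (append ℭ (values u) (values v)) e}
          (λ { (inj₁ (inj₁ j)) → S.refl ; (inj₁ (inj₂ j)) → S.refl ; (inj₂ i) → S.refl }) θ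

      invariant : (F : Automorphism ℭ) → (∀ i → Automorphism.to F (e i) ≈ e i) →
                  ∀ u v → u ⊴ v ⇔ (λ j → Automorphism.to F (u j)) ⊴ (λ j → Automorphism.to F (v j))
      invariant F F-e u v = corr-⊨ (graph ℭ F)
        {a = append ℭ (append ℭ u v) e}
        {append ℭ (append ℭ (λ j → Automorphism.to F (u j)) (λ j → Automorphism.to F (v j))) e}
        (λ { (inj₁ (inj₁ j)) → S.refl ; (inj₁ (inj₂ j)) → S.refl ; (inj₂ i) → F-e i }) θ

      Interval : Tuple hull D → Set ℓ
      Interval u = x₀ ⊴₀ u × ¬ z₀ ⊴₀ u

      interval : ∀ u → x ⊴ values u → ¬ z ⊴ values u → Interval u
      interval u p q = from (⊴₀⇔⊴ x₀ u) p , q ∘ to (⊴₀⇔⊴ z₀ u)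

      lower-bound : ∀ u → Interval u → x ⊴ values u
      lower-bound u (p , _) = to (⊴₀⇔⊴ x₀ u) p

      upper-bound : ∀ u → Interval u → ¬ z ⊴ values u
      upper-bound u (_ , q) = q ∘ from (⊴₀⇔⊴ z₀ u)

      x⊴x : x ⊴ x
      x⊴x = ⊴-reflˡ (proj₁ x<y)

      y⊴y : y ⊴ y
      y⊴y = ⊴-reflʳ (proj₁ x<y)

      αₕ βₕ α⁻¹ β⁻¹ : Tuple hull D → Tuple hull D
      αₕ u j = image (false , false) (u j)
      βₕ u j = image (true , false) (u j)
      α⁻¹ u j = image (false , true) (u j)
      β⁻¹ u j = image (true , true) (u j)

      αα⁻¹ : ∀ u j → value (αₕ (α⁻¹ u) j) ≈ value (u j)
      αα⁻¹ u j = Inverse.strictlyInverseˡ (Automorphism.inverse α _) (value (u j))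

      ββ⁻¹ : ∀ u j → value (βₕ (β⁻¹ u) j) ≈ value (u j)
      ββ⁻¹ u j = Inverse.strictlyInverseˡ (Automorphism.inverse β _) (value (u j))

      α-lower : ∀ u → x ⊴ values u ⇔ x ⊴ values (αₕ u)
      α-lower u = mk⇔ (⊴-resp α-x (λ _ → S.refl) ∘ to (invariant α α-e x (values u)))
                      (from (invariant α α-e x (values u)) ∘ ⊴-resp (λ j → S.sym (α-x j)) (λ _ → S.refl))

      α-upper : ∀ u → z ⊴ values u ⇔ y ⊴ values (αₕ u)
      α-upper u = mk⇔ (⊴-resp α-z (λ _ → S.refl) ∘ to (invariant α α-e z (values u)))
                      (from (invariant α α-e z (values u)) ∘ ⊴-resp (λ j → S.sym (α-z j)) (λ _ → S.refl))

      β-lower : ∀ u → x ⊴ values u ⇔ y ⊴ values (βₕ u)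
      β-lower u = mk⇔ (⊴-resp β-x (λ _ → S.refl) ∘ to (invariant β β-e x (values u)))
                      (from (invariant β β-e x (values u)) ∘ ⊴-resp (λ j → S.sym (β-x j)) (λ _ → S.refl))

      β-upper : ∀ u → z ⊴ values u ⇔ z ⊴ values (βₕ u)
      β-upper u = mk⇔ (⊴-resp β-z (λ _ → S.refl) ∘ to (invariant β β-e z (values u)))
                      (from (invariant β β-e z (values u)) ∘ ⊴-resp (λ j → S.sym (β-z j)) (λ _ → S.refl))

      α-interval : ∀ u → Interval u → Interval (αₕ u)
      α-interval u p = interval (αₕ u) (to (α-lower u) (lower-bound u p))
        λ q → upper-bound u p (from (α-upper u) (⊴-trans (proj₁ y<z) q))

      β-interval : ∀ u → Interval u → Interval (βₕ u)
      β-interval u p = interval (βₕ u) (⊴-trans (proj₁ x<y) (to (β-lower u) (lower-bound u p)))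
        (upper-bound u p ∘ from (β-upper u))

      reflexive : ∀ u → Interval u → values u ⊴ values u
      reflexive u p = ⊴-reflʳ (lower-bound u p)

      below-y : ∀ u → Interval u → values (αₕ u) ⊴ y
      below-y u p = [ id , ⊥-elim ∘ upper-bound u p ∘ from (α-upper u) ]′
        (⊴-total (reflexive (αₕ u) (α-interval u p)) y⊴y)

      halve : ∀ w → Interval w →
              (Σ[ u ∈ ∃ Interval ] w ⊴₀ αₕ (proj₁ u) × αₕ (proj₁ u) ⊴₀ w) ⊎
              (Σ[ u ∈ ∃ Interval ] w ⊴₀ βₕ (proj₁ u) × βₕ (proj₁ u) ⊴₀ w)
      halve w p with em {P = y ⊴ values w}
      ... | yes y⊴w = inj₂ ((β⁻¹ w , interval (β⁻¹ w)
              (from (β-lower (β⁻¹ w)) (⊴-resp (λ _ → S.refl) (λ j → S.sym (ββ⁻¹ w j)) y⊴w))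
              (upper-bound w p ∘ ⊴-resp (λ _ → S.refl) (ββ⁻¹ w) ∘ to (β-upper (β⁻¹ w)))) ,
            from (⊴₀⇔⊴ w (βₕ (β⁻¹ w))) (⊴-resp (λ _ → S.refl) (λ j → S.sym (ββ⁻¹ w j)) (reflexive w p)) ,
            from (⊴₀⇔⊴ (βₕ (β⁻¹ w)) w) (⊴-resp (λ j → S.sym (ββ⁻¹ w j)) (λ _ → S.refl) (reflexive w p)))
      ... | no ¬y⊴w = inj₁ ((α⁻¹ w , interval (α⁻¹ w)
              (from (α-lower (α⁻¹ w)) (⊴-resp (λ _ → S.refl) (λ j → S.sym (αα⁻¹ w j)) (lower-bound w p)))
              (¬y⊴w ∘ ⊴-resp (λ _ → S.refl) (αα⁻¹ w) ∘ to (α-upper (α⁻¹ w)))) ,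
            from (⊴₀⇔⊴ w (αₕ (α⁻¹ w))) (⊴-resp (λ _ → S.refl) (λ j → S.sym (αα⁻¹ w j)) (reflexive w p)) ,
            from (⊴₀⇔⊴ (αₕ (α⁻¹ w)) w) (⊴-resp (λ j → S.sym (αα⁻¹ w j)) (λ _ → S.refl) (reflexive w p)))

    -- Leaving out the right endpoint makes the two halves disjoint, with `y` as the first point of
    -- the right one; `x`, which `α` fixes, serves as origin.
    half-open : SelfSimilar ℓ
    half-open = record
      { Point   = ∃ Interval
      ; _≲_     = λ (u , _) (v , _) → u ⊴₀ v
      ; ≲-refl  = λ {(u , p)} → from (⊴₀⇔⊴ u u) (reflexive u p)
      ; ≲-trans = λ {(u , _)} {(v , _)} {(w , _)} p q → from (⊴₀⇔⊴ u w) (⊴-trans (to (⊴₀⇔⊴ u v) p) (to (⊴₀⇔⊴ v w) q))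
      ; left    = λ (u , p) → αₕ u , α-interval u p
      ; right   = λ (u , p) → βₕ u , β-interval u p
      ; left-≲  = λ {(u , _)} {(v , _)} → mk⇔
          (λ p → from (⊴₀⇔⊴ u v) (from (invariant α α-e (values u) (values v)) (to (⊴₀⇔⊴ (αₕ u) (αₕ v)) p)))
          (λ p → from (⊴₀⇔⊴ (αₕ u) (αₕ v)) (to (invariant α α-e (values u) (values v)) (to (⊴₀⇔⊴ u v) p)))
      ; right-≲ = λ {(u , _)} {(v , _)} → mk⇔
          (λ p → from (⊴₀⇔⊴ u v) (from (invariant β β-e (values u) (values v)) (to (⊴₀⇔⊴ (βₕ u) (βₕ v)) p)))
          (λ p → from (⊴₀⇔⊴ (βₕ u) (βₕ v)) (to (invariant β β-e (values u) (values v)) (to (⊴₀⇔⊴ u v) p)))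
      ; left≲right  = λ {(u , p)} {(v , q)} → from (⊴₀⇔⊴ (αₕ u) (βₕ v))
          (⊴-trans (below-y u p) (to (β-lower v) (lower-bound v q)))
      ; right≴left  = λ {(u , p)} {(v , q)} r → upper-bound v q (from (α-upper v)
          (⊴-trans (to (β-lower u) (lower-bound u p)) (to (⊴₀⇔⊴ (βₕ u) (αₕ v)) r)))
      ; split       = λ (w , p) → halve w p
      ; origin      = x₀ , interval x₀ x⊴x λ z⊴x → proj₂ y<z (⊴-trans z⊴x (proj₁ x<y))
      ; origin-left = from (⊴₀⇔⊴ x₀ (αₕ x₀)) (⊴-resp (λ _ → S.refl) (λ j → S.sym (α-x j)) x⊴x)
                    , from (⊴₀⇔⊴ (αₕ x₀) x₀) (⊴-resp (λ j → S.sym (α-x j)) (λ _ → S.refl) x⊴x)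
      }

    hull-models : ∀ σ → ℭ ⊨ σ → hull ⊨ σ
    hull-models σ p = to (⊨-rename hull {a = λ ()} {append hull (append hull x₀ x₀) e₀} σ λ ())
      (from (hull-⊨ base (rename σ λ ()) (append hull (append hull x₀ x₀) e₀))
        (from (⊨-rename ℭ {a = λ ()} σ λ ()) p))

    open LascarDistance half-open using (iterate)
    open SelfSimilar half-open using (_≲_; ≲-refl; ≲-trans; left; right; right-≲; right≴left; origin; origin-left)

    -- `origin` lies in the left half and every later iterate in the right one. The iterates supply
    -- the parameters that name the copies of the interval.
    iterate-injective : ∀ {j k} → iterate j ≲ iterate k → iterate k ≲ iterate j → j ≡ k
    iterate-injective {zero}  {zero}  p q = refl
    iterate-injective {zero}  {suc k} p q = ⊥-elim (right≴left {iterate k} {origin}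
      (≲-trans {iterate (suc k)} {origin} {left origin} q (proj₁ origin-left)))
    iterate-injective {suc j} {zero}  p q = ⊥-elim (right≴left {iterate j} {origin}
      (≲-trans {iterate (suc j)} {origin} {left origin} p (proj₁ origin-left)))
    iterate-injective {suc j} {suc k} p q = cong suc (iterate-injective
      (to (right-≲ {iterate j} {iterate k}) p) (to (right-≲ {iterate k} {iterate j}) q))

    circle-interpretation : Interpretation hull (Circle.circle half-open)
    circle-interpretation = CircleInterpretation.interpretation hull ds θ e₀
      (λ {u} {v} {w} p q → from (⊴₀⇔⊴ u w) (⊴-trans (to (⊴₀⇔⊴ u v) p) (to (⊴₀⇔⊴ v w) q)))
      (proj₁ ∘ iterate) (λ k → ≲-refl {iterate k}) iterate-injective
      x₀ z₀ half-open _,_ (λ _ _ → mk⇔ id id)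
      (λ w → proj₁ w , proj₂ w , ≲-refl {w} , ≲-refl {w})

  -- Strictly increasing sequences against hereditary G-compactness

  module _ {ℓ} {L : Signature ℓ} {ℭ : Structure L (lsuc ℓ)} {D Δ : Context (Sort L) ℓ} where

    move-pair : ∀ {W} → IsMonster (Th W) ℭ → {u v u′ v′ : Tuple ℭ D} {e : Tuple ℭ Δ} →
      ℭ ⟪ append ℭ (append ℭ u v) e ⟫≼ ℭ ⟪ append ℭ (append ℭ u′ v′) e ⟫ →
      Σ[ F ∈ Automorphism ℭ ] Moves F u u′ × Moves F v v′ × Moves F e e
    move-pair monster {u} {v} {u′} {v′} {e} h =
      let (F , m) = homogeneous monster {a = append ℭ (append ℭ u v) e} {append ℭ (append ℭ u′ v′) e} h
      in F , (λ j → m (inj₁ (inj₁ j))) , (λ j → m (inj₁ (inj₂ j))) , λ i → m (inj₂ i)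

    Strict-resp-≼ : ∀ (θ : Formula L (D ⊕ D ⊕ Δ)) (e : Tuple ℭ Δ) {u v u′ v′} →
      ℭ ⟪ append ℭ (append ℭ u v) e ⟫≼ ℭ ⟪ append ℭ (append ℭ u′ v′) e ⟫ →
      Strict ℭ θ e u v → Strict ℭ θ e u′ v′
    Strict-resp-≼ θ e {u} {v} {u′} {v′} h (p , q) = h θ p , λ r → drop (h (∼ converse θ)
      (λ s → raise (q (to (converse-⊨ ℭ θ e u v) s))) (from (converse-⊨ ℭ θ e u′ v′) r))

  module _ {ℓ} {L : Signature ℓ} (T : Theory L) (M : Structure L ℓ) (ds : List (Sort L))
           (θ : Formula L (block L ds ⊕ block L ds ⊕ Elements M))
           (pre : IsTotalPreorderOnField M θ (elements M)) (c : ℕ → Tuple M (block L ds))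
           (c-strict : ∀ i j → i < j → Strict M θ (elements M) (c i) (c j))
           (M⊨T : M ⊨ᵀ T) (hgc : HereditarilyGCompact T) where

    open IdempotentTriple M θ c c-strict

    no-triple : ∀ {ℭ} → IsMonster (Th M) ℭ → ¬ Triple ℭ
    no-triple {ℭ} monster t = split (move-pair monster {x} {z} {x} {y} {e} xz≼xy)
                                    (move-pair monster {x} {z} {y} {z} {e} xz≼yz)
      where
      open Triple t
      -- Equal types carry the strict inequality from (x, y) to (x, z) and on to (y, z).
      y<z : Strict ℭ θ e y z
      y<z = Strict-resp-≼ {ℭ = ℭ} θ e {x} {z} {y} {z} xz≼yz (Strict-resp-≼ {ℭ = ℭ} θ e {x} {y} {x} {z}
        (≼-converse {A = ℭ} {ℭ} {a = append ℭ (append ℭ x z) e} {append ℭ (append ℭ x y) e} xz≼xy) x<y)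
      preℭ : IsTotalPreorderOnField ℭ θ e
      preℭ = transfer-preorder {A = M} {ℭ} {a = elements M} {e} e-elementary θ pre
      split : Σ[ F ∈ Automorphism ℭ ] Moves F x x × Moves F z y × Moves F e e →
              Σ[ F ∈ Automorphism ℭ ] Moves F x y × Moves F z z × Moves F e e → ⊥
      split (α , α-x , α-z , α-e) (β , β-x , β-z , β-e) =
        circle-not-GCompact half-open (hgc hull (λ σ p → hull-models σ (IsMonster.model monster σ (M⊨T σ p)))
          _ (Circle.circle half-open) circle-interpretation)
        where open Halving {ℭ = ℭ} ds θ e preℭ x y z x<y y<z α β α-x α-z α-e β-x β-z β-e

    strict-sequence-absurd : ⊥
    strict-sequence-absurd = no-triple (proj₁ (proj₂ compact)) (find (proj₁ (proj₂ compact)))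
      -- G-compactness of `Th M` is the source of the monster model in which the triple is found.
      where compact = hgc M M⊨T L M (self-interpretation M)

  -- Interpreted linear orders

  -- A tuple from the gap between the i-th definable set and the next one lies in exactly the later
  -- sets of the chain.
  SOP⇒¬Stable : ∀ {ℓ} {L : Signature ℓ} (T : Theory L) → SOP T → ¬ Stable T
  SOP⇒¬Stable T (X , Y , φ , M , M⊨T , b , strict) stable = stable X Y φ
    (M , M⊨T , (λ i → proj₁ (gap i)) , b , λ i j → mk⇔ (forth i j) (back i j))
    where
    gap : ∀ i → Σ[ a ∈ Tuple M ⟦ X ⟧ ] M ⊨ φ [ a ⊞ b (suc i) ] × ¬ M ⊨ φ [ a ⊞ b i ]
    gap i = dne {q = 0ℓ} λ k → proj₂ (strict i (suc i) ≤-refl) λ {a} p → dne λ q →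
      drop (k (a , p , λ r → drop {0ℓ} (q r)))
    monotone : ∀ {i j} → i ≤ j → ∀ a → M ⊨ φ [ a ⊞ b i ] → M ⊨ φ [ a ⊞ b j ]
    monotone i≤j a p with m≤n⇒m<n∨m≡n i≤j
    ... | inj₁ i<j  = proj₁ (strict _ _ i<j) p
    ... | inj₂ refl = p
    forth : ∀ i j → M ⊨ φ [ proj₁ (gap i) ⊞ b j ] → i < j
    forth i j p = ≰⇒> λ j≤i → proj₂ (proj₂ (gap i)) (monotone j≤i (proj₁ (gap i)) p)
    back : ∀ i j → i < j → M ⊨ φ [ proj₁ (gap i) ⊞ b j ]
    back i j i<j = monotone i<j (proj₁ (gap i)) (proj₁ (proj₂ (gap i)))

  module InterpretedOrder {ℓ} {L : Signature ℓ} (M : Structure L ℓ)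
    (N : Structure (orderSignature ℓ) ℓ) (infinite-linear : IsInfiniteLinearOrder N)
    (interpretation : Interpretation M N) where

    open Interpretation interpretation
    open Structure N using (_≈_; rel; rel-resp; Dom)
    private
      module O = IsTotalOrder (IsInfiniteLinearOrder.isTotalOrder infinite-linear)

      Ends : Set ℓ
      Ends = ∀ k → ∣ N ∣ (lookup (tt ∷ tt ∷ []) k)

      ends : ∣ N ∣ tt → ∣ N ∣ tt → Ends
      ends a b zero       = a
      ends a b (suc zero) = b

      rel-ends : {xs ys : Ends} → xs zero ≈ ys zero → xs (suc zero) ≈ ys (suc zero) → rel le xs → rel le ys
      rel-ends e f = rel-resp le λ { zero → e ; (suc zero) → f }

      -- The order of N, in a form from which the endpoints can be inferred.
      infix 4 _⊑_
      record _⊑_ (a b : ∣ N ∣ tt) : Set ℓ where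
        constructor wrap
        field unwrap : rel le (ends a b)

      ⊑-trans : ∀ {a b c} → a ⊑ b → b ⊑ c → a ⊑ c
      ⊑-trans {a} {b} {c} (wrap p) (wrap q) = wrap (rel-ends O.Eq.refl O.Eq.refl
        (O.trans {a} {b} {c} (rel-ends O.Eq.refl O.Eq.refl p) (rel-ends O.Eq.refl O.Eq.refl q)))

      ⊑-reflexive : ∀ {a b} → a ≈ b → a ⊑ b
      ⊑-reflexive e = wrap (rel-ends O.Eq.refl O.Eq.refl (O.reflexive e))

      ⊑-total : ∀ a b → a ⊑ b ⊎ b ⊑ a
      ⊑-total a b = Sum.map (wrap ∘ rel-ends O.Eq.refl O.Eq.refl) (wrap ∘ rel-ends O.Eq.refl O.Eq.refl)
        (O.total a b)

      ⊑-antisym : ∀ {a b} → a ⊑ b → b ⊑ a → a ≈ b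
      ⊑-antisym {a} {b} (wrap p) (wrap q) =
        O.antisym {a} {b} (rel-ends O.Eq.refl O.Eq.refl p) (rel-ends O.Eq.refl O.Eq.refl q)

      module M≈ {t} = Setoid (Structure.Dom M t)
      open Injection (IsInfiniteLinearOrder.infinite infinite-linear) using ()
        renaming (to to element; injective to element-injective)

      ds : List (Sort L)
      ds = dim tt

      D : Context (Sort L) ℓ
      D = block L ds

      Pair : Context (Sort L) 0ℓ
      Pair = Reps (tt ∷ tt ∷ [])

      flat : Tuple M D → Rep tt
      flat u j = u (lift j)

      reps : Tuple M D → Tuple M D → Tuple M Pair
      reps u v (zero , j)     = flat u j
      reps u v (suc zero , j) = flat v j

      unflatten : ∀ x → Term L (D ⊕ D ⊕ Elements M) (sort (Pair ⊕ Elements M) x)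
      unflatten (inj₁ (zero , j))     = var (inj₁ (inj₁ (lift j)))
      unflatten (inj₁ (suc zero , j)) = var (inj₁ (inj₂ (lift j)))
      unflatten (inj₂ y)              = var (inj₂ y)

    θ : Formula L (D ⊕ D ⊕ Elements M)
    θ = rename (proj₁ (rel-definable le)) unflatten

    private
      Ordered : Tuple M D → Tuple M D → Set ℓ
      Ordered u v = Σ[ p ∈ U tt (flat u) ] Σ[ q ∈ U tt (flat v) ] coord tt (flat u , p) ⊑ coord tt (flat v , q)

      θ-⊨ : ∀ u v → Below M θ (elements M) u v ⇔ Ordered u v
      θ-⊨ u v = mk⇔ (λ h → ordered (from defined (to renamed h)))
                     (λ h → from renamed (to defined (unordered h)))
        where
        renamed : Below M θ (elements M) u v ⇔
                  M ⊨ proj₁ (rel-definable le) [ append M (reps u v) (elements M) ]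
        renamed = ⊨-rename M {b = append M (append M u v) (elements M)} (proj₁ (rel-definable le)) λ
          { (inj₁ (zero , j)) → M≈.refl ; (inj₁ (suc zero , j)) → M≈.refl ; (inj₂ y) → M≈.refl }
        Related : Set ℓ
        Related = Σ[ p ∈ (∀ k → U (lookup (tt ∷ tt ∷ []) k) (curry (reps u v) k)) ]
          rel le (λ k → coord (lookup (tt ∷ tt ∷ []) k) (curry (reps u v) k , p k))
        defined : Related ⇔ M ⊨ proj₁ (rel-definable le) [ append M (reps u v) (elements M) ]
        defined = proj₂ (rel-definable le) (reps u v)
        ordered : Related → Ordered u v
        ordered (p , r) = p zero , p (suc zero) , wrap
          (rel-ends O.Eq.refl O.Eq.refl r)
        unordered : Ordered u v → Related
        unordered (p , q , wrap r) = (λ { zero → p ; (suc zero) → q }) ,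
          rel-ends O.Eq.refl O.Eq.refl r

      -- `coord` takes the membership proof as an argument, and `U` need not have unique proofs.
      coord-unique : ∀ {r} (p q : U tt r) → coord tt (r , p) ≈ coord tt (r , q)
      coord-unique p q = coord-cong tt λ _ → M≈.refl

      link : ∀ {r a b} (p q : U tt r) → a ⊑ coord tt (r , p) → coord tt (r , q) ⊑ b → a ⊑ b
      link p q h k = ⊑-trans h (⊑-trans (⊑-reflexive (coord-unique p q)) k)

    preorder : IsTotalPreorderOnField M θ (elements M)
    preorder = record
      { ⊴-trans = λ {u} {v} {w} h k → from (θ-⊨ u w) (trans′ (to (θ-⊨ u v) h) (to (θ-⊨ v w) k))
      ; ⊴-reflˡ = λ {u} {v} h → from (θ-⊨ u u) (let (p , _) = to (θ-⊨ u v) h in p , p , ⊑-reflexive O.Eq.refl)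
      ; ⊴-reflʳ = λ {u} {v} h → from (θ-⊨ v v) (let (_ , q , _) = to (θ-⊨ u v) h in q , q , ⊑-reflexive O.Eq.refl)
      ; ⊴-total = λ {u} {v} h k → Sum.map (from (θ-⊨ u v)) (from (θ-⊨ v u))
          (total′ (to (θ-⊨ u u) h) (to (θ-⊨ v v) k))
      }
      where
      trans′ : ∀ {u v w} → Ordered u v → Ordered v w → Ordered u w
      trans′ (p , q , h) (q′ , r , k) = p , r , link q q′ h k
      total′ : ∀ {u v} → Ordered u u → Ordered v v → Ordered u v ⊎ Ordered v u
      total′ (p , _) (q , _) = Sum.map (λ h → p , q , h) (λ h → q , p , h) (⊑-total _ _)

    private
      representative : ℕ → Tuple M D
      representative i j = proj₁ (proj₁ (coord-surj tt (element i))) (lower j)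

      θ-representative : ∀ i j → Below M θ (elements M) (representative i) (representative j) ⇔
                                 element i ⊑ element j
      θ-representative i j = mk⇔
        (λ h → let (p , q , k) = to (θ-⊨ (representative i) (representative j)) h in
           ⊑-trans (⊑-reflexive (O.Eq.trans (O.Eq.sym (eq i)) (coord-unique _ p)))
             (⊑-trans k (⊑-reflexive (O.Eq.trans (coord-unique q _) (eq j)))))
        (λ h → from (θ-⊨ (representative i) (representative j)) (proj₂ (point i) , proj₂ (point j) ,
           ⊑-trans (⊑-reflexive (eq i)) (⊑-trans h (⊑-reflexive (O.Eq.sym (eq j))))))
        where
        point = λ i → proj₁ (coord-surj tt (element i))
        eq : ∀ i → coord tt (point i) ≈ element i
        eq i = proj₂ (coord-surj tt (element i))

      open Ramsey

      monotone-sequence : Σ[ h ∈ (ℕ → ℕ) ] Increasing h ×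
        ((∀ i j → i < j → element (h i) ⊑ element (h j)) ⊎ (∀ i j → i < j → element (h j) ⊑ element (h i)))
      monotone-sequence = let (h , inc , c) = ramsey (λ i j → element i ⊑ element j) in h , inc ,
        Sum.map id (λ blue i j i<j → [ ⊥-elim ∘ blue i j i<j , id ]′ (⊑-total _ _)) c

      distinct : ∀ {h : ℕ → ℕ} → Increasing h → ∀ {i j} → i < j → element (h i) ⊑ element (h j) →
                 ¬ element (h j) ⊑ element (h i)
      distinct inc i<j p q = <-irrefl (element-injective (⊑-antisym p q)) (inc i<j)

    -- A decreasing sequence is an increasing one for the converse order.
    chain : Σ[ θ ∈ Formula L (block L (dim tt) ⊕ block L (dim tt) ⊕ Elements M) ]
            IsTotalPreorderOnField M θ (elements M) ×
            Σ[ c ∈ (ℕ → Tuple M (block L (dim tt))) ] (∀ i j → i < j → Strict M θ (elements M) (c i) (c j))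
    chain = let (h , inc , direction) = monotone-sequence in
      [ (λ up → θ , preorder , representative ∘ h , λ i j i<j →
          from (θ-representative (h i) (h j)) (up i j i<j) ,
          distinct inc i<j (up i j i<j) ∘ to (θ-representative (h j) (h i)))
      , (λ down → converse θ , converse-preorder M θ (elements M) preorder , representative ∘ h , λ i j i<j →
          from (converse-⊨ M θ (elements M) _ _) (from (θ-representative (h j) (h i)) (down i j i<j)) ,
          λ q → distinct inc i<j (to (θ-representative (h i) (h j)) (to (converse-⊨ M θ (elements M) _ _) q))
                         (down i j i<j)) ]′ direction

  interpreted-order⇒¬HGC : ∀ {ℓ} {L : Signature ℓ} (T : Theory L) →
    InterpretsInfiniteLinearOrder T → ¬ HereditarilyGCompact T
  interpreted-order⇒¬HGC T (M , M⊨T , N , infinite-linear , interpretation) hgc =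
    let (θ , pre , c , c-strict) = InterpretedOrder.chain M N infinite-linear interpretation
    in strict-sequence-absurd T M (Interpretation.dim interpretation tt) θ pre c c-strict M⊨T hgc

corollary4p11 : (∀ {a} → ExcludedMiddle a) →
    ∀ {ℓ} →
    (∀ (L : Signature ℓ) (T : Theory L) → Complete T → NIP T → ¬ Stable T →
    InterpretsInfiniteLinearOrder T) →
    ∀ (L : Signature ℓ) (T : Theory L) → Complete T → NIP T → SOP T →
    ¬ HereditarilyGCompact T
corollary4p11 em conjecture L T complete nip sop =
  interpreted-order⇒¬HGC T (conjecture L T complete nip (SOP⇒¬Stable T sop))
  where open Classical em
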